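{- Let $CP_3(n)$ be defined by $\sum_{n\ge 0} CP_3(n)q^n = \dfrac{f_3^6f_6^6}{f_1^2f_2^2}$. Then for all integers $n\ge 0$, \[ CP_3(8n+3)\equiv 0\pmod{8},\qquad CP_3(8n+7)\equiv 0\pmod{16}. \]
   Context: For $|q|<1$ and integer $m\ge 1$, $f_m := (q^m;q^m)_\infty=\prod_{n\ge1}(1-q^{mn})$. $CP_3(n)$ is the number of $3$-core cubic bipartitions of $n$, defined by the generating function $\sum_{n\ge0}CP_3(n)q^n = \frac{f_3^6f_6^6}{f_1^2f_2^2}$. -}

module Defs where

open import Data.Nat using (ℕ; zero; suc; _∸_) renaming (_*_ to _*ℕ_; _+_ to _+ℕ_)
open import Data.Integer using (ℤ; +_; _+_; _*_; -_)
open import Data.List using (List; []; _∷_; map; upTo; foldr)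
open import Data.Nat.Divisibility using (_∣_)

Series : Set
Series = ℕ → ℤ

sumℤ : List ℤ → ℤ
sumℤ = foldr _+_ (+ 0)

_·_ : Series → Series → Series
(a · b) n = sumℤ (map (λ k → a k * b (n ∸ k)) (upTo (suc n)))

infixl 7 _·_

one : Series
one zero    = + 1
one (suc _) = + 0

-- Coefficients of the polynomial 1 - q^d  (for d ≥ 1).
oneMinusQ^ : ℕ → Series
oneMinusQ^ d zero    = + 1
oneMinusQ^ d (suc n) = δ d (suc n)
  where
  δ : ℕ → ℕ → ℤ
  δ zero    zero    = - (+ 1)
  δ zero    (suc _) = + 0
  δ (suc _) zero    = + 0
  δ (suc a) (suc b) = δ a b

eulerTrunc : ℕ → ℕ → Series
eulerTrunc m zero    = one
eulerTrunc m (suc N) = eulerTrunc m N · oneMinusQ^ (m *ℕ suc N)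

-- f_m = (q^m; q^m)_∞ = Π_{n ≥ 1} (1 - q^{m n}), as a formal power series.
-- For m ≥ 1 the coefficient of q^n is already determined by the factors
-- with k ≤ n, so we read it off the truncated product with N = n.
f : ℕ → Series
f m n = eulerTrunc m n n

_^s_ : Series → ℕ → Series
s ^s zero  = one
s ^s suc k = s · (s ^s k)

_≡ℤ0mod_ : ℤ → ℕ → Set
x ≡ℤ0mod d = d ∣ Data.Integer.∣ x ∣

{-# OPTIONS --safe #-}

-- Let φ(q) = ∑_{x ∈ ℤ} q^(x²), ψ(q) = ∑_{n ≥ 0} q^(n(n+1)/2), Φ(q) = φ(-q), and write x_k = x(q^k).
-- Gauss's identities f_2 Φ = f_1² and f_1 ψ = f_2² follow from finite forms whose partial sums telescope
-- (Shanks).  The change of variables x² + 3y² ↦ ((x+3y)/2)² + 3((x-y)/2)² gives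
--   ψ ψ_3 = ψ_4 φ_6 + q φ_2 ψ_12.
-- Eliminating products yields CP_3 = (f_6/f_2)^6 (Φ_3² ψ ψ_3)², where f_6/f_2 is a series in q².
-- Splitting Φ_3² ψ ψ_3 into even and odd parts U(q²) + q V(q²), the odd part of CP_3 is
-- 2 (f_3/f_1)^6 U V.  Because φ, Φ ≡ 1 mod 2, Φ⁴ ≡ 1 mod 8 and φ = Φ + 4qψ_8, the series
-- (f_3/f_1)^6 U V is, modulo 8, of the form E(q²) + 4q (ψ_4 ψ_6)(q²), and ψ_4 ψ_6 is a series in q².
module Submission where

open import Defs
open import Algebra.Bundles using (CommutativeRing)
open import Algebra.Definitions using (Congruent₁; Congruent₂)
import Algebra.Properties.CommutativeSemiring.Exp
import Algebra.Properties.Group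
import Algebra.Properties.Ring
import Algebra.Properties.Semiring.Mult.TCOptimised
import Algebra.Solver.Ring
open import Algebra.Solver.Ring.AlmostCommutativeRing
  using (fromCommutativeRing; _-Raw-AlmostCommutative⟶_)
open import Algebra.Structures using (IsCommutativeRing)
open import Data.Empty using (⊥-elim)
open import Data.Integer using (ℤ)
open import Data.Integer.Base as ℤ using (+_; -[1+_]; 0ℤ; 1ℤ)
import Data.Integer.Properties as ℤ
import Data.Integer.Solver
open import Data.List.Base
  using (List; []; _∷_; [_]; _++_; map; filter; length; concat; upTo; downFrom; cartesianProduct)
open import Data.List.Membership.Propositional using (_∈_)
open import Data.List.Membership.Propositional.Properties
  using (∈-map⁺; ∈-map⁻; ∈-++⁺ˡ; ∈-++⁺ʳ; ∈-++⁻; ∈-concat⁺′; ∈-concat⁻′; ∈-cartesianProduct⁺; ∈-cartesianProduct⁻;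
         ∈-upTo⁺; ∈-upTo⁻; ∈-downFrom⁺; ∈-filter⁺; ∈-filter⁻)
open import Data.List.Membership.Propositional.Properties.WithK using (unique∧set⇒bag)
open import Data.List.Properties
  using (length-map; length-++; filter-accept; filter-reject; map-applyUpTo; map-upTo)
open import Data.List.Relation.Binary.BagAndSetEquality using (∼bag⇒↭)
open import Data.List.Relation.Binary.Permutation.Propositional.Properties using (↭-length)
import Data.List.Relation.Unary.All as All
import Data.List.Relation.Unary.All.Properties as All
import Data.List.Relation.Unary.AllPairs.Properties as AllPairs
open import Data.List.Relation.Unary.Any using (here)
open import Data.List.Relation.Unary.Unique.Propositional using (Unique; []; _∷_)
import Data.List.Relation.Unary.Unique.Propositional.Properties as Unique
open import Data.Maybe.Base using (Maybe; just; nothing)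
open import Data.Nat using (ℕ)
open import Data.Nat.Base as ℕ using (zero; suc; _≤_; _<_; z≤n; s≤s; _∸_)
open import Data.Nat.Divisibility using (_∣?_; divides)
import Data.Nat.Properties as ℕ
import Data.Nat.Solver
open import Data.Product using (∃; _×_; _,_; proj₁; proj₂)
open import Data.Sum.Base using (_⊎_; inj₁; inj₂; [_,_]′)
open import Data.Sum.Function.Propositional using (_⊎-↔_)
open import Data.Sum.Properties using (inj₁-injective; inj₂-injective)
open import Data.Unit.Base using (⊤; tt)
open import Function.Base using (_∘_)
open import Function.Bundles using (_↔_; mk↔ₛ′; mk⇔; Inverse)
open import Function.Properties.Inverse using (↔-trans)
open import Level using (_⊔_)
open import Relation.Binary.Core using (Rel)
open import Relation.Binary.PropositionalEquality as ≡
  using (_≡_; _≢_; _≗_; cong; cong₂; subst)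
import Relation.Binary.Reasoning.Setoid
open import Relation.Binary.Structures using (IsEquivalence)
open import Relation.Nullary using (Dec; yes; no)

-- Write `g` = (f_3/f_1)³. The obstacle is that g² is not a series in q² and must still be
-- controlled modulo 8. The exact relation g² Φ³ = g_2 Φ_3³ with Φ⁴ ≡ Φ_3⁴ ≡ 1 trades g² Φ Φ_3 for
-- g_2 Φ²; every other occurrence of g² carries a factor 4, where g² ≡ g_2 modulo 2 is enough. What
-- is then odd in q is 4 times a series needed only modulo 2. The two terms 4 q g_2 ψ_8 ψ_2 ψ_6
-- cancel modulo 8, and the rest collapses to ψ_4 ψ_6 by a second use of the identity for ψ ψ_3. The
-- outcome is CP_3(4n+3) ≡ 8 w(n) modulo 16 with w a series in q²: even n gives 8n+3 and the factor
-- 8, odd n gives 8n+7, where w(n) = 0. Division is avoided throughout: f_1 has constant term 1, so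
-- a reciprocal series stands for 1/f_1, and Gauss's identities are proved modulo q^N for every N.

-- Polynomial identities over a commutative ring, coarser equalities and quotients.

module IntegerCoefficients {c ℓ} (R : CommutativeRing c ℓ) where
  open CommutativeRing R
  open Algebra.Properties.Ring ring
  open Algebra.Properties.Semiring.Mult.TCOptimised semiring
    using (×-homo-+; ×1-homo-*; 1+×) renaming (_×_ to _×′_)
  open Relation.Binary.Reasoning.Setoid setoid

  -- The canonical map from ℤ. With this form of multiples, `ι (+ 1)` is `1#` and `ι (+ 2)` is
  -- `1# + 1#` by computation, so solver constants match literal ring expressions.
  ι : ℤ → Carrier
  ι (+ n)      = n ×′ 1#
  ι (-[1+ n ]) = - (suc n ×′ 1#)

  ι-⊖ : ∀ m n → ι (m ℤ.⊖ n) ≈ m ×′ 1# - n ×′ 1#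
  ι-⊖ m       zero    = sym (trans (+-congˡ -0#≈0#) (+-identityʳ _))
  ι-⊖ zero    (suc n) = sym (+-identityˡ _)
  ι-⊖ (suc m) (suc n) = begin
    ι (suc m ℤ.⊖ suc n)                     ≡⟨ ≡.cong ι (ℤ.[1+m]⊖[1+n]≡m⊖n m n) ⟩
    ι (m ℤ.⊖ n)                             ≈⟨ ι-⊖ m n ⟩
    x - y                                   ≈⟨ +-congʳ (+-identityˡ x) ⟨
    0# + x - y                              ≈⟨ +-congʳ (+-congʳ (-‿inverseʳ 1#)) ⟨
    1# - 1# + x - y                         ≈⟨ +-congʳ (+-assoc _ _ _) ⟩
    1# + (- 1# + x) - y                     ≈⟨ +-congʳ (+-congˡ (+-comm _ _)) ⟩
    1# + (x - 1#) - y                       ≈⟨ +-congʳ (+-assoc _ _ _) ⟨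
    1# + x - 1# - y                         ≈⟨ +-assoc _ _ _ ⟩
    1# + x + (- 1# - y)                     ≈⟨ +-congˡ (-‿+-comm 1# y) ⟩
    1# + x - (1# + y)                       ≈⟨ +-cong (1+× m 1#) (-‿cong (1+× n 1#)) ⟨
    suc m ×′ 1# - suc n ×′ 1#               ∎
    where x = m ×′ 1# ; y = n ×′ 1#

  ι-neg : ∀ i → ι (ℤ.- i) ≈ - ι i
  ι-neg (+ zero)   = sym -0#≈0#
  ι-neg (+ suc n)  = refl
  ι-neg (-[1+ n ]) = sym (-‿involutive _)

  ι-+ : ∀ i j → ι (i ℤ.+ j) ≈ ι i + ι j
  ι-+ (+ m)      (+ n)      = ×-homo-+ 1# m n
  ι-+ (+ m)      (-[1+ n ]) = ι-⊖ m (suc n)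
  ι-+ (-[1+ m ]) (+ n)      = trans (ι-⊖ n (suc m)) (+-comm _ _)
  ι-+ (-[1+ m ]) (-[1+ n ]) = begin
    ι (-[1+ m ] ℤ.+ -[1+ n ])               ≡⟨ ≡.cong ι (≡.sym (ℤ.neg-distrib-+ (+ suc m) (+ suc n))) ⟩
    ι (ℤ.- (+ suc m ℤ.+ + suc n))           ≈⟨ ι-neg (+ suc m ℤ.+ + suc n) ⟩
    - ι (+ suc m ℤ.+ + suc n)               ≈⟨ -‿cong (×-homo-+ 1# (suc m) (suc n)) ⟩
    - (suc m ×′ 1# + suc n ×′ 1#)           ≈⟨ -‿+-comm _ _ ⟨
    - (suc m ×′ 1#) - suc n ×′ 1#           ∎

  ι-*ℕ : ∀ m j → ι (+ m ℤ.* j) ≈ ι (+ m) * ι j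
  ι-*ℕ m (+ n) = trans (reflexive (≡.cong ι (≡.sym (ℤ.pos-* m n)))) (×1-homo-* m n)
  ι-*ℕ m (-[1+ n ]) = begin
    ι (+ m ℤ.* (ℤ.- + suc n))               ≡⟨ ≡.cong ι (ℤ.neg-distribʳ-* (+ m) (+ suc n)) ⟨
    ι (ℤ.- (+ m ℤ.* + suc n))               ≈⟨ ι-neg (+ m ℤ.* + suc n) ⟩
    - ι (+ m ℤ.* + suc n)                   ≈⟨ -‿cong (ι-*ℕ m (+ suc n)) ⟩
    - (ι (+ m) * ι (+ suc n))               ≈⟨ -‿distribʳ-* _ _ ⟩
    ι (+ m) * ι (-[1+ n ])                  ∎

  ι-* : ∀ i j → ι (i ℤ.* j) ≈ ι i * ι j
  ι-* (+ m)      j = ι-*ℕ m j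
  ι-* (-[1+ m ]) j = begin
    ι ((ℤ.- + suc m) ℤ.* j)                 ≡⟨ ≡.cong ι (ℤ.neg-distribˡ-* (+ suc m) j) ⟨
    ι (ℤ.- (+ suc m ℤ.* j))                 ≈⟨ ι-neg (+ suc m ℤ.* j) ⟩
    - ι (+ suc m ℤ.* j)                     ≈⟨ -‿cong (ι-*ℕ (suc m) j) ⟩
    - (ι (+ suc m) * ι j)                   ≈⟨ -‿distribˡ-* _ _ ⟩
    ι (-[1+ m ]) * ι j                      ∎

  ι-morphism : CommutativeRing.rawRing ℤ.+-*-commutativeRing
                 -Raw-AlmostCommutative⟶ fromCommutativeRing R
  ι-morphism = record
    { ⟦_⟧ = ι ; +-homo = ι-+ ; *-homo = ι-* ; -‿homo = ι-neg
    ; 0-homo = refl ; 1-homo = refl }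

  ι≟ : ∀ i j → Maybe (ι i ≈ ι j)
  ι≟ i j with i ℤ.≟ j
  ... | yes i≡j = just (reflexive (≡.cong ι i≡j))
  ... | no  _   = nothing

  open Algebra.Solver.Ring _ (fromCommutativeRing R) ι-morphism ι≟ public
    using (solve; _:=_; _:+_; _:*_; _:-_; :-_; con)

module Coarsening {c ℓ} (R : CommutativeRing c ℓ) where
  open CommutativeRing R

  -- The ring axioms are equations and survive any coarsening; only compatibility with the
  -- operations has to be supplied. This yields both the quotients R/m and the series modulo q^N.
  coarsen : ∀ {ℓ′} (_∼_ : Rel Carrier ℓ′) →
            IsEquivalence _∼_ → (∀ {x y} → x ≈ y → x ∼ y) →
            Congruent₂ _∼_ _+_ → Congruent₂ _∼_ _*_ → Congruent₁ _∼_ (-_) →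
            CommutativeRing c ℓ′
  coarsen _∼_ isEq incl +-cg *-cg neg-cg = record
    { Carrier = Carrier ; _≈_ = _∼_ ; _+_ = _+_ ; _*_ = _*_ ; -_ = -_ ; 0# = 0# ; 1# = 1#
    ; isCommutativeRing = record
      { isRing = record
        { +-isAbelianGroup = record
          { isGroup = record
            { isMonoid = record
              { isSemigroup = record
                { isMagma = record { isEquivalence = isEq ; ∙-cong = +-cg }
                ; assoc = λ x y z → incl (+-assoc x y z) }
              ; identity = (λ x → incl (+-identityˡ x)) , (λ x → incl (+-identityʳ x)) }
            ; inverse = (λ x → incl (-‿inverseˡ x)) , (λ x → incl (-‿inverseʳ x))
            ; ⁻¹-cong = neg-cg }
          ; comm = λ x y → incl (+-comm x y) }
        ; *-cong = *-cg
        ; *-assoc = λ x y z → incl (*-assoc x y z)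
        ; *-identity = (λ x → incl (*-identityˡ x)) , (λ x → incl (*-identityʳ x))
        ; distrib = (λ x y z → incl (distribˡ x y z)) , (λ x y z → incl (distribʳ x y z)) }
      ; *-comm = λ x y → incl (*-comm x y) } }

module Quotient {c ℓ} (R : CommutativeRing c ℓ) (m : CommutativeRing.Carrier R) where
  open CommutativeRing R
  open IntegerCoefficients R

  infix 4 _≈ₘ_
  -- The cofactor `t` is kept as data: it can be dilated along with a congruence of series, and its
  -- coefficients witness the final divisibility.
  _≈ₘ_ : Rel Carrier (c ⊔ ℓ)
  x ≈ₘ y = ∃ λ t → x ≈ y + m * t

  ≈⇒≈ₘ : ∀ {x y} → x ≈ y → x ≈ₘ y
  ≈⇒≈ₘ {y = y} e = 0# , trans e
    (solve 2 (λ y m → y := y :+ m :* con (+ 0)) refl y m)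

  quotient : CommutativeRing c (c ⊔ ℓ)
  quotient = Coarsening.coarsen R _≈ₘ_
    (record
      { refl  = ≈⇒≈ₘ refl
      ; sym   = λ { {x} {y} (s , p) → - s , trans
          (solve 3 (λ y m s → y := y :+ m :* s :+ m :* (:- s)) refl y m s)
          (+-congʳ (sym p)) }
      ; trans = λ { {x} {y} {z} (s , p) (t , q) → t + s , trans (trans p (+-congʳ q))
          (solve 4 (λ z m s t → z :+ m :* t :+ m :* s := z :+ m :* (t :+ s)) refl z m s t) } })
    ≈⇒≈ₘ
    (λ { {x} {y} {u} {v} (s , p) (t , q) → s + t , trans (+-cong p q)
      (solve 5 (λ y v m s t → y :+ m :* s :+ (v :+ m :* t) := y :+ v :+ m :* (s :+ t))
        refl y v m s t) })
    (λ { {x} {y} {u} {v} (s , p) (t , q) → y * t + s * v + m * s * t , trans (*-cong p q)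
      (solve 5 (λ y v m s t → (y :+ m :* s) :* (v :+ m :* t)
                  := y :* v :+ m :* (y :* t :+ s :* v :+ m :* s :* t))
        refl y v m s t) })
    (λ { {x} {y} (s , p) → - s , trans (-‿cong p)
      (solve 3 (λ y m s → :- (y :+ m :* s) := :- y :+ m :* (:- s)) refl y m s) })

-- Finite theta sums and the telescoping forms of Gauss's identities.

module FiniteSum {c ℓ} (R : CommutativeRing c ℓ) where
  open CommutativeRing R
  open Algebra.Properties.CommutativeSemiring.Exp commutativeSemiring using (_^_)

  ∑ : (ℕ → Carrier) → ℕ → Carrier
  ∑ g zero    = 0#
  ∑ g (suc n) = ∑ g n + g n

  -- ε = 1 gives partial sums of φ(q), ε = -1 those of φ(-q). Writing ε^m q^(m²) as (ε q^m)^m makes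
  -- each term a power z^m at z = ε q^m, the form in which it arises below.
  theta : Carrier → Carrier → ℕ → Carrier
  theta q ε n = 1# + (1# + 1#) * ∑ (λ m → (ε * q ^ suc m) ^ suc m) n

  -- The first 2n triangular numbers, split by parity of the index: T_{2m} = m(2m+1) and T_{2m+1} =
  -- (m+1)(2m+1).
  triangular : Carrier → ℕ → Carrier
  triangular q n = ∑ (λ m → q ^ (m ℕ.* (1 ℕ.+ 2 ℕ.* m))) n
                 + ∑ (λ m → q ^ (suc m ℕ.* (1 ℕ.+ 2 ℕ.* m))) n

module GaussTriangular {c ℓ} (R : CommutativeRing c ℓ) (q : CommutativeRing.Carrier R) where
  open CommutativeRing R
  open IntegerCoefficients R
  open FiniteSum R
  open Algebra.Properties.CommutativeSemiring.Exp commutativeSemiring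
  open Relation.Binary.Reasoning.Setoid setoid
  open Data.Nat.Solver.+-*-Solver using ()
    renaming (solve to solve′; con to con′; _:+_ to _:+′_; _:*_ to _:*′_; _:=_ to _:=′_)

  -- The q-Pochhammer symbols (q; q²)_k and (q²; q²)_k.
  odds evens : ℕ → Carrier
  odds  zero    = 1#
  odds  (suc k) = odds k * (1# - q ^ (1 ℕ.+ 2 ℕ.* k))
  evens zero    = 1#
  evens (suc k) = evens k * (1# - q ^ (2 ℕ.+ 2 ℕ.* k))

  private
    -- K z k = ∑_{s<k} odds s * (evens k / evens s) * z^s
    K : Carrier → ℕ → Carrier
    K z zero    = 0#
    K z (suc k) = (1# - q ^ (2 ℕ.+ 2 ℕ.* k)) * (K z k + odds k * z ^ k)

    K-cong : ∀ {z z′} → z ≈ z′ → ∀ k → K z k ≈ K z′ k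
    K-cong e zero    = refl
    K-cong e (suc k) = *-congˡ (+-cong (K-cong e k) (*-congˡ (^-congˡ k e)))

    q^2k : ∀ k → (q * q) ^ k ≈ q ^ (2 ℕ.* k)
    q^2k k = trans (^-congˡ k (*-congˡ (sym (*-identityʳ q)))) (^-assocʳ q 2 k)

    -- Divided by `evens k`, `K z k` is a partial sum of the q-binomial series F(z) = ∑ (q; q²)_s /
    -- (q²; q²)_s z^s = (qz; q²)_∞ / (z; q²)_∞, for which (1 - qz) F(q²z) = (1 - z) F(z). The last
    -- summand is the boundary term left by the cut at `k`.
    K-shift : ∀ z k → (1# - q * z) * K (q * q * z) k
                    ≈ (1# - z) * K z k + (1# - q ^ (2 ℕ.* k)) * (z ^ k * odds k)
    K-shift z zero = solve 2
      (λ q z → (con (+ 1) :- q :* z) :* con (+ 0)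
         := (con (+ 1) :- z) :* con (+ 0) :+ (con (+ 1) :- con (+ 1)) :* (con (+ 1) :* con (+ 1)))
      refl q z
    K-shift z (suc k) = begin
      (1# - q * z) * ((1# - q * (q * u)) * (K′ + ok * (q * q * z) ^ k))
        ≈⟨ *-congˡ (*-congˡ (+-congˡ (*-congˡ
             (trans (^-distrib-* (q * q) z k) (*-congʳ (q^2k k)))))) ⟩
      (1# - q * z) * ((1# - q * (q * u)) * (K′ + ok * (u * w)))
        ≈⟨ solve 6 (λ q z u K′ ok w →
             (con (+ 1) :- q :* z) :* ((con (+ 1) :- q :* (q :* u)) :* (K′ :+ ok :* (u :* w)))
             := (con (+ 1) :- q :* (q :* u)) :*
                ((con (+ 1) :- q :* z) :* K′ :+ (con (+ 1) :- q :* z) :* (ok :* (u :* w))))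
             refl q z u K′ ok w ⟩
      (1# - q * (q * u)) * ((1# - q * z) * K′ + (1# - q * z) * (ok * (u * w)))
        ≈⟨ *-congˡ (+-congʳ (K-shift z k)) ⟩
      (1# - q * (q * u)) * (((1# - z) * K₀ + (1# - u) * (w * ok)) + (1# - q * z) * (ok * (u * w)))
        ≈⟨ solve 6 (λ q z u K₀ ok w →
             (con (+ 1) :- q :* (q :* u)) :*
               (((con (+ 1) :- z) :* K₀ :+ (con (+ 1) :- u) :* (w :* ok))
                 :+ (con (+ 1) :- q :* z) :* (ok :* (u :* w)))
             := (con (+ 1) :- z) :* ((con (+ 1) :- q :* (q :* u)) :* (K₀ :+ ok :* w))
                :+ (con (+ 1) :- q :* (q :* u)) :* (z :* w :* (ok :* (con (+ 1) :- q :* u))))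
             refl q z u K₀ ok w ⟩
      (1# - z) * ((1# - q * (q * u)) * (K₀ + ok * w))
        + (1# - q * (q * u)) * (z * w * (ok * (1# - q * u)))
        ≈⟨ +-congˡ (*-congʳ (+-congˡ (-‿cong (^-congʳ q (exponent k))))) ⟩
      (1# - z) * ((1# - q * (q * u)) * (K₀ + ok * w))
        + (1# - q ^ (2 ℕ.* suc k)) * (z * w * (ok * (1# - q * u)))
        ∎
      where
      u = q ^ (2 ℕ.* k) ; K′ = K (q * q * z) k ; K₀ = K z k ; ok = odds k ; w = z ^ k
      exponent : ∀ k → 2 ℕ.+ 2 ℕ.* k ≡ 2 ℕ.* suc k
      exponent = solve′ 1
        (λ k → con′ 2 :+′ con′ 2 :*′ k :=′ con′ 2 :*′ (con′ 1 :+′ k)) ≡.refl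

    -- First evaluation at z = q^(2n+1). Raising n moves z to q²z, which `K-shift` undoes: 1 - qz is
    -- the factor in the recursion of `K`, and 1 - z is the new factor of `odds`.
    K-odds : ∀ n → K (q ^ (1 ℕ.+ 2 ℕ.* n)) n ≈ odds n * triangular q n
    K-odds zero    = solve 0 (con (+ 0) := con (+ 1) :* (con (+ 0) :+ con (+ 0))) refl
    K-odds (suc n) = begin
      (1# - q * (q * u)) * (K z′ n + on * z′ ^ n)
        ≈⟨ *-congˡ (+-cong (K-cong z′≈ n)
             (*-congˡ (trans (^-congˡ n z′≈)
               (trans (^-distrib-* (q * q) z n) (*-congʳ (q^2k n)))))) ⟩
      (1# - q * (q * u)) * (K (q * q * z) n + on * (u * w))
        ≈⟨ solve 5 (λ q u K′ on w →
             (con (+ 1) :- q :* (q :* u)) :* (K′ :+ on :* (u :* w))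
             := (con (+ 1) :- q :* (q :* u)) :* K′ :+ (con (+ 1) :- q :* (q :* u)) :* (on :* (u :* w)))
             refl q u (K (q * q * z) n) on w ⟩
      (1# - q * z) * K (q * q * z) n + (1# - q * z) * (on * (u * w))
        ≈⟨ +-congʳ (K-shift z n) ⟩
      (1# - z) * K z n + (1# - u) * (w * on) + (1# - q * z) * (on * (u * w))
        ≈⟨ +-congʳ (+-congʳ (*-congˡ (K-odds n))) ⟩
      (1# - z) * (on * (t₁ + t₂)) + (1# - u) * (w * on) + (1# - q * z) * (on * (u * w))
        -- Since z = q u, the last two summands add up to on w (1 - z²), that is on (1 - z) times
        -- the two new triangular terms w and z w.
        ≈⟨ solve 6 (λ q u on t₁ t₂ w →
             (con (+ 1) :- q :* u) :* (on :* (t₁ :+ t₂)) :+ (con (+ 1) :- u) :* (w :* on)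
               :+ (con (+ 1) :- q :* (q :* u)) :* (on :* (u :* w))
             := on :* (con (+ 1) :- q :* u) :* (t₁ :+ w :+ (t₂ :+ q :* u :* w)))
             refl q u on t₁ t₂ w ⟩
      on * (1# - z) * (t₁ + w + (t₂ + z * w))
        ≈⟨ *-congˡ (+-cong (+-congˡ w≈) (+-congˡ (trans (*-congˡ w≈)
             (sym (^-homo-* q (1 ℕ.+ 2 ℕ.* n) (n ℕ.* (1 ℕ.+ 2 ℕ.* n))))))) ⟩
      odds (suc n) * triangular q (suc n) ∎
      where
      u = q ^ (2 ℕ.* n) ; z = q ^ (1 ℕ.+ 2 ℕ.* n) ; z′ = q ^ (1 ℕ.+ 2 ℕ.* suc n)
      on = odds n ; w = z ^ n
      t₁ = ∑ (λ m → q ^ (m ℕ.* (1 ℕ.+ 2 ℕ.* m))) n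
      t₂ = ∑ (λ m → q ^ (suc m ℕ.* (1 ℕ.+ 2 ℕ.* m))) n
      z′≈ : z′ ≈ q * q * z
      z′≈ = trans (^-congʳ q (≡.cong suc (solve′ 1
        (λ k → con′ 2 :*′ (con′ 1 :+′ k) :=′ con′ 2 :+′ con′ 2 :*′ k) ≡.refl n)))
        (sym (*-assoc q q z))
      w≈ : w ≈ q ^ (n ℕ.* (1 ℕ.+ 2 ℕ.* n))
      w≈ = trans (^-assocʳ q (1 ℕ.+ 2 ℕ.* n) n) (^-congʳ q (ℕ.*-comm (1 ℕ.+ 2 ℕ.* n) n))

    -- Second evaluation: only the summand s = 0 is free of z, and it is the whole product `evens`.
    -- The length is at least 1 because the empty sum `K z 0` lacks that summand.
    K-evens : ∀ z k → ∃ λ t → K z (suc k) ≈ evens (suc k) + z * t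
    K-evens z zero = 0# , solve 2
      (λ y z → y :* (con (+ 0) :+ con (+ 1) :* con (+ 1)) := con (+ 1) :* y :+ z :* con (+ 0))
      refl (1# - q ^ 2) z
    K-evens z (suc k) with K-evens z k
    ... | t , e = y * t + y * (odds (suc k) * z ^ k) , trans (*-congˡ (+-congʳ e))
      (solve 6 (λ y en z t o w → y :* (en :+ z :* t :+ o :* (z :* w))
         := en :* y :+ z :* (y :* t :+ y :* (o :* w)))
         refl y (evens (suc k)) z t (odds (suc k)) (z ^ k))
      where y = 1# - q ^ (2 ℕ.+ 2 ℕ.* suc k)

  -- The two evaluations are compared at the same z, a power of q that grows with n; the error
  -- leaves every fixed degree and ψ = (q²; q²)_∞ / (q; q²)_∞ results in the limit.
  odds*triangular : ∀ n → ∃ λ t →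
    odds (suc n) * triangular q (suc n) ≈ evens (suc n) + q ^ (1 ℕ.+ 2 ℕ.* suc n) * t
  odds*triangular n with K-evens (q ^ (1 ℕ.+ 2 ℕ.* suc n)) n
  ... | t , e = t , trans (sym (K-odds (suc n))) e

module GaussSquare {c ℓ} (R : CommutativeRing c ℓ) (q : CommutativeRing.Carrier R) where
  open CommutativeRing R
  open IntegerCoefficients R
  open FiniteSum R
  open Algebra.Properties.CommutativeSemiring.Exp commutativeSemiring
  open Relation.Binary.Reasoning.Setoid setoid

  -- The q-Pochhammer symbols (q; q)_k and (-q; q)_k.
  minus plus : ℕ → Carrier
  minus zero    = 1#
  minus (suc k) = minus k * (1# - q ^ suc k)
  plus  zero    = 1#
  plus  (suc k) = plus k * (1# + q ^ suc k)

  private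
    -- K z k = ∑_{s≤k} c_s * z^s * (minus k / minus s), where c₀ = 1 and c_s = 2 * plus (s - 1)
    K : Carrier → ℕ → Carrier
    K z zero    = 1#
    K z (suc k) = (1# - q ^ suc k) * K z k + (1# + 1#) * (z ^ suc k * plus k)

    K-cong : ∀ {z z′} → z ≈ z′ → ∀ k → K z k ≈ K z′ k
    K-cong e zero    = refl
    K-cong e (suc k) = +-cong (*-congˡ (K-cong e k)) (*-congˡ (*-congʳ (^-congˡ (suc k) e)))

    -- Here c_s = (-1; q)_s, so `K z k` divided by `minus k` truncates F(z) = ∑ (-1; q)_s / (q; q)_s
    -- z^s = (-z; q)_∞ / (z; q)_∞, for which (1 + z) F(qz) = (1 - z) F(z).
    K-shift : ∀ z k → (1# + z) * K (q * z) k
                    ≈ (1# - z) * K z k + (1# + 1#) * (z ^ suc k * plus k)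
    K-shift z zero = solve 1
      (λ z → (con (+ 1) :+ z) :* con (+ 1)
         := (con (+ 1) :- z) :* con (+ 1) :+ con (+ 2) :* (z :* con (+ 1) :* con (+ 1)))
      refl z
    K-shift z (suc k) = begin
      (1# + z) * ((1# - u) * K′ + 2# * ((q * z) ^ suc k * D))
        ≈⟨ *-congˡ (+-congˡ (*-congˡ (*-congʳ (^-distrib-* q z (suc k))))) ⟩
      (1# + z) * ((1# - u) * K′ + 2# * (u * w * D))
        ≈⟨ solve 5 (λ z u K′ w D →
             (con (+ 1) :+ z) :* ((con (+ 1) :- u) :* K′ :+ con (+ 2) :* (u :* w :* D))
             := (con (+ 1) :- u) :* ((con (+ 1) :+ z) :* K′)
                :+ (con (+ 1) :+ z) :* (con (+ 2) :* (u :* w :* D)))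
             refl z u K′ w D ⟩
      (1# - u) * ((1# + z) * K′) + (1# + z) * (2# * (u * w * D))
        ≈⟨ +-congʳ (*-congˡ (K-shift z k)) ⟩
      (1# - u) * ((1# - z) * K₀ + 2# * (w * D)) + (1# + z) * (2# * (u * w * D))
        ≈⟨ solve 5 (λ z u K₀ w D →
             (con (+ 1) :- u) :* ((con (+ 1) :- z) :* K₀ :+ con (+ 2) :* (w :* D))
                :+ (con (+ 1) :+ z) :* (con (+ 2) :* (u :* w :* D))
             := (con (+ 1) :- z) :* ((con (+ 1) :- u) :* K₀ :+ con (+ 2) :* (w :* D))
                :+ con (+ 2) :* (z :* w :* (D :* (con (+ 1) :+ u))))
             refl z u K₀ w D ⟩
      (1# - z) * ((1# - u) * K₀ + 2# * (w * D)) + 2# * (z * w * (D * (1# + u))) ∎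
      where
      u = q ^ suc k ; K′ = K (q * z) k ; K₀ = K z k ; D = plus k ; w = z ^ suc k ; 2# = 1# + 1#

    -- At z = -q^(n+1) the factor 1 + z is the one in the recursion of `K`, and 1 - z is the new
    -- factor of `plus`.
    K-plus : ∀ n → K (- 1# * q ^ suc n) n ≈ plus n * theta q (- 1#) n
    K-plus zero    = solve 0
      (con (+ 1) := con (+ 1) :* (con (+ 1) :+ con (+ 2) :* con (+ 0))) refl
    K-plus (suc n) = begin
      (1# - u) * K z′ n + 2# * (z′ ^ suc n * D)
        ≈⟨ +-cong (*-cong 1-u≈1+z (K-cong z′≈ n))
             (*-congˡ (*-congʳ (trans (^-congˡ (suc n) z′≈) (^-distrib-* q z (suc n))))) ⟩
      (1# + z) * K (q * z) n + 2# * (u * w * D)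
        ≈⟨ +-congʳ (K-shift z n) ⟩
      (1# - z) * K z n + 2# * (w * D) + 2# * (u * w * D)
        ≈⟨ +-congʳ (+-congʳ (*-congˡ (K-plus n))) ⟩
      (1# - z) * (D * (1# + 2# * s)) + 2# * (w * D) + 2# * (u * w * D)
        ≈⟨ solve 4 (λ u D s w →
             (con (+ 1) :- con (-[1+ 0 ]) :* u) :* (D :* (con (+ 1) :+ con (+ 2) :* s)) :+ con (+ 2) :* (w :* D)
               :+ con (+ 2) :* (u :* w :* D)
             := D :* (con (+ 1) :+ u) :* (con (+ 1) :+ con (+ 2) :* (s :+ w)))
             refl u D s w ⟩
      plus (suc n) * theta q (- 1#) (suc n) ∎
      where
      u = q ^ suc n ; z = - 1# * u ; z′ = - 1# * q ^ suc (suc n) ; 2# = 1# + 1#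
      D = plus n ; w = z ^ suc n ; s = ∑ (λ m → (- 1# * q ^ suc m) ^ suc m) n
      1-u≈1+z : 1# - u ≈ 1# + z
      1-u≈1+z = solve 1 (λ u → con (+ 1) :- u := con (+ 1) :+ con -[1+ 0 ] :* u) refl u
      z′≈ : z′ ≈ q * z
      z′≈ = solve 2 (λ q u → con -[1+ 0 ] :* (q :* u) := q :* (con -[1+ 0 ] :* u)) refl q u

    K-minus : ∀ z k → ∃ λ t → K z k ≈ minus k + z * t
    K-minus z zero = 0# , solve 1 (λ z → con (+ 1) := con (+ 1) :+ z :* con (+ 0)) refl z
    K-minus z (suc k) with K-minus z k
    ... | t , e = y * t + (1# + 1#) * (z ^ k * plus k) , trans (+-congʳ (*-congˡ e))
      (solve 6 (λ y mk z t w D →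
         y :* (mk :+ z :* t) :+ con (+ 2) :* (z :* w :* D)
         := mk :* y :+ z :* (y :* t :+ con (+ 2) :* (w :* D)))
         refl y (minus k) z t (z ^ k) (plus k))
      where y = 1# - q ^ suc k

  plus*theta : ∀ n → ∃ λ t → plus n * theta q (- 1#) n ≈ minus n + - 1# * q ^ suc n * t
  plus*theta n with K-minus (- 1# * q ^ suc n) n
  ... | t , e = t , trans (sym (K-plus n)) e

-- Dissection of φ(q) and φ(-q) into even and odd squares.

module ThetaDissection {c ℓ} (R : CommutativeRing c ℓ) (q : CommutativeRing.Carrier R) where
  open CommutativeRing R
  open IntegerCoefficients R
  open FiniteSum R
  open Algebra.Properties.CommutativeSemiring.Exp commutativeSemiring
  open Relation.Binary.Reasoning.Setoid setoid
  open Data.Nat.Solver.+-*-Solver using ()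
    renaming (solve to solve′; con to con′; _:+_ to _:+′_; _:*_ to _:*′_; _:=_ to _:=′_)

  module _ (ε : Carrier) (ε²≈1 : ε * ε ≈ 1#) where

    private
      1^ : ∀ n → 1# ^ n ≈ 1#
      1^ zero    = refl
      1^ (suc n) = trans (*-identityˡ _) (1^ n)

      ε^2j : ∀ j → ε ^ (2 ℕ.* j) ≈ 1#
      ε^2j j = trans (sym (^-assocʳ ε 2 j))
        (trans (^-congˡ j (trans (*-congˡ (*-identityʳ ε)) ε²≈1)) (1^ j))

      term : ∀ k → (ε * q ^ k) ^ k ≈ ε ^ k * q ^ (k ℕ.* k)
      term k = trans (^-distrib-* ε (q ^ k) k) (*-congˡ (^-assocʳ q k k))

      even-term : ∀ k j → k ≡ 2 ℕ.* j → (ε * q ^ k) ^ k ≈ (q ^ 4) ^ (j ℕ.* j)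
      even-term k j ≡.refl = begin
        (ε * q ^ k) ^ k            ≈⟨ term k ⟩
        ε ^ k * q ^ (k ℕ.* k)      ≈⟨ *-cong (ε^2j j) (^-congʳ q (solve′ 1
          (λ j → con′ 2 :*′ j :*′ (con′ 2 :*′ j) :=′ con′ 4 :*′ (j :*′ j)) ≡.refl j)) ⟩
        1# * q ^ (4 ℕ.* (j ℕ.* j)) ≈⟨ *-identityˡ _ ⟩
        q ^ (4 ℕ.* (j ℕ.* j))      ≈⟨ ^-assocʳ q 4 (j ℕ.* j) ⟨
        (q ^ 4) ^ (j ℕ.* j)        ∎

      odd-term : ∀ k j e → k ≡ suc (2 ℕ.* j) → k ℕ.* k ≡ suc (8 ℕ.* e) →
                 (ε * q ^ k) ^ k ≈ ε * (q * (q ^ 8) ^ e)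
      odd-term k j e ≡.refl k²≡ = begin
        (ε * q ^ k) ^ k           ≈⟨ term k ⟩
        ε ^ k * q ^ (k ℕ.* k)     ≈⟨ *-cong (trans (*-congˡ (ε^2j j)) (*-identityʳ ε)) (^-congʳ q k²≡) ⟩
        ε * (q * q ^ (8 ℕ.* e))   ≈⟨ *-congˡ (*-congˡ (^-assocʳ q 8 e)) ⟨
        ε * (q * (q ^ 8) ^ e)     ∎

    -- Four terms are added at a time. The even squares are 4j²; the odd ones are 1 + 8T with T
    -- triangular, and (4n+1)², (4n+3)² feed the two families of `triangular`. By ε² = 1 the sign
    -- survives only on odd squares.
    theta-dissection : ∀ n → theta q ε (n ℕ.* 4)
      ≈ 1# + (1# + 1#) * ∑ (λ m → (q ^ 4) ^ (suc m ℕ.* suc m)) (n ℕ.* 2)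
        + (1# + 1#) * (ε * (q * triangular (q ^ 8) n))
    theta-dissection zero = solve 2
      (λ ε q → con (+ 1) :+ con (+ 2) :* con (+ 0)
        := con (+ 1) :+ con (+ 2) :* con (+ 0)
          :+ con (+ 2) :* (ε :* (q :* (con (+ 0) :+ con (+ 0))))) refl ε q
    theta-dissection (suc n) = begin
      1# + 2# * (s + x₁ + x₂ + x₃ + x₄)
        ≈⟨ solve 5 (λ s x₁ x₂ x₃ x₄ → con (+ 1) :+ con (+ 2) :* (s :+ x₁ :+ x₂ :+ x₃ :+ x₄)
             := con (+ 1) :+ con (+ 2) :* s :+ (con (+ 2) :* (x₂ :+ x₄) :+ con (+ 2) :* (x₁ :+ x₃)))
             refl s x₁ x₂ x₃ x₄ ⟩
      theta q ε (n ℕ.* 4) + (2# * (x₂ + x₄) + 2# * (x₁ + x₃))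
        ≈⟨ +-cong (theta-dissection n) (+-cong
             (*-congˡ (+-cong
               (even-term (2 ℕ.+ n ℕ.* 4) (1 ℕ.+ n ℕ.* 2)
                 (solve′ 1 (λ n → con′ 2 :+′ n :*′ con′ 4 :=′ con′ 2 :*′ (con′ 1 :+′ n :*′ con′ 2)) ≡.refl n))
               (even-term (4 ℕ.+ n ℕ.* 4) (2 ℕ.+ n ℕ.* 2)
                 (solve′ 1 (λ n → con′ 4 :+′ n :*′ con′ 4 :=′ con′ 2 :*′ (con′ 2 :+′ n :*′ con′ 2)) ≡.refl n))))
             (*-congˡ (+-cong
               (odd-term (1 ℕ.+ n ℕ.* 4) (2 ℕ.* n) (n ℕ.* (1 ℕ.+ 2 ℕ.* n))
                 (solve′ 1 (λ n → con′ 1 :+′ n :*′ con′ 4 :=′ con′ 1 :+′ con′ 2 :*′ (con′ 2 :*′ n)) ≡.refl n)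
                 (solve′ 1 (λ n → (con′ 1 :+′ n :*′ con′ 4) :*′ (con′ 1 :+′ n :*′ con′ 4)
                   :=′ con′ 1 :+′ con′ 8 :*′ (n :*′ (con′ 1 :+′ con′ 2 :*′ n))) ≡.refl n))
               (odd-term (3 ℕ.+ n ℕ.* 4) (1 ℕ.+ 2 ℕ.* n) (suc n ℕ.* (1 ℕ.+ 2 ℕ.* n))
                 (solve′ 1 (λ n → con′ 3 :+′ n :*′ con′ 4
                   :=′ con′ 1 :+′ con′ 2 :*′ (con′ 1 :+′ con′ 2 :*′ n)) ≡.refl n)
                 (solve′ 1 (λ n → (con′ 3 :+′ n :*′ con′ 4) :*′ (con′ 3 :+′ n :*′ con′ 4)
                   :=′ con′ 1 :+′ con′ 8 :*′ ((con′ 1 :+′ n) :*′ (con′ 1 :+′ con′ 2 :*′ n))) ≡.refl n))))) ⟩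
      1# + 2# * r + 2# * (ε * (q * (t₁ + t₂))) + (2# * (y₂ + y₄) + 2# * (ε * (q * y₁) + ε * (q * y₃)))
        ≈⟨ rearrange r t₁ t₂ y₁ y₂ y₃ y₄ ⟩
      1# + 2# * (r + y₂ + y₄) + 2# * (ε * (q * ((t₁ + y₁) + (t₂ + y₃)))) ∎
      where
      2# = 1# + 1#
      x₁ = (ε * q ^ (1 ℕ.+ n ℕ.* 4)) ^ (1 ℕ.+ n ℕ.* 4)
      x₂ = (ε * q ^ (2 ℕ.+ n ℕ.* 4)) ^ (2 ℕ.+ n ℕ.* 4)
      x₃ = (ε * q ^ (3 ℕ.+ n ℕ.* 4)) ^ (3 ℕ.+ n ℕ.* 4)
      x₄ = (ε * q ^ (4 ℕ.+ n ℕ.* 4)) ^ (4 ℕ.+ n ℕ.* 4)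
      s  = ∑ (λ m → (ε * q ^ suc m) ^ suc m) (n ℕ.* 4)
      r  = ∑ (λ m → (q ^ 4) ^ (suc m ℕ.* suc m)) (n ℕ.* 2)
      t₁ = ∑ (λ m → (q ^ 8) ^ (m ℕ.* (1 ℕ.+ 2 ℕ.* m))) n
      t₂ = ∑ (λ m → (q ^ 8) ^ (suc m ℕ.* (1 ℕ.+ 2 ℕ.* m))) n
      y₁ = (q ^ 8) ^ (n ℕ.* (1 ℕ.+ 2 ℕ.* n))
      y₃ = (q ^ 8) ^ (suc n ℕ.* (1 ℕ.+ 2 ℕ.* n))
      y₂ = (q ^ 4) ^ ((1 ℕ.+ n ℕ.* 2) ℕ.* (1 ℕ.+ n ℕ.* 2))
      y₄ = (q ^ 4) ^ ((2 ℕ.+ n ℕ.* 2) ℕ.* (2 ℕ.+ n ℕ.* 2))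
      rearrange : ∀ r t₁ t₂ y₁ y₂ y₃ y₄ →
        1# + 2# * r + 2# * (ε * (q * (t₁ + t₂))) + (2# * (y₂ + y₄) + 2# * (ε * (q * y₁) + ε * (q * y₃)))
        ≈ 1# + 2# * (r + y₂ + y₄) + 2# * (ε * (q * ((t₁ + y₁) + (t₂ + y₃))))
      rearrange r t₁ t₂ y₁ y₂ y₃ y₄ = solve 9 (λ ε q r t₁ t₂ y₁ y₂ y₃ y₄ →
        con (+ 1) :+ con (+ 2) :* r :+ con (+ 2) :* (ε :* (q :* (t₁ :+ t₂)))
          :+ (con (+ 2) :* (y₂ :+ y₄) :+ con (+ 2) :* (ε :* (q :* y₁) :+ ε :* (q :* y₃)))
        := con (+ 1) :+ con (+ 2) :* (r :+ y₂ :+ y₄)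
          :+ con (+ 2) :* (ε :* (q :* ((t₁ :+ y₁) :+ (t₂ :+ y₃))))) refl ε q r t₁ t₂ y₁ y₂ y₃ y₄

-- Algebra modulo 2 and modulo 8.

module TwoAdic {c ℓ} (R : CommutativeRing c ℓ) where
  open CommutativeRing R
  open IntegerCoefficients R

  private
    module Mod₂ = Quotient R (ι (+ 2))
    module Mod₈ = Quotient R (ι (+ 8))

  open Mod₂ public using () renaming (_≈ₘ_ to _≈₂_; ≈⇒≈ₘ to ≈⇒≈₂; quotient to R₂)
  open Mod₈ public using () renaming (_≈ₘ_ to _≈₈_; ≈⇒≈ₘ to ≈⇒≈₈; quotient to R₈)
  module R₂ = CommutativeRing R₂
  module R₈ = CommutativeRing R₈

  2* 4* 8* : Carrier → Carrier
  2* x = ι (+ 2) * x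
  4* x = ι (+ 4) * x
  8* x = ι (+ 8) * x

  2*≈₂0 : ∀ x → 2* x ≈₂ 0#
  2*≈₂0 x = x , sym (+-identityˡ (2* x))

  +8*≈₈ : ∀ x y → x + 8* y ≈₈ x
  +8*≈₈ x y = y , refl

  -- The saving of precision on which the whole reduction rests: behind a factor 4, parity
  -- information suffices.
  4*-lift : ∀ {x y} → x ≈₂ y → 4* x ≈₈ 4* y
  4*-lift {x} {y} (t , e) = t , trans (*-congˡ e)
    (solve 2 (λ y t → con (+ 4) :* (y :+ con (+ 2) :* t) := con (+ 4) :* y :+ con (+ 8) :* t) refl y t)

  neg≈₂ : ∀ x → - x ≈₂ x
  neg≈₂ x = - x , solve 1 (λ x → :- x := x :+ con (+ 2) :* (:- x)) refl x

  -- The witness is the binomial expansion of (1 + 2t)⁴ with 8 taken out of every term but the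
  -- first.
  fourth-power : ∀ {x} → x ≈₂ 1# → x * x * x * x ≈₈ 1#
  fourth-power {x} (t , e) = t + ι (+ 3) * (t * t) + ι (+ 4) * (t * t * t) + ι (+ 2) * (t * t * t * t) ,
    trans (*-cong (*-cong (*-cong e e) e) e)
    (solve 1 (λ t → let x = con (+ 1) :+ con (+ 2) :* t in
      x :* x :* x :* x := con (+ 1) :+ con (+ 8) :*
        (t :+ con (+ 3) :* (t :* t) :+ con (+ 4) :* (t :* t :* t) :+ con (+ 2) :* (t :* t :* t :* t)))
      refl t)

  -- The letters anticipate the series: p_k = ψ(q^k), a_k = φ(q^k), Φ = φ(-q), g = (f_3/f_1)³, with
  -- subscripts for dilation. From these relations on, the congruence is pure ring algebra.
  module _ {q p₂ p₆ p₈ p₁₂ p₂₄ a a₃ a₄ a₆ Φ Φ₃ g g₂ : Carrier}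
    (a₄≈₂1 : a₄ ≈₂ 1#) (a₆≈₂1 : a₆ ≈₂ 1#) (Φ≈₂1 : Φ ≈₂ 1#) (Φ₃≈₂1 : Φ₃ ≈₂ 1#)
    (Φ≈ : Φ ≈ a₄ - 2* (q * p₈))
    (a≈ : a ≈ Φ + 4* (q * p₈)) (a₃≈ : a₃ ≈ Φ₃ + 4* (q * q * q * p₂₄))
    (g²Φ³≈ : g * g * (Φ * Φ * Φ) ≈ g₂ * (Φ₃ * Φ₃ * Φ₃))
    where

    private
      b = q * p₈
      c₃ = q * q * q * p₂₄
      X = p₂ * a₃
      Y = a * p₆
      M = a₆ * a₆ + 4* (q * q * q * (p₁₂ * p₁₂))
      N = a₆ * p₁₂

      1≈₂ : ∀ {x} → x ≈₂ 1# → ∀ y → x * y ≈₂ y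
      1≈₂ e y = R₂.trans (R₂.*-congʳ e) (R₂.*-identityˡ y)

      4*≈₂0 : ∀ x → 4* x ≈₂ 0#
      4*≈₂0 x = R₂.trans (≈⇒≈₂ (solve 1 (λ x → con (+ 4) :* x := con (+ 2) :* (con (+ 2) :* x)) refl x))
        (2*≈₂0 (2* x))

      a≈₂1 : a ≈₂ 1#
      a≈₂1 = R₂.trans (≈⇒≈₂ a≈) (R₂.trans (R₂.+-cong Φ≈₂1 (4*≈₂0 b)) (R₂.+-identityʳ 1#))

      a₃≈₂1 : a₃ ≈₂ 1#
      a₃≈₂1 = R₂.trans (≈⇒≈₂ a₃≈) (R₂.trans (R₂.+-cong Φ₃≈₂1 (4*≈₂0 c₃)) (R₂.+-identityʳ 1#))

      cube≈₂1 : ∀ {x} → x ≈₂ 1# → x * x * x ≈₂ 1#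
      cube≈₂1 e = R₂.trans (R₂.*-cong (R₂.*-cong e e) e)
        (R₂.trans (R₂.*-congʳ (R₂.*-identityˡ 1#)) (R₂.*-identityˡ 1#))

      g²≈₂g₂ : g * g ≈₂ g₂
      g²≈₂g₂ = R₂.trans (R₂.sym (R₂.trans (R₂.*-congˡ (cube≈₂1 Φ≈₂1)) (R₂.*-identityʳ _)))
        (R₂.trans (≈⇒≈₂ g²Φ³≈) (R₂.trans (R₂.*-congˡ (cube≈₂1 Φ₃≈₂1)) (R₂.*-identityʳ g₂)))

      X≈₂ : X ≈₂ p₂
      X≈₂ = R₂.trans (R₂.*-congˡ a₃≈₂1) (R₂.*-identityʳ p₂)

      Y≈₂ : Y ≈₂ p₆
      Y≈₂ = 1≈₂ a≈₂1 p₆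

      N≈₂ : N ≈₂ p₁₂
      N≈₂ = 1≈₂ a₆≈₂1 p₁₂

      M≈₂ : M ≈₂ 1#
      M≈₂ = R₂.trans (R₂.+-cong (R₂.*-cong a₆≈₂1 a₆≈₂1) (4*≈₂0 _))
        (R₂.trans (R₂.+-identityʳ _) (R₂.*-identityʳ 1#))

      M²≈₈ : M * M ≈₈ 1#
      M²≈₈ = R₈.trans (≈⇒≈₈ (solve 2 (λ a w →
          (a :* a :+ con (+ 4) :* w) :* (a :* a :+ con (+ 4) :* w)
          := a :* a :* a :* a :+ con (+ 8) :* (a :* a :* w :+ con (+ 2) :* (w :* w)))
          refl a₆ (q * q * q * (p₁₂ * p₁₂))))
        (R₈.trans (+8*≈₈ _ _) (fourth-power a₆≈₂1))

      -- The product of the two subtracted terms has a factor 16, and the cross terms a factor 4, so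
      -- their sign is immaterial modulo 8 and their cofactors may be reduced modulo 2. The main
      -- term loses M² ≡ a₆⁴ ≡ 1.
      g²UV≈₈ : g * g * ((X * M - 4* (q * q * (Y * N))) * (Y * M - 4* (q * (X * N))))
             ≈₈ g * g * (X * Y) + 4* (g₂ * p₁₂ * (q * (p₂ * p₂) + q * q * (p₆ * p₆)))
      g²UV≈₈ = R₈.trans (≈⇒≈₈ (solve 6 (λ h q X Y M N →
          h :* ((X :* M :- con (+ 4) :* (q :* q :* (Y :* N))) :* (Y :* M :- con (+ 4) :* (q :* (X :* N))))
          := h :* (X :* Y) :* (M :* M)
             :+ con (+ 4) :* (h :* (M :* N) :* (q :* (X :* X) :+ q :* q :* (Y :* Y)))
             :+ con (+ 8) :* (con (+ 2) :* (h :* (q :* q :* q) :* (X :* Y) :* (N :* N))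
                  :- h :* (M :* N) :* (q :* (X :* X) :+ q :* q :* (Y :* Y))))
          refl (g * g) q X Y M N))
        (R₈.trans (+8*≈₈ _ _) (R₈.+-cong
          (R₈.trans (R₈.*-congˡ M²≈₈) (R₈.*-identityʳ _))
          (4*-lift (R₂.*-cong (R₂.*-cong g²≈₂g₂ (R₂.trans (1≈₂ M≈₂ N) N≈₂))
            (R₂.+-cong (R₂.*-congˡ (R₂.*-cong X≈₂ X≈₂)) (R₂.*-congˡ (R₂.*-cong Y≈₂ Y≈₂)))))))

      -- Inserting Φ⁴ ≡ 1 completes Φ to a cube with Φ² Φ₃ left over; the exact relation turns g² Φ³
      -- into g₂ Φ₃³, and Φ₃⁴ ≡ 1 is discarded.
      g²ΦΦ₃≈₈ : g * g * (Φ * Φ₃) ≈₈ g₂ * (Φ * Φ)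
      g²ΦΦ₃≈₈ = begin
        g * g * (Φ * Φ₃)
          ≈⟨ R₈.*-identityʳ _ ⟨
        g * g * (Φ * Φ₃) * 1#
          ≈⟨ R₈.*-congˡ (fourth-power Φ≈₂1) ⟨
        g * g * (Φ * Φ₃) * (Φ * Φ * Φ * Φ)
          ≈⟨ ≈⇒≈₈ (trans
               (solve 3 (λ h x y → h :* (x :* y) :* (x :* x :* x :* x) := h :* (x :* x :* x) :* (x :* x :* y))
                  refl (g * g) Φ Φ₃)
               (trans (*-congʳ g²Φ³≈)
                 (solve 3 (λ h x y → h :* (y :* y :* y) :* (x :* x :* y) := h :* (x :* x) :* (y :* y :* y :* y))
                    refl g₂ Φ Φ₃))) ⟩
        g₂ * (Φ * Φ) * (Φ₃ * Φ₃ * Φ₃ * Φ₃)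
          ≈⟨ R₈.*-congˡ (fourth-power Φ₃≈₂1) ⟩
        g₂ * (Φ * Φ) * 1#
          ≈⟨ R₈.*-identityʳ _ ⟩
        g₂ * (Φ * Φ) ∎
        where open Relation.Binary.Reasoning.Setoid R₈.setoid

      g²aa₃≈₈ : g * g * (a * a₃) ≈₈ g₂ * (Φ * Φ) + 4* (g₂ * (b + c₃))
      g²aa₃≈₈ = R₈.trans (≈⇒≈₈ (trans (*-congˡ (*-cong a≈ a₃≈)) (solve 5 (λ h x y b c →
          h :* ((x :+ con (+ 4) :* b) :* (y :+ con (+ 4) :* c))
          := h :* (x :* y) :+ con (+ 4) :* (h :* (y :* b :+ x :* c)) :+ con (+ 8) :* (con (+ 2) :* (h :* (b :* c))))
          refl (g * g) Φ Φ₃ b c₃)))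
        (R₈.trans (+8*≈₈ _ _) (R₈.+-cong g²ΦΦ₃≈₈
          (4*-lift (R₂.*-cong g²≈₂g₂ (R₂.+-cong (1≈₂ Φ₃≈₂1 b) (1≈₂ Φ≈₂1 c₃))))))

      Φ²≈₈ : Φ * Φ ≈₈ a₄ * a₄ + 4* (b * b) + 4* b
      Φ²≈₈ = R₈.trans (≈⇒≈₈ (trans (*-cong Φ≈ Φ≈) (solve 2 (λ a b →
          (a :- con (+ 2) :* b) :* (a :- con (+ 2) :* b)
          := a :* a :+ con (+ 4) :* (b :* b) :+ con (+ 4) :* (:- (a :* b))) refl a₄ b)))
        (R₈.+-congˡ (4*-lift (R₂.trans (neg≈₂ _) (1≈₂ a₄≈₂1 b))))

    -- The right side is arranged by parity: once subscripts mean dilation, every letter in it other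
    -- than `q` is a series in q², so the two summands are the even and the odd half.
    odd-part-mod-8 :
      g * g * ((X * M - 4* (q * q * (Y * N))) * (Y * M - 4* (q * (X * N))))
      ≈₈ g₂ * (p₂ * p₆ * (a₄ * a₄ + 4* (q * q * (p₈ * p₈))) + 4* (p₁₂ * (q * q * (p₆ * p₆))))
         + q * 4* (g₂ * (q * q * p₂₄ * (p₂ * p₆) + p₁₂ * (p₂ * p₂)))
    odd-part-mod-8 = begin
      g * g * ((X * M - 4* (q * q * (Y * N))) * (Y * M - 4* (q * (X * N))))
        ≈⟨ g²UV≈₈ ⟩
      g * g * (X * Y) + r
        ≈⟨ R₈.+-congʳ (≈⇒≈₈ (solve 5 (λ h p a₃ a r → h :* (p :* a₃ :* (a :* r)) := h :* (a :* a₃) :* (p :* r))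
             refl (g * g) p₂ a₃ a p₆)) ⟩
      g * g * (a * a₃) * (p₂ * p₆) + r
        ≈⟨ R₈.+-congʳ (R₈.*-congʳ (R₈.trans g²aa₃≈₈ (R₈.+-congʳ (R₈.*-congˡ Φ²≈₈)))) ⟩
      (g₂ * (a₄ * a₄ + 4* (b * b) + 4* b) + 4* (g₂ * (b + c₃))) * (p₂ * p₆) + r
        -- The term 4 g₂ b occurs twice, from Φ² and from a = Φ + 4b; together they form the
        -- multiple of 8 that is dropped next.
        ≈⟨ ≈⇒≈₈ (solve 8 (λ g a q p₂ p₆ p₈ p₁₂ p₂₄ → let b = q :* p₈ ; c = q :* q :* q :* p₂₄ in
             (g :* (a :* a :+ con (+ 4) :* (b :* b) :+ con (+ 4) :* b) :+ con (+ 4) :* (g :* (b :+ c))) :* (p₂ :* p₆)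
               :+ con (+ 4) :* (g :* p₁₂ :* (q :* (p₂ :* p₂) :+ q :* q :* (p₆ :* p₆)))
             := g :* (p₂ :* p₆ :* (a :* a :+ con (+ 4) :* (q :* q :* (p₈ :* p₈)))
                      :+ con (+ 4) :* (p₁₂ :* (q :* q :* (p₆ :* p₆))))
                :+ q :* (con (+ 4) :* (g :* (q :* q :* p₂₄ :* (p₂ :* p₆) :+ p₁₂ :* (p₂ :* p₂))))
                :+ con (+ 8) :* (g :* b :* (p₂ :* p₆)))
             refl g₂ a₄ q p₂ p₆ p₈ p₁₂ p₂₄) ⟩
      g₂ * (p₂ * p₆ * (a₄ * a₄ + 4* (q * q * (p₈ * p₈))) + 4* (p₁₂ * (q * q * (p₆ * p₆))))
         + q * 4* (g₂ * (q * q * p₂₄ * (p₂ * p₆) + p₁₂ * (p₂ * p₂))) + 8* (g₂ * b * (p₂ * p₆))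
        ≈⟨ +8*≈₈ _ _ ⟩
      g₂ * (p₂ * p₆ * (a₄ * a₄ + 4* (q * q * (p₈ * p₈))) + 4* (p₁₂ * (q * q * (p₆ * p₆))))
         + q * 4* (g₂ * (q * q * p₂₄ * (p₂ * p₆) + p₁₂ * (p₂ * p₂))) ∎
      where
      open Relation.Binary.Reasoning.Setoid R₈.setoid
      r = 4* (g₂ * p₁₂ * (q * (p₂ * p₂) + q * q * (p₆ * p₆)))

  -- The left side is the odd half above, divided by 4q and with q² replaced by q. Extracting g p ≡
  -- p₃ and using p₆ ≡ p₃² leaves p₆ (q p₁₂ + p p₃), where p p₃ supplies a second q p₁₂ that cancels
  -- the first.
  residue-mod-2 : ∀ {q p p₃ p₄ p₆ p₁₂ g} →
    g * p ≈₂ p₃ → p₆ ≈₂ p₃ * p₃ → p * p₃ ≈₂ p₄ + q * p₁₂ →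
    g * (q * p₁₂ * (p * p₃) + p₆ * (p * p)) ≈₂ p₄ * p₆
  residue-mod-2 {q} {p} {p₃} {p₄} {p₆} {p₁₂} {g} gp≈ p₆≈ pp₃≈ = begin
    g * (q * p₁₂ * (p * p₃) + p₆ * (p * p))
      ≈⟨ ≈⇒≈₂ (solve 6 (λ g q p p₃ p₆ p₁₂ →
           g :* (q :* p₁₂ :* (p :* p₃) :+ p₆ :* (p :* p)) := g :* p :* (q :* p₁₂ :* p₃ :+ p₆ :* p))
           refl g q p p₃ p₆ p₁₂) ⟩
    g * p * (q * p₁₂ * p₃ + p₆ * p)
      ≈⟨ R₂.*-cong gp≈ (R₂.+-congˡ (R₂.*-congʳ p₆≈)) ⟩
    p₃ * (q * p₁₂ * p₃ + p₃ * p₃ * p)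
      ≈⟨ ≈⇒≈₂ (solve 4 (λ q p p₃ p₁₂ → p₃ :* (q :* p₁₂ :* p₃ :+ p₃ :* p₃ :* p)
           := p₃ :* p₃ :* (q :* p₁₂ :+ p :* p₃)) refl q p p₃ p₁₂) ⟩
    p₃ * p₃ * (q * p₁₂ + p * p₃)
      ≈⟨ R₂.*-cong (R₂.sym p₆≈) (R₂.+-congˡ pp₃≈) ⟩
    p₆ * (q * p₁₂ + (p₄ + q * p₁₂))
      ≈⟨ ≈⇒≈₂ (solve 3 (λ p₆ p₄ r → p₆ :* (r :+ (p₄ :+ r)) := p₄ :* p₆ :+ con (+ 2) :* (p₆ :* r))
           refl p₆ p₄ (q * p₁₂)) ⟩
    p₄ * p₆ + 2* (p₆ * (q * p₁₂))
      ≈⟨ R₂.trans (R₂.+-congˡ (2*≈₂0 _)) (R₂.+-identityʳ _) ⟩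
    p₄ * p₆ ∎
    where open Relation.Binary.Reasoning.Setoid R₂.setoid

-- The ring of integer power series and its truncations.

module SeriesRing where
  open ≡ using (refl; sym; trans)
  open ≡.≡-Reasoning
  open Data.Integer.Solver.+-*-Solver using (solve; _:+_; _:*_; con; _:=_)

  tail : Series → Series
  tail a n = a (suc n)

  𝟘 : Series
  𝟘 _ = 0ℤ

  q : Series
  q 0             = 0ℤ
  q 1             = 1ℤ
  q (suc (suc _)) = 0ℤ

  -- Turns the convolution into a recursion, so that the ring laws follow by induction on the
  -- coefficient with the series left arbitrary.
  ·-suc : ∀ a b n → (a · b) (suc n) ≡ a 0 ℤ.* b (suc n) ℤ.+ (tail a · b) n
  ·-suc a b n = cong (λ l → a 0 ℤ.* b (suc n) ℤ.+ sumℤ l)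
    (trans (map-applyUpTo suc (λ k → a k ℤ.* b (suc n ∸ k)) (suc n)) (sym (map-upTo (λ k → a (suc k) ℤ.* b (n ∸ k)) (suc n))))

  ·-zero : ∀ a b → (a · b) 0 ≡ a 0 ℤ.* b 0
  ·-zero a b = ℤ.+-identityʳ _

  ·-cong-≤ : ∀ {a a′ b b′} n → (∀ {k} → k ≤ n → a k ≡ a′ k) → (∀ {k} → k ≤ n → b k ≡ b′ k) →
             (a · b) n ≡ (a′ · b′) n
  ·-cong-≤ {a} {a′} {b} {b′} zero p r =
    cong (ℤ._+ 0ℤ) (cong₂ ℤ._*_ (p z≤n) (r z≤n))
  ·-cong-≤ {a} {a′} {b} {b′} (suc n) p r = begin
    (a · b) (suc n)                            ≡⟨ ·-suc a b n ⟩
    a 0 ℤ.* b (suc n) ℤ.+ (tail a · b) n       ≡⟨ cong₂ ℤ._+_ (cong₂ ℤ._*_ (p z≤n) (r ℕ.≤-refl))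
      (·-cong-≤ n (λ k≤n → p (s≤s k≤n)) (λ k≤n → r (ℕ.m≤n⇒m≤1+n k≤n))) ⟩
    a′ 0 ℤ.* b′ (suc n) ℤ.+ (tail a′ · b′) n   ≡⟨ ·-suc a′ b′ n ⟨
    (a′ · b′) (suc n)                          ∎

  ·-cong : ∀ {a a′ b b′} → a ≗ a′ → b ≗ b′ → a · b ≗ a′ · b′
  ·-cong p r n = ·-cong-≤ n (λ {k} _ → p k) (λ {k} _ → r k)

  -- The mirror image of `·-suc`; playing one recursion against the other gives commutativity.
  ·-sucʳ : ∀ a b n → (a · b) (suc n) ≡ (a · tail b) n ℤ.+ a (suc n) ℤ.* b 0
  ·-sucʳ a b zero =
    solve 4 (λ w x y z → w :* x :+ (y :* z :+ con 0ℤ) := w :* x :+ con 0ℤ :+ y :* z)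
      refl (a 0) (b 1) (a 1) (b 0)
  ·-sucʳ a b (suc n) = begin
    (a · b) (suc (suc n))
      ≡⟨ ·-suc a b (suc n) ⟩
    a 0 ℤ.* b (suc (suc n)) ℤ.+ (tail a · b) (suc n)
      ≡⟨ cong (λ x → a 0 ℤ.* b (suc (suc n)) ℤ.+ x) (·-sucʳ (tail a) b n) ⟩
    a 0 ℤ.* b (suc (suc n)) ℤ.+ ((tail a · tail b) n ℤ.+ a (suc (suc n)) ℤ.* b 0)
      ≡⟨ ℤ.+-assoc (a 0 ℤ.* b (suc (suc n))) _ _ ⟨
    a 0 ℤ.* b (suc (suc n)) ℤ.+ (tail a · tail b) n ℤ.+ a (suc (suc n)) ℤ.* b 0
      ≡⟨ cong (ℤ._+ a (suc (suc n)) ℤ.* b 0) (·-suc a (tail b) n) ⟨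
    (a · tail b) (suc n) ℤ.+ a (suc (suc n)) ℤ.* b 0 ∎

  ·-comm : ∀ a b → a · b ≗ b · a
  ·-comm a b zero = cong (ℤ._+ 0ℤ) (ℤ.*-comm (a 0) (b 0))
  ·-comm a b (suc n) = begin
    (a · b) (suc n)                              ≡⟨ ·-suc a b n ⟩
    a 0 ℤ.* b (suc n) ℤ.+ (tail a · b) n         ≡⟨ cong₂ ℤ._+_ (ℤ.*-comm (a 0) (b (suc n))) (·-comm (tail a) b n) ⟩
    b (suc n) ℤ.* a 0 ℤ.+ (b · tail a) n         ≡⟨ ℤ.+-comm (b (suc n) ℤ.* a 0) _ ⟩
    (b · tail a) n ℤ.+ b (suc n) ℤ.* a 0         ≡⟨ ·-sucʳ b a n ⟨
    (b · a) (suc n)                              ∎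

  𝟘-· : ∀ a → 𝟘 · a ≗ 𝟘
  𝟘-· a zero    = refl
  𝟘-· a (suc n) = trans (·-suc 𝟘 a n) (trans (ℤ.+-identityˡ _) (𝟘-· a n))

  ·-identityˡ : ∀ a → one · a ≗ a
  ·-identityˡ a zero    = solve 1 (λ x → con 1ℤ :* x :+ con 0ℤ := x) refl (a 0)
  ·-identityˡ a (suc n) = trans (·-suc one a n)
    (trans (cong₂ ℤ._+_ (ℤ.*-identityˡ (a (suc n))) (𝟘-· a n)) (ℤ.+-identityʳ _))

  q·-suc : ∀ a n → (q · a) (suc n) ≡ a n
  q·-suc a n = trans (·-suc q a n) (trans (ℤ.+-identityˡ _)
    (trans (·-cong {tail q} {one} {a} tail-q (λ _ → refl) n) (·-identityˡ a n)))
    where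
    tail-q : tail q ≗ one
    tail-q zero    = refl
    tail-q (suc _) = refl

  -- Outside this block coefficients are reached only through the `-coeff` lemmas, so that ring
  -- identities between series never unfold into convolutions.
  opaque
    infixl 6 _⊕_
    _⊕_ : Series → Series → Series
    (a ⊕ b) n = a n ℤ.+ b n

    infix 8 ⊖_
    ⊖_ : Series → Series
    (⊖ a) n = ℤ.- a n

    infixl 7 _⊗_
    _⊗_ : Series → Series → Series
    _⊗_ = _·_

    ⊕-coeff : ∀ a b n → (a ⊕ b) n ≡ a n ℤ.+ b n
    ⊕-coeff a b n = refl

    ⊖-coeff : ∀ a n → (⊖ a) n ≡ ℤ.- a n
    ⊖-coeff a n = refl

    ⊗-coeff : ∀ a b n → (a ⊗ b) n ≡ (a · b) n
    ⊗-coeff a b n = refl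

    infixr 7 _∙_
    _∙_ : ℤ → Series → Series
    (c ∙ a) n = c ℤ.* a n

    ∙-· : ∀ c a b → (c ∙ a) · b ≗ c ∙ (a · b)
    ∙-· c a b zero = trans (·-zero (c ∙ a) b) (trans (ℤ.*-assoc c (a 0) (b 0)) (cong (c ℤ.*_) (sym (·-zero a b))))
    ∙-· c a b (suc n) = begin
      ((c ∙ a) · b) (suc n)
        ≡⟨ ·-suc (c ∙ a) b n ⟩
      c ℤ.* a 0 ℤ.* b (suc n) ℤ.+ ((c ∙ tail a) · b) n
        ≡⟨ cong (λ x → c ℤ.* a 0 ℤ.* b (suc n) ℤ.+ x) (∙-· c (tail a) b n) ⟩
      c ℤ.* a 0 ℤ.* b (suc n) ℤ.+ c ℤ.* (tail a · b) n
        ≡⟨ solve 4 (λ c x y z → c :* x :* y :+ c :* z := c :* (x :* y :+ z)) refl c (a 0) (b (suc n)) _ ⟩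
      c ℤ.* (a 0 ℤ.* b (suc n) ℤ.+ (tail a · b) n)
        ≡⟨ cong (c ℤ.*_) (·-suc a b n) ⟨
      c ℤ.* (a · b) (suc n) ∎

    ·-distribʳ : ∀ a b c → (b ⊕ c) · a ≗ b · a ⊕ c · a
    ·-distribʳ a b c zero =
      solve 3 (λ a b c → (b :+ c) :* a :+ con 0ℤ := b :* a :+ con 0ℤ :+ (c :* a :+ con 0ℤ))
        refl (a 0) (b 0) (c 0)
    ·-distribʳ a b c (suc n) = begin
      ((b ⊕ c) · a) (suc n)
        ≡⟨ ·-suc (b ⊕ c) a n ⟩
      (b 0 ℤ.+ c 0) ℤ.* a (suc n) ℤ.+ ((tail b ⊕ tail c) · a) n
        ≡⟨ cong (λ x → (b 0 ℤ.+ c 0) ℤ.* a (suc n) ℤ.+ x) (·-distribʳ a (tail b) (tail c) n) ⟩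
      (b 0 ℤ.+ c 0) ℤ.* a (suc n) ℤ.+ ((tail b · a) n ℤ.+ (tail c · a) n)
        ≡⟨ solve 5 (λ b c a x y → (b :+ c) :* a :+ (x :+ y) := b :* a :+ x :+ (c :* a :+ y))
             refl (b 0) (c 0) (a (suc n)) _ _ ⟩
      b 0 ℤ.* a (suc n) ℤ.+ (tail b · a) n ℤ.+ (c 0 ℤ.* a (suc n) ℤ.+ (tail c · a) n)
        ≡⟨ cong₂ ℤ._+_ (·-suc b a n) (·-suc c a n) ⟨
      (b · a ⊕ c · a) (suc n) ∎

    ·-assoc : ∀ a b c → (a · b) · c ≗ a · (b · c)
    ·-assoc a b c zero =
      solve 3 (λ a b c → (a :* b :+ con 0ℤ) :* c :+ con 0ℤ := a :* (b :* c :+ con 0ℤ) :+ con 0ℤ)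
        refl (a 0) (b 0) (c 0)
    ·-assoc a b c (suc n) = begin
      ((a · b) · c) (suc n)
        ≡⟨ ·-suc (a · b) c n ⟩
      (a · b) 0 ℤ.* c (suc n) ℤ.+ (tail (a · b) · c) n
        ≡⟨ cong₂ ℤ._+_ (cong (ℤ._* c (suc n)) (·-zero a b)) (begin
             (tail (a · b) · c) n                          ≡⟨ ·-cong {b = c} {b′ = c} (·-suc a b) (λ _ → refl) n ⟩
             ((a 0 ∙ tail b ⊕ tail a · b) · c) n           ≡⟨ ·-distribʳ c (a 0 ∙ tail b) (tail a · b) n ⟩
             ((a 0 ∙ tail b) · c) n ℤ.+ ((tail a · b) · c) n
               ≡⟨ cong₂ ℤ._+_ (∙-· (a 0) (tail b) c n) (·-assoc (tail a) b c n) ⟩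
             a 0 ℤ.* (tail b · c) n ℤ.+ (tail a · (b · c)) n ∎) ⟩
      a 0 ℤ.* b 0 ℤ.* c (suc n) ℤ.+ (a 0 ℤ.* (tail b · c) n ℤ.+ (tail a · (b · c)) n)
        ≡⟨ solve 5 (λ a b c x y → a :* b :* c :+ (a :* x :+ y) := a :* (b :* c :+ x) :+ y)
             refl (a 0) (b 0) (c (suc n)) _ _ ⟩
      a 0 ℤ.* (b 0 ℤ.* c (suc n) ℤ.+ (tail b · c) n) ℤ.+ (tail a · (b · c)) n
        ≡⟨ cong (λ x → a 0 ℤ.* x ℤ.+ (tail a · (b · c)) n) (·-suc b c n) ⟨
      a 0 ℤ.* (b · c) (suc n) ℤ.+ (tail a · (b · c)) n
        ≡⟨ ·-suc a (b · c) n ⟨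
      (a · (b · c)) (suc n) ∎

    isSeriesRing : IsCommutativeRing _≗_ _⊕_ _⊗_ ⊖_ 𝟘 one
    isSeriesRing = record
        { isRing = record
          { +-isAbelianGroup = record
            { isGroup = record
              { isMonoid = record
                { isSemigroup = record
                  { isMagma = record
                    { isEquivalence = record
                      { refl = λ _ → refl ; sym = λ p n → sym (p n) ; trans = λ p r n → trans (p n) (r n) }
                    ; ∙-cong = λ p r n → cong₂ ℤ._+_ (p n) (r n) }
                  ; assoc = λ a b c n → ℤ.+-assoc (a n) (b n) (c n) }
                ; identity = (λ a n → ℤ.+-identityˡ (a n)) , (λ a n → ℤ.+-identityʳ (a n)) }
              ; inverse = (λ a n → ℤ.+-inverseˡ (a n)) , (λ a n → ℤ.+-inverseʳ (a n))
              ; ⁻¹-cong = λ p n → cong ℤ.-_ (p n) }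
            ; comm = λ a b n → ℤ.+-comm (a n) (b n) }
          ; *-cong = ·-cong
          ; *-assoc = ·-assoc
          ; *-identity = ·-identityˡ , λ a n → trans (·-comm a one n) (·-identityˡ a n)
          ; distrib = (λ a b c n → trans (·-comm a (b ⊕ c) n) (trans (·-distribʳ a b c n)
                        (cong₂ ℤ._+_ (·-comm b a n) (·-comm c a n))))
                    , ·-distribʳ }
        ; *-comm = ·-comm }

  seriesRing : CommutativeRing _ _
  seriesRing = record { isCommutativeRing = isSeriesRing }

  ⊕-cong-at : ∀ {a a′ b b′} n → a n ≡ a′ n → b n ≡ b′ n → (a ⊕ b) n ≡ (a′ ⊕ b′) n
  ⊕-cong-at {a} {a′} {b} {b′} n p r =
    trans (⊕-coeff a b n) (trans (cong₂ ℤ._+_ p r) (sym (⊕-coeff a′ b′ n)))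

  ⊖-cong-at : ∀ {a a′} n → a n ≡ a′ n → (⊖ a) n ≡ (⊖ a′) n
  ⊖-cong-at {a} {a′} n p = trans (⊖-coeff a n) (trans (cong ℤ.-_ p) (sym (⊖-coeff a′ n)))

  -- Equality of the coefficients of q^0, …, q^(N-1).
  module Truncation (N : ℕ) where
    infix 4 _≈ᵀ_
    _≈ᵀ_ : Series → Series → Set
    a ≈ᵀ b = ∀ {n} → n < N → a n ≡ b n

    truncatedRing : CommutativeRing _ _
    truncatedRing = Coarsening.coarsen seriesRing _≈ᵀ_
      (record { refl = λ _ → refl ; sym = λ p n<N → sym (p n<N)
              ; trans = λ p r n<N → trans (p n<N) (r n<N) })
      (λ p {n} _ → p n)
      (λ p r {n} n<N → ⊕-cong-at n (p n<N) (r n<N))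
      (λ {a} {a′} {b} {b′} p r {n} n<N → trans (⊗-coeff a b n) (trans
        (·-cong-≤ n (λ k≤n → p (ℕ.≤-<-trans k≤n n<N)) (λ k≤n → r (ℕ.≤-<-trans k≤n n<N)))
        (sym (⊗-coeff a′ b′ n))))
      (λ p {n} n<N → ⊖-cong-at n (p n<N))

-- Limits, reciprocals, dilation and odd parts of power series.

module SeriesOperations where
  open SeriesRing
  open CommutativeRing seriesRing hiding (Carrier; _≈_; isEquivalence; zero)
  open Algebra.Properties.CommutativeSemiring.Exp commutativeSemiring public
    using (_^_; ^-homo-*; ^-assocʳ; ^-congˡ; ^-congʳ)
  open IntegerCoefficients seriesRing
  open Truncation using (_≈ᵀ_)

  -- Coefficients of products with powers of q

  ⊗-zero : ∀ a b → (a ⊗ b) 0 ≡ a 0 ℤ.* b 0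
  ⊗-zero a b = ≡.trans (⊗-coeff a b 0) (·-zero a b)

  ⊗-suc : ∀ a b n → (a ⊗ b) (suc n) ≡ a 0 ℤ.* b (suc n) ℤ.+ (tail a ⊗ b) n
  ⊗-suc a b n = ≡.trans (⊗-coeff a b (suc n)) (≡.trans (·-suc a b n)
    (cong (λ x → a 0 ℤ.* b (suc n) ℤ.+ x) (≡.sym (⊗-coeff (tail a) b n))))

  q⊗-zero : ∀ a → (q ⊗ a) 0 ≡ 0ℤ
  q⊗-zero a = ⊗-zero q a

  q⊗-suc : ∀ a n → (q ⊗ a) (suc n) ≡ a n
  q⊗-suc a n = ≡.trans (⊗-coeff q a (suc n)) (q·-suc a n)

  ⊗-cong-≤ : ∀ {a a′ b b′} n → (∀ {k} → k ≤ n → a k ≡ a′ k) → (∀ {k} → k ≤ n → b k ≡ b′ k) →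
             (a ⊗ b) n ≡ (a′ ⊗ b′) n
  ⊗-cong-≤ {a} {a′} {b} {b′} n p r =
    ≡.trans (⊗-coeff a b n) (≡.trans (·-cong-≤ n p r) (≡.sym (⊗-coeff a′ b′ n)))

  -- A factor without constant term raises degrees, so agreement improves by one coefficient; this
  -- is the contraction behind the reciprocal.
  ⊗-cong-sucᵀ : ∀ {N a b} c → c 0 ≡ 0ℤ → _≈ᵀ_ N a b → _≈ᵀ_ (suc N) (c ⊗ a) (c ⊗ b)
  ⊗-cong-sucᵀ {a = a} {b} c c₀≡0 p {zero} _ = ≡.trans (⊗-zero c a)
    (≡.trans (cong (ℤ._* a 0) c₀≡0) (≡.sym (≡.trans (⊗-zero c b) (cong (ℤ._* b 0) c₀≡0))))
  ⊗-cong-sucᵀ {a = a} {b} c c₀≡0 p {suc n} (s≤s n<N) = ≡.trans (⊗-suc c a n) (≡.trans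
    (cong₂ ℤ._+_ (≡.trans (cong (ℤ._* a (suc n)) c₀≡0) (cong (ℤ._* b (suc n)) (≡.sym c₀≡0)))
      (⊗-cong-≤ n (λ _ → ≡.refl) (λ k≤n → p (ℕ.≤-<-trans k≤n n<N))))
    (≡.sym (⊗-suc c b n)))

  q^⊗≈ᵀ0 : ∀ N a → _≈ᵀ_ N (q ^ N ⊗ a) 𝟘
  q^⊗≈ᵀ0 (suc N) a {zero}  _         = ≡.trans (*-assoc q (q ^ N) a 0) (q⊗-zero _)
  q^⊗≈ᵀ0 (suc N) a {suc n} (s≤s n<N) =
    ≡.trans (*-assoc q (q ^ N) a (suc n)) (≡.trans (q⊗-suc _ n) (q^⊗≈ᵀ0 N a n<N))

  q^-diag : ∀ n → (q ^ n) n ≡ 1ℤ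
  q^-diag zero    = ≡.refl
  q^-diag (suc n) = ≡.trans (q⊗-suc (q ^ n) n) (q^-diag n)

  q^-off : ∀ m n → m ≢ n → (q ^ m) n ≡ 0ℤ
  q^-off zero    zero    m≢n = ⊥-elim (m≢n ≡.refl)
  q^-off zero    (suc n) m≢n = ≡.refl
  q^-off (suc m) zero    m≢n = q⊗-zero (q ^ m)
  q^-off (suc m) (suc n) m≢n = ≡.trans (q⊗-suc (q ^ m) n) (q^-off m n (m≢n ∘ cong suc))

  private
    ι-coeff⁺ : ∀ k a n → (ι (+ k) ⊗ a) n ≡ + k ℤ.* a n
    ι-coeff⁺ zero    a n = ≡.trans (zeroˡ a n) (≡.sym (ℤ.*-zeroˡ (a n)))
    ι-coeff⁺ (suc k) a n = ≡.trans (ι-suc n) (≡.trans (⊕-coeff a (ι (+ k) ⊗ a) n)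
      (≡.trans (cong (λ x → a n ℤ.+ x) (ι-coeff⁺ k a n)) (≡.sym (ℤ.suc-* (+ k) (a n)))))
      where
      ι-suc : ι (+ suc k) ⊗ a ≗ a ⊕ ι (+ k) ⊗ a
      ι-suc = trans (*-congʳ (ι-+ (+ 1) (+ k)))
        (trans (distribʳ a one (ι (+ k))) (+-congʳ (*-identityˡ a)))

  ι-coeff : ∀ i a n → (ι i ⊗ a) n ≡ i ℤ.* a n
  ι-coeff (+ k)      a n = ι-coeff⁺ k a n
  ι-coeff (-[1+ k ]) a n = ≡.trans (sym (-‿distribˡ-* (ι (+ suc k)) a) n)
    (≡.trans (⊖-coeff _ n) (≡.trans (cong ℤ.-_ (ι-coeff⁺ (suc k) a n)) (ℤ.neg-distribˡ-* (+ suc k) (a n))))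
    where open import Algebra.Properties.Ring ring

  -- Limits of sequences of series

  -- Stage N of a convergent sequence is reliable only below q^N, hence coefficient n is read at
  -- stage n + 1.
  lim : (ℕ → Series) → Series
  lim g n = g (suc n) n

  Convergent : (ℕ → Series) → Set
  Convergent g = ∀ N → _≈ᵀ_ N (g N) (g (suc N))

  stable : ∀ {g} → Convergent g → ∀ {M N} → M ≤ N → _≈ᵀ_ M (g M) (g N)
  stable {g} cv {M} {N} M≤N with ℕ.m≤n⇒∃[o]m+o≡n M≤N
  ... | o , ≡.refl = go o
    where
    go : ∀ o {n} → n < M → g M n ≡ g (M ℕ.+ o) n
    go zero    n<M = cong (λ k → g k _) (≡.sym (ℕ.+-identityʳ M))
    go (suc o) {n} n<M = ≡.trans (go o n<M) (≡.trans (cv (M ℕ.+ o) (ℕ.<-≤-trans n<M (ℕ.m≤m+n M o)))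
      (cong (λ k → g k n) (≡.sym (ℕ.+-suc M o))))

  lim≈ᵀ : ∀ {g} → Convergent g → ∀ N → _≈ᵀ_ N (lim g) (g N)
  lim≈ᵀ cv N n<N = stable cv n<N (ℕ.n<1+n _)

  ≈ᵀ⇒≗ : ∀ {a b} → (∀ N → _≈ᵀ_ N a b) → a ≗ b
  ≈ᵀ⇒≗ p n = p (suc n) (ℕ.n<1+n n)

  -- Reciprocals

  module Reciprocal (u : Series) (u₀≡1 : u 0 ≡ 1ℤ) where
    private
      v : Series
      v = one - u

      v₀≡0 : v 0 ≡ 0ℤ
      v₀≡0 = ≡.trans (⊕-coeff one (⊖ u) 0)
        (cong (λ x → 1ℤ ℤ.+ x) (≡.trans (⊖-coeff u 0) (cong ℤ.-_ u₀≡1)))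

      -- 1/u is the fixed point of x ↦ 1 + (1 - u) x. As 1 - u has no constant term, each iteration
      -- settles one more coefficient.
      approx : ℕ → Series
      approx zero    = 𝟘
      approx (suc k) = one ⊕ v ⊗ approx k

      cv : Convergent approx
      cv zero    ()
      cv (suc N) {n} n<N = ⊕-cong-at n ≡.refl (⊗-cong-sucᵀ v v₀≡0 (cv N) n<N)

    reciprocal : Series
    reciprocal = lim approx

    *-reciprocal : u ⊗ reciprocal ≗ one
    *-reciprocal = trans (solve 2 (λ u J → u :* J := J :- (con (+ 1) :- u) :* J) refl u reciprocal)
      (trans (+-congʳ fixpoint) (solve 2 (λ v J → con (+ 1) :+ v :* J :- v :* J := con (+ 1)) refl v reciprocal))
      where
      fixpoint : reciprocal ≗ one ⊕ v ⊗ reciprocal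
      fixpoint = ≈ᵀ⇒≗ λ N {n} n<N → ≡.trans (lim≈ᵀ cv (suc N) (ℕ.m≤n⇒m≤1+n n<N))
        (⊕-cong-at n ≡.refl (⊗-cong-≤ n (λ _ → ≡.refl)
          (λ k≤n → ≡.sym (lim≈ᵀ cv N (ℕ.≤-<-trans k≤n n<N)))))

  -- Substitution of q^k for q

  private
    -- delay k j a = q^j · a(q^(k+1))
    delay : ℕ → ℕ → Series → Series
    delay k zero    a zero    = a 0
    -- Emitting a coefficient uses up one of the k + 1 places, so k zeros remain before the next
    -- one.
    delay k zero    a (suc n) = delay k k (tail a) n
    delay k (suc j) a zero    = 0ℤ
    delay k (suc j) a (suc n) = delay k j a n

  -- `delay k` has period k + 1, hence the predecessor. `dil 0` thereby agrees with `dil 1`, the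
  -- identity, and the homomorphism laws hold for every `k`.
  dil : ℕ → Series → Series
  dil k = delay (ℕ.pred k) 0

  private
    delay-cong-≤ : ∀ k j {a b} n → (∀ {i} → i ≤ n → a i ≡ b i) → delay k j a n ≡ delay k j b n
    delay-cong-≤ k zero    zero    p = p z≤n
    delay-cong-≤ k zero    (suc n) p = delay-cong-≤ k k n (λ i≤n → p (s≤s i≤n))
    delay-cong-≤ k (suc j) zero    p = ≡.refl
    delay-cong-≤ k (suc j) (suc n) p = delay-cong-≤ k j n (λ i≤n → p (ℕ.m≤n⇒m≤1+n i≤n))

    delay-⊕ : ∀ k j a b → delay k j (a ⊕ b) ≗ delay k j a ⊕ delay k j b
    delay-⊕ k j a b n = ≡.trans (go k j a b n) (≡.sym (⊕-coeff _ _ n))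
      where
      go : ∀ k j a b n → delay k j (a ⊕ b) n ≡ delay k j a n ℤ.+ delay k j b n
      go k zero    a b zero    = ⊕-coeff a b 0
      go k zero    a b (suc n) = ≡.trans
        (delay-cong-≤ k k n (λ {i} _ → ≡.trans (⊕-coeff a b (suc i)) (≡.sym (⊕-coeff (tail a) (tail b) i))))
        (go k k (tail a) (tail b) n)
      go k (suc j) a b zero    = ≡.refl
      go k (suc j) a b (suc n) = go k j a b n

    delay-⊖ : ∀ k j a → delay k j (⊖ a) ≗ ⊖ delay k j a
    delay-⊖ k j a n = ≡.trans (go k j a n) (≡.sym (⊖-coeff _ n))
      where
      go : ∀ k j a n → delay k j (⊖ a) n ≡ ℤ.- delay k j a n
      go k zero    a zero    = ⊖-coeff a 0
      go k zero    a (suc n) = ≡.trans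
        (delay-cong-≤ k k n (λ {i} _ → ≡.trans (⊖-coeff a (suc i)) (≡.sym (⊖-coeff (tail a) i))))
        (go k k (tail a) n)
      go k (suc j) a zero    = ≡.refl
      go k (suc j) a (suc n) = go k j a n

    delay-ι : ∀ k j i a → delay k j (ι i ⊗ a) ≗ ι i ⊗ delay k j a
    delay-ι k j i a n = ≡.trans (go k j a n) (≡.sym (ι-coeff i _ n))
      where
      go : ∀ k j a n → delay k j (ι i ⊗ a) n ≡ i ℤ.* delay k j a n
      go k zero    a zero    = ι-coeff i a 0
      go k zero    a (suc n) = ≡.trans
        (delay-cong-≤ k k n (λ {m} _ → ≡.trans (ι-coeff i a (suc m)) (≡.sym (ι-coeff i (tail a) m))))
        (go k k (tail a) n)
      go k (suc j) a zero    = ≡.sym (ℤ.*-zeroʳ i)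
      go k (suc j) a (suc n) = go k j a n

    -- The tail of a dilated series is a delayed one, so the induction closes only with a pending
    -- delay on one factor.
    delay-⊗ : ∀ k j a b → delay k j (a ⊗ b) ≗ delay k j a ⊗ delay k 0 b
    delay-⊗ k zero    a b zero    = ≡.trans (⊗-zero a b) (≡.sym (⊗-zero (delay k 0 a) (delay k 0 b)))
    delay-⊗ k zero    a b (suc n) = begin
      delay k k (tail (a ⊗ b)) n
        ≡⟨ delay-cong-≤ k k n (λ {i} _ → ≡.trans (⊗-suc a b i) (≡.trans
             (cong (λ x → x ℤ.+ (tail a ⊗ b) i) (≡.sym (ι-coeff (a 0) (tail b) i)))
             (≡.sym (⊕-coeff _ _ i)))) ⟩
      delay k k (ι (a 0) ⊗ tail b ⊕ tail a ⊗ b) n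
        ≡⟨ delay-⊕ k k (ι (a 0) ⊗ tail b) (tail a ⊗ b) n ⟩
      (delay k k (ι (a 0) ⊗ tail b) ⊕ delay k k (tail a ⊗ b)) n
        ≡⟨ ⊕-coeff _ _ n ⟩
      delay k k (ι (a 0) ⊗ tail b) n ℤ.+ delay k k (tail a ⊗ b) n
        ≡⟨ cong₂ ℤ._+_ (≡.trans (delay-ι k k (a 0) (tail b) n) (ι-coeff (a 0) _ n)) (delay-⊗ k k (tail a) b n) ⟩
      a 0 ℤ.* delay k k (tail b) n ℤ.+ (delay k k (tail a) ⊗ delay k 0 b) n
        ≡⟨ ⊗-suc (delay k 0 a) (delay k 0 b) n ⟨
      (delay k 0 a ⊗ delay k 0 b) (suc n) ∎
      where open ≡.≡-Reasoning
    delay-⊗ k (suc j) a b zero    = ≡.sym (⊗-zero (delay k (suc j) a) (delay k 0 b))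
    delay-⊗ k (suc j) a b (suc n) = ≡.trans (delay-⊗ k j a b n)
      (≡.sym (≡.trans (⊗-suc (delay k (suc j) a) (delay k 0 b) n) (ℤ.+-identityˡ _)))

    delay-𝟘 : ∀ k j → delay k j 𝟘 ≗ 𝟘
    delay-𝟘 k zero    zero    = ≡.refl
    delay-𝟘 k zero    (suc n) = delay-𝟘 k k n
    delay-𝟘 k (suc j) zero    = ≡.refl
    delay-𝟘 k (suc j) (suc n) = delay-𝟘 k j n

    delay-q^ : ∀ k j a → delay k j a ≗ q ^ j ⊗ delay k 0 a
    delay-q^ k zero    a n       = ≡.sym (*-identityˡ (delay k 0 a) n)
    delay-q^ k (suc j) a zero    = ≡.sym (≡.trans (*-assoc q (q ^ j) (delay k 0 a) 0) (q⊗-zero _))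
    delay-q^ k (suc j) a (suc n) = ≡.trans (delay-q^ k j a n)
      (≡.sym (≡.trans (*-assoc q (q ^ j) (delay k 0 a) (suc n)) (q⊗-suc _ n)))

    delay-hit : ∀ k j a m → delay k j a (j ℕ.+ m ℕ.* suc k) ≡ a m
    delay-hit k zero    a zero    = ≡.refl
    delay-hit k zero    a (suc m) = delay-hit k k (tail a) m
    delay-hit k (suc j) a m       = delay-hit k j a m

    delay-miss : ∀ k j a n → (∀ m → n ≢ j ℕ.+ m ℕ.* suc k) → delay k j a n ≡ 0ℤ
    delay-miss k zero    a zero    n≢ = ⊥-elim (n≢ 0 ≡.refl)
    delay-miss k zero    a (suc n) n≢ = delay-miss k k (tail a) n (λ m e → n≢ (suc m) (cong suc e))
    delay-miss k (suc j) a zero    n≢ = ≡.refl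
    delay-miss k (suc j) a (suc n) n≢ = delay-miss k j a n (λ m e → n≢ m (cong suc e))

  module _ (k : ℕ) where
    dil-cong : ∀ {a b} → a ≗ b → dil k a ≗ dil k b
    dil-cong p n = delay-cong-≤ _ 0 n (λ {i} _ → p i)

    dil-congᵀ : ∀ {N a b} → _≈ᵀ_ N a b → _≈ᵀ_ N (dil k a) (dil k b)
    dil-congᵀ p {n} n<N = delay-cong-≤ _ 0 n (λ i≤n → p (ℕ.≤-<-trans i≤n n<N))

    dil-⊕ : ∀ a b → dil k (a ⊕ b) ≗ dil k a ⊕ dil k b
    dil-⊕ = delay-⊕ _ 0

    dil-⊗ : ∀ a b → dil k (a ⊗ b) ≗ dil k a ⊗ dil k b
    dil-⊗ = delay-⊗ _ 0

    dil-⊖ : ∀ a → dil k (⊖ a) ≗ ⊖ dil k a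
    dil-⊖ = delay-⊖ _ 0

    dil-𝟘 : dil k 𝟘 ≗ 𝟘
    dil-𝟘 = delay-𝟘 _ 0

    dil-one : dil k one ≗ one
    dil-one zero    = ≡.refl
    dil-one (suc n) = delay-𝟘 (ℕ.pred k) (ℕ.pred k) n

    dil-ι : ∀ i → dil k (ι i) ≗ ι i
    dil-ι i = trans (dil-cong (sym (*-identityʳ (ι i)))) (trans (delay-ι _ 0 i one)
      (trans (*-congˡ dil-one) (*-identityʳ (ι i))))

    dil-^ : ∀ a n → dil k (a ^ n) ≗ dil k a ^ n
    dil-^ a zero    = dil-one
    dil-^ a (suc n) = trans (dil-⊗ a (a ^ n)) (*-congˡ (dil-^ a n))

  module _ (k : ℕ) where
    dil-q : dil (suc k) q ≗ q ^ suc k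
    dil-q zero    = ≡.sym (q⊗-zero (q ^ k))
    dil-q (suc n) = ≡.trans (delay-cong-≤ k k n (λ {i} _ → tail-q i)) (≡.trans (delay-q^ k k one n)
      (≡.trans (trans (*-congˡ (dil-one (suc k))) (*-identityʳ (q ^ k)) n) (≡.sym (q⊗-suc (q ^ k) n))))
      where
      tail-q : tail q ≗ one
      tail-q zero    = ≡.refl
      tail-q (suc _) = ≡.refl

    dil-hit : ∀ a m → dil (suc k) a (m ℕ.* suc k) ≡ a m
    dil-hit = delay-hit k 0

    dil-miss : ∀ a n → (∀ m → n ≢ m ℕ.* suc k) → dil (suc k) a n ≡ 0ℤ
    dil-miss = delay-miss k 0

  dil-dil : ∀ j k a → dil (suc j) (dil (suc k) a) ≗ dil (suc j ℕ.* suc k) a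
  dil-dil j k a n with suc j ∣? n
  ... | no ∤n = ≡.trans (dil-miss j _ n (λ m e → ∤n (divides m e)))
    (≡.sym (dil-miss (k ℕ.+ j ℕ.* suc k) a n (λ m e → ∤n (divides (m ℕ.* suc k)
      (≡.trans e (≡.trans (cong (m ℕ.*_) (ℕ.*-comm (suc j) (suc k))) (≡.sym (ℕ.*-assoc m (suc k) (suc j)))))))))
  ... | yes (divides m ≡.refl) with suc k ∣? m
  ... | no ∤m = ≡.trans (dil-hit j _ m) (≡.trans (dil-miss k a m (λ l e → ∤m (divides l e)))
    (≡.sym (dil-miss (k ℕ.+ j ℕ.* suc k) a (m ℕ.* suc j) (λ l e → ∤m (divides l
      (ℕ.*-cancelʳ-≡ m (l ℕ.* suc k) (suc j) (≡.trans e
        (≡.trans (cong (l ℕ.*_) (ℕ.*-comm (suc j) (suc k))) (≡.sym (ℕ.*-assoc l (suc k) (suc j)))))))))))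
  ... | yes (divides l ≡.refl) = ≡.trans (dil-hit j _ (l ℕ.* suc k)) (≡.trans (dil-hit k a l)
    (≡.sym (≡.trans (cong (dil (suc j ℕ.* suc k) a)
      (≡.trans (ℕ.*-assoc l (suc k) (suc j)) (cong (l ℕ.*_) (ℕ.*-comm (suc k) (suc j)))))
      (dil-hit (k ℕ.+ j ℕ.* suc k) a l))))

  -- Odd parts

  odd : Series → Series
  odd a n = a (suc (n ℕ.* 2))

  data Parity : ℕ → Set where
    is-even : ∀ n → Parity (n ℕ.* 2)
    is-odd  : ∀ n → Parity (suc (n ℕ.* 2))

  parity : ∀ n → Parity n
  parity zero = is-even 0
  parity (suc n) with parity n
  ... | is-even m = is-odd m
  ... | is-odd m  = is-even (suc m)

  odd≢even : ∀ n m → suc (n ℕ.* 2) ≢ m ℕ.* 2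
  odd≢even (suc n) (suc m) e = odd≢even n m (ℕ.suc-injective (ℕ.suc-injective e))

  odd-dil : ∀ a b → odd (dil 2 a ⊕ q ⊗ dil 2 b) ≗ b
  odd-dil a b n = ≡.trans (⊕-coeff (dil 2 a) (q ⊗ dil 2 b) (suc (n ℕ.* 2)))
    (≡.trans (cong₂ ℤ._+_ (dil-miss 1 a _ (odd≢even n)) (≡.trans (q⊗-suc (dil 2 b) (n ℕ.* 2)) (dil-hit 1 b n)))
      (ℤ.+-identityˡ (b n)))

-- Theta series, Euler products and Gauss's identities as identities of series.

module EulerProducts where
  open SeriesRing
  open SeriesOperations
  open CommutativeRing seriesRing hiding (Carrier; _≈_; isEquivalence; zero)
  open IntegerCoefficients seriesRing
  open FiniteSum seriesRing
  open GaussTriangular seriesRing q using (odds; evens; odds*triangular)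
  open GaussSquare seriesRing q using (minus; plus; plus*theta)
  open ThetaDissection seriesRing q using (theta-dissection)
  open Truncation using (_≈ᵀ_; truncatedRing)
  module T (N : ℕ) = CommutativeRing (truncatedRing N)

  private module ≗-Reasoning = Relation.Binary.Reasoning.Setoid setoid

  ≗⇒≈ᵀ : ∀ N {a b} → a ≗ b → _≈ᵀ_ N a b
  ≗⇒≈ᵀ N p {n} _ = p n

  q^≈ᵀ0 : ∀ {N e} → N ≤ e → _≈ᵀ_ N (q ^ e) 𝟘
  q^≈ᵀ0 {N} {e} N≤e {n} n<N = q^-off e n (λ { ≡.refl → ℕ.<⇒≱ n<N N≤e })

  q^⊗≈ᵀ0′ : ∀ {N e} a → N ≤ e → _≈ᵀ_ N (q ^ e ⊗ a) 𝟘
  q^⊗≈ᵀ0′ {N} {e} a N≤e n<N = q^⊗≈ᵀ0 e a (ℕ.<-≤-trans n<N N≤e)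

  drop-error : ∀ {N e a b} → N ≤ e → (∃ λ t → a ≗ b ⊕ q ^ e ⊗ t) → _≈ᵀ_ N a b
  drop-error {N} {e} {a} {b} N≤e (t , a≗) = T.trans N {a} {b ⊕ q ^ e ⊗ t} {b} (≗⇒≈ᵀ N a≗)
    (T.trans N {b ⊕ q ^ e ⊗ t} {b ⊕ 𝟘} {b} (T.+-congˡ N {b} (q^⊗≈ᵀ0′ t N≤e)) (T.+-identityʳ N b))

  ∑-cong : ∀ {g h} → (∀ m → g m ≗ h m) → ∀ n → ∑ g n ≗ ∑ h n
  ∑-cong p zero    = λ _ → ≡.refl
  ∑-cong p (suc n) = +-cong (∑-cong p n) (p n)

  ∑-convergent : ∀ {g} → (∀ m → _≈ᵀ_ m (g m) 𝟘) → Convergent (∑ g)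
  ∑-convergent {g} p N = T.sym N {∑ g N ⊕ g N} {∑ g N}
    (T.trans N {∑ g N ⊕ g N} {∑ g N ⊕ 𝟘} {∑ g N}
      (T.+-cong N {∑ g N} {∑ g N} {g N} {𝟘} (λ _ → ≡.refl) (p N)) (T.+-identityʳ N (∑ g N)))

  dil-∑ : ∀ k g n → dil k (∑ g n) ≗ ∑ (λ m → dil k (g m)) n
  dil-∑ k g zero    = dil-𝟘 k
  dil-∑ k g (suc n) = trans (dil-⊕ k (∑ g n) (g n)) (+-congʳ (dil-∑ k g n))

  dil-q^ : ∀ k e → dil (suc k) (q ^ e) ≗ (q ^ suc k) ^ e
  dil-q^ k e = trans (dil-^ (suc k) q e) (^-congˡ e (dil-q k))

  -- Intended for exponents with m ≤ e m: then the terms from m = N on do not touch the coefficients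
  -- below q^N, and the partial sums converge.
  powerSum : (ℕ → ℕ) → Series
  powerSum e = lim (∑ (λ m → q ^ e m))

  powerSum≈ᵀ : ∀ {e} → (∀ m → m ≤ e m) → ∀ N {M} → N ≤ M → _≈ᵀ_ N (powerSum e) (∑ (λ m → q ^ e m) M)
  powerSum≈ᵀ le N {M} N≤M n<N =
    lim≈ᵀ (∑-convergent (λ m → q^≈ᵀ0 (le m))) M (ℕ.<-≤-trans n<N N≤M)

  dil-powerSum≈ᵀ : ∀ k {e} → (∀ m → m ≤ e m) → ∀ N {M} → N ≤ M →
                   _≈ᵀ_ N (dil (suc k) (powerSum e)) (∑ (λ m → (q ^ suc k) ^ e m) M)
  dil-powerSum≈ᵀ k {e} le N {M} N≤M {n} n<N = ≡.trans (dil-congᵀ (suc k) (powerSum≈ᵀ le N N≤M) n<N)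
    (trans (dil-∑ (suc k) (λ m → q ^ e m) M) (∑-cong (λ m → dil-q^ k (e m)) M) n)

  -- Ramanujan's φ(q) = ∑_{x ∈ ℤ} q^(x²), ψ(q) = ∑_{n ≥ 0} q^(n(n+1)/2) and φ(-q);
  -- ψ is split according to the parity of n.

  φ⁺ φ φ⁻ ψ : Series
  φ⁺ = powerSum (λ m → suc m ℕ.* suc m)
  φ  = one ⊕ ι (+ 2) ⊗ φ⁺
  φ⁻ = lim (∑ (λ m → (- one ⊗ q ^ suc m) ^ suc m))
  ψ  = powerSum (λ m → m ℕ.* (1 ℕ.+ 2 ℕ.* m)) ⊕ powerSum (λ m → suc m ℕ.* (1 ℕ.+ 2 ℕ.* m))

  φ[-q] : Series
  φ[-q] = one ⊕ ι (+ 2) ⊗ φ⁻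

  square-≥ : ∀ m → m ≤ suc m ℕ.* suc m
  square-≥ m = ℕ.≤-trans (ℕ.n≤1+n m) (ℕ.m≤m*n (suc m) (suc m))

  triangle₁-≥ : ∀ m → m ≤ m ℕ.* (1 ℕ.+ 2 ℕ.* m)
  triangle₁-≥ m = ℕ.m≤m*n m (1 ℕ.+ 2 ℕ.* m)

  triangle₂-≥ : ∀ m → m ≤ suc m ℕ.* (1 ℕ.+ 2 ℕ.* m)
  triangle₂-≥ m = ℕ.≤-trans (ℕ.n≤1+n m) (ℕ.m≤m*n (suc m) (1 ℕ.+ 2 ℕ.* m))

  private
    theta-term : ∀ ε m → (ε ⊗ q ^ suc m) ^ suc m ≗ q ^ (suc m ℕ.* suc m) ⊗ ε ^ suc m
    theta-term ε m = trans (^-distrib-* ε (q ^ suc m) (suc m))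
      (trans (*-comm _ _) (*-congʳ (^-assocʳ q (suc m) (suc m))))
      where open import Algebra.Properties.CommutativeSemiring.Exp commutativeSemiring using (^-distrib-*)

    theta-convergent : ∀ ε → Convergent (∑ (λ m → (ε ⊗ q ^ suc m) ^ suc m))
    theta-convergent ε = ∑-convergent λ m {n} n<m →
      ≡.trans (theta-term ε m n) (q^⊗≈ᵀ0′ (ε ^ suc m) (square-≥ m) n<m)

    1^ : ∀ n → one ^ n ≗ one
    1^ zero    = refl
    1^ (suc n) = trans (*-identityˡ (one ^ n)) (1^ n)

  ψ≈ᵀ : ∀ N {M} → N ≤ M → _≈ᵀ_ N ψ (triangular q M)
  ψ≈ᵀ N N≤M = T.+-cong N (powerSum≈ᵀ triangle₁-≥ N N≤M) (powerSum≈ᵀ triangle₂-≥ N N≤M)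

  dil-ψ≈ᵀ : ∀ k N {M} → N ≤ M → _≈ᵀ_ N (dil (suc k) ψ) (triangular (q ^ suc k) M)
  dil-ψ≈ᵀ k N N≤M = T.trans N (≗⇒≈ᵀ N (dil-⊕ (suc k) _ _))
    (T.+-cong N (dil-powerSum≈ᵀ k triangle₁-≥ N N≤M) (dil-powerSum≈ᵀ k triangle₂-≥ N N≤M))

  φ≈ᵀ : ∀ N {M} → N ≤ M → _≈ᵀ_ N φ (theta q one M)
  φ≈ᵀ N {M} N≤M = T.+-congˡ N (T.*-congˡ N (T.trans N (powerSum≈ᵀ square-≥ N N≤M)
    (≗⇒≈ᵀ N (∑-cong (λ m → sym (trans (theta-term one m)
      (trans (*-congˡ (1^ (suc m))) (*-identityʳ _)))) M))))

  φ[-q]≈ᵀ : ∀ N {M} → N ≤ M → _≈ᵀ_ N φ[-q] (theta q (- one) M)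
  φ[-q]≈ᵀ N {M} N≤M = T.+-congˡ N (T.*-congˡ N
    (λ n<N → lim≈ᵀ (theta-convergent (- one)) M (ℕ.<-≤-trans n<N N≤M)))

  dil-φ≈ᵀ : ∀ k N {M} → N ≤ M →
    _≈ᵀ_ N (dil (suc k) φ) (one ⊕ (one ⊕ one) ⊗ ∑ (λ m → (q ^ suc k) ^ (suc m ℕ.* suc m)) M)
  dil-φ≈ᵀ k N N≤M = T.trans N
    (≗⇒≈ᵀ N (trans (dil-⊕ (suc k) one _) (+-cong (dil-one (suc k))
      (trans (dil-⊗ (suc k) (ι (+ 2)) φ⁺) (*-congʳ (dil-ι (suc k) (+ 2)))))))
    (T.+-congˡ N (T.*-congˡ N (dil-powerSum≈ᵀ k square-≥ N N≤M)))

  private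
    dissection : ∀ ε → ε ⊗ ε ≗ one → ∀ N →
      _≈ᵀ_ N (theta q ε (N ℕ.* 4)) (dil 4 φ ⊕ (one ⊕ one) ⊗ (ε ⊗ (q ⊗ dil 8 ψ)))
    dissection ε ε² N = T.trans N (≗⇒≈ᵀ N (theta-dissection ε ε² N))
      (T.sym N (T.+-cong N (dil-φ≈ᵀ 3 N (ℕ.m≤m*n N 2))
        (T.*-congˡ N (T.*-congˡ N (T.*-congˡ N (dil-ψ≈ᵀ 7 N ℕ.≤-refl))))))

  φ-dissection : φ ≗ dil 4 φ ⊕ ι (+ 2) ⊗ (q ⊗ dil 8 ψ)
  φ-dissection = trans
    (≈ᵀ⇒≗ λ N → T.trans N (φ≈ᵀ N (ℕ.m≤m*n N 4)) (dissection one (*-identityˡ one) N))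
    (+-congˡ (*-congˡ (*-identityˡ _)))

  φ[-q]-dissection : φ[-q] ≗ dil 4 φ - ι (+ 2) ⊗ (q ⊗ dil 8 ψ)
  φ[-q]-dissection = trans
    (≈ᵀ⇒≗ λ N → T.trans N (φ[-q]≈ᵀ N (ℕ.m≤m*n N 4)) (dissection (- one)
      (solve 0 (con -[1+ 0 ] :* con -[1+ 0 ] := con (+ 1)) refl) N))
    (solve 2 (λ x y → x :+ con (+ 2) :* (con -[1+ 0 ] :* y) := x :- con (+ 2) :* y) refl
      (dil 4 φ) (q ⊗ dil 8 ψ))

  -- Euler products

  oneMinusQ^≗ : ∀ d → oneMinusQ^ (suc d) ≗ one - q ^ suc d
  oneMinusQ^≗ d n = ≡.trans (go d n) (≡.sym (≡.trans (⊕-coeff one (⊖ (q ^ suc d)) n)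
    (cong (λ x → one n ℤ.+ x) (⊖-coeff (q ^ suc d) n))))
    where
    go : ∀ d n → oneMinusQ^ (suc d) n ≡ one n ℤ.- (q ^ suc d) n
    go d zero = cong (λ x → 1ℤ ℤ.- x) (≡.sym (q⊗-zero (q ^ d)))
    go zero (suc zero) = cong (λ x → 0ℤ ℤ.- x) (≡.sym (q⊗-suc one 0))
    go zero (suc (suc n)) = cong (λ x → 0ℤ ℤ.- x) (≡.sym (q⊗-suc one (suc n)))
    go (suc d) (suc zero) = cong (λ x → 0ℤ ℤ.- x) (≡.sym (≡.trans (q⊗-suc (q ^ suc d) 0) (q⊗-zero (q ^ d))))
    -- Both sides unfold to the same local function of `oneMinusQ^`, which ignores its parameters.
    go (suc d) (suc (suc n)) = ≡.trans (go d (suc n))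
      (cong (λ x → 0ℤ ℤ.- x) (≡.sym (q⊗-suc (q ^ suc d) (suc n))))

  eulerTrunc-suc : ∀ k N → let m = suc k in
    eulerTrunc m (suc N) ≗ eulerTrunc m N ⊗ (one - q ^ (m ℕ.* suc N))
  eulerTrunc-suc k N n = ≡.trans (·-cong {eulerTrunc (suc k) N} (λ _ → ≡.refl) (oneMinusQ^≗ (N ℕ.+ k ℕ.* suc N)) n)
    (≡.sym (⊗-coeff (eulerTrunc (suc k) N) _ n))

  eulerTrunc-convergent : ∀ k → Convergent (λ N → eulerTrunc (suc k) N)
  eulerTrunc-convergent k N = T.sym N (T.trans N (≗⇒≈ᵀ N (eulerTrunc-suc k N))
    (T.trans N (T.*-congˡ N (T.+-congˡ N (T.-‿cong N (q^≈ᵀ0 {N} {suc k ℕ.* suc N}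
      (ℕ.≤-trans (ℕ.n≤1+n N) (ℕ.m≤n*m (suc N) (suc k)))))))
      (≗⇒≈ᵀ N (solve 1 (λ x → x :* (con (+ 1) :- con (+ 0)) := x) refl (eulerTrunc (suc k) N)))))

  -- `f` reads coefficient n after n factors, `lim` after n + 1; the extra factor 1 - q^((k+1)(n+1))
  -- does not reach degree n.
  f≗lim : ∀ k → f (suc k) ≗ lim (eulerTrunc (suc k))
  f≗lim k n = ≡.sym (≡.trans (eulerTrunc-suc k n n) (≡.trans
    (⊗-cong-≤ n (λ _ → ≡.refl) (λ {i} i≤n → T.trans (suc n)
      (T.+-congˡ (suc n) (T.-‿cong (suc n) (q^≈ᵀ0 {suc n} {suc k ℕ.* suc n} (ℕ.m≤n*m (suc n) (suc k)))))
      (≗⇒≈ᵀ (suc n) (solve 0 (con (+ 1) :- con (+ 0) := con (+ 1)) refl)) (s≤s i≤n)))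
    (*-identityʳ (eulerTrunc (suc k) n) n)))

  f≈ᵀ : ∀ k N {M} → N ≤ M → _≈ᵀ_ N (f (suc k)) (eulerTrunc (suc k) M)
  f≈ᵀ k N {M} N≤M {n} n<N =
    ≡.trans (f≗lim k n) (lim≈ᵀ (eulerTrunc-convergent k) M (ℕ.<-≤-trans n<N N≤M))

  f-dil : ∀ k → f (suc k) ≗ dil (suc k) (f 1)
  f-dil k = ≈ᵀ⇒≗ λ N → T.trans N (f≈ᵀ k N ℕ.≤-refl) (T.sym N (T.trans N
    (dil-congᵀ (suc k) (f≈ᵀ 0 N ℕ.≤-refl)) (≗⇒≈ᵀ N (dil-eulerTrunc N))))
    where
    dil-eulerTrunc : ∀ N → dil (suc k) (eulerTrunc 1 N) ≗ eulerTrunc (suc k) N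
    dil-eulerTrunc zero = dil-one (suc k)
    dil-eulerTrunc (suc N) = begin
      dil K (eulerTrunc 1 (suc N))
        ≈⟨ dil-cong K (eulerTrunc-suc 0 N) ⟩
      dil K (eulerTrunc 1 N ⊗ (one - q ^ (1 ℕ.* suc N)))
        ≈⟨ trans (dil-⊗ K (eulerTrunc 1 N) _) (*-cong (dil-eulerTrunc N) (begin
             dil K (one - q ^ (1 ℕ.* suc N))
               ≈⟨ trans (dil-⊕ K one _) (+-cong (dil-one K) (dil-⊖ K (q ^ (1 ℕ.* suc N)))) ⟩
             one - dil K (q ^ (1 ℕ.* suc N))
               ≈⟨ +-congˡ (-‿cong (trans (dil-q^ k (1 ℕ.* suc N)) (trans (^-assocʳ q K (1 ℕ.* suc N))
                    (^-congʳ q (cong (K ℕ.*_) (ℕ.*-identityˡ (suc N))))))) ⟩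
             one - q ^ (K ℕ.* suc N) ∎)) ⟩
      eulerTrunc K N ⊗ (one - q ^ (K ℕ.* suc N))
        ≈⟨ eulerTrunc-suc k N ⟨
      eulerTrunc K (suc N) ∎
      where open ≗-Reasoning ; K = suc k

  private
    eulerTrunc-minus : ∀ N → eulerTrunc 1 N ≗ minus N
    eulerTrunc-minus zero    = refl
    eulerTrunc-minus (suc N) = trans (eulerTrunc-suc 0 N) (*-cong (eulerTrunc-minus N)
      (+-congˡ (-‿cong (^-congʳ q (ℕ.*-identityˡ (suc N))))))

    -- 1 - q^(2n) = (1 - q^n)(1 + q^n) exhibits inside f_2 the factor `plus` demanded by the finite
    -- identity for squares.
    eulerTrunc-minus-plus : ∀ N → eulerTrunc 2 N ≗ minus N ⊗ plus N
    eulerTrunc-minus-plus zero    = sym (*-identityˡ one)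
    eulerTrunc-minus-plus (suc N) = trans (eulerTrunc-suc 1 N)
      (trans (*-cong (eulerTrunc-minus-plus N) (+-congˡ (-‿cong
        (trans (^-congʳ q (cong (suc N ℕ.+_) (ℕ.+-identityʳ (suc N)))) (^-homo-* q (suc N) (suc N))))))
      (solve 3 (λ m p u → m :* p :* (con (+ 1) :- u :* u)
         := m :* (con (+ 1) :- u) :* (p :* (con (+ 1) :+ u))) refl (minus N) (plus N) (q ^ suc N)))

    eulerTrunc-evens : ∀ N → eulerTrunc 2 N ≗ evens N
    eulerTrunc-evens zero    = refl
    eulerTrunc-evens (suc N) = trans (eulerTrunc-suc 1 N)
      (*-cong (eulerTrunc-evens N) (+-congˡ (-‿cong (^-congʳ q (ℕ.*-suc 2 N)))))

    eulerTrunc-odds-evens : ∀ N → eulerTrunc 1 (N ℕ.* 2) ≗ odds N ⊗ evens N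
    eulerTrunc-odds-evens zero    = sym (*-identityˡ one)
    eulerTrunc-odds-evens (suc N) = begin
      eulerTrunc 1 (2 ℕ.+ N ℕ.* 2)
        ≈⟨ trans (eulerTrunc-suc 0 (suc (N ℕ.* 2))) (*-congʳ (eulerTrunc-suc 0 (N ℕ.* 2))) ⟩
      eulerTrunc 1 (N ℕ.* 2) ⊗ (one - q ^ (1 ℕ.* (1 ℕ.+ N ℕ.* 2))) ⊗ (one - q ^ (1 ℕ.* (2 ℕ.+ N ℕ.* 2)))
        ≈⟨ *-cong (*-cong (eulerTrunc-odds-evens N) (+-congˡ (-‿cong (^-congʳ q (exponent (λ x → 1 ℕ.+ x))))))
             (+-congˡ (-‿cong (^-congʳ q (exponent (λ x → 2 ℕ.+ x))))) ⟩
      odds N ⊗ evens N ⊗ (one - q ^ (1 ℕ.+ 2 ℕ.* N)) ⊗ (one - q ^ (2 ℕ.+ 2 ℕ.* N))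
        ≈⟨ solve 4 (λ o e x y → o :* e :* x :* y := o :* x :* (e :* y)) refl (odds N) (evens N) _ _ ⟩
      odds (suc N) ⊗ evens (suc N) ∎
      where
      open ≗-Reasoning
      exponent : (g : ℕ → ℕ) → 1 ℕ.* g (N ℕ.* 2) ≡ g (2 ℕ.* N)
      exponent g = ≡.trans (ℕ.*-identityˡ _) (cong g (ℕ.*-comm N 2))

  -- Modulo q^N, f_2 is `minus` times `plus`, and `plus*theta` converts `plus` times φ(-q) into a
  -- second `minus` up to an error divisible by q^(N+1).
  f₂φ[-q]≗f₁² : f 2 ⊗ φ[-q] ≗ f 1 ⊗ f 1
  f₂φ[-q]≗f₁² = ≈ᵀ⇒≗ go
    where
    go : ∀ N → _≈ᵀ_ N (f 2 ⊗ φ[-q]) (f 1 ⊗ f 1)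
    go N with plus*theta N
    ... | t , e = begin
      f 2 ⊗ φ[-q]
        ≈⟨ T.*-cong N (T.trans N (f≈ᵀ 1 N ℕ.≤-refl) (≗⇒≈ᵀ N (eulerTrunc-minus-plus N))) (φ[-q]≈ᵀ N ℕ.≤-refl) ⟩
      minus N ⊗ plus N ⊗ theta q (- one) N
        ≈⟨ ≗⇒≈ᵀ N (trans (*-assoc (minus N) (plus N) _) (*-congˡ e)) ⟩
      minus N ⊗ (minus N ⊕ (- one) ⊗ q ^ suc N ⊗ t)
        ≈⟨ ≗⇒≈ᵀ N (solve 3 (λ m u t → m :* (m :+ con -[1+ 0 ] :* u :* t) := m :* m :+ u :* (:- (m :* t)))
             refl (minus N) (q ^ suc N) t) ⟩
      minus N ⊗ minus N ⊕ q ^ suc N ⊗ (- (minus N ⊗ t))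
        ≈⟨ T.trans N (T.+-congˡ N (q^⊗≈ᵀ0′ {N} {suc N} (- (minus N ⊗ t)) (ℕ.n≤1+n N))) (T.+-identityʳ N _) ⟩
      minus N ⊗ minus N
        ≈⟨ T.*-cong N minus≈ minus≈ ⟩
      f 1 ⊗ f 1 ∎
      where
      open Relation.Binary.Reasoning.Setoid (T.setoid N)
      minus≈ : _≈ᵀ_ N (minus N) (f 1)
      minus≈ = T.sym N (T.trans N (f≈ᵀ 0 N ℕ.≤-refl) (≗⇒≈ᵀ N (eulerTrunc-minus N)))

  private
    odds*triangular≈ᵀ : ∀ N → _≈ᵀ_ N (odds N ⊗ triangular q N) (evens N)
    odds*triangular≈ᵀ zero ()
    odds*triangular≈ᵀ (suc M) = drop-error {suc M} {1 ℕ.+ 2 ℕ.* suc M}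
      (ℕ.≤-trans (ℕ.m≤n*m (suc M) 2) (ℕ.n≤1+n (2 ℕ.* suc M))) (odds*triangular M)

  -- The first 2N factors of f_1 are `odds` times `evens`; the finite identity converts `odds` times
  -- ψ into a second `evens`.
  f₁ψ≗f₂² : f 1 ⊗ ψ ≗ f 2 ⊗ f 2
  f₁ψ≗f₂² = ≈ᵀ⇒≗ go
    where
    go : ∀ N → _≈ᵀ_ N (f 1 ⊗ ψ) (f 2 ⊗ f 2)
    go N = begin
      f 1 ⊗ ψ
        ≈⟨ T.*-cong N (T.trans N (f≈ᵀ 0 N {N ℕ.* 2} (ℕ.m≤m*n N 2)) (≗⇒≈ᵀ N (eulerTrunc-odds-evens N))) (ψ≈ᵀ N ℕ.≤-refl) ⟩
      odds N ⊗ evens N ⊗ triangular q N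
        ≈⟨ ≗⇒≈ᵀ N (solve 3 (λ o e t → o :* e :* t := e :* (o :* t)) refl (odds N) (evens N) (triangular q N)) ⟩
      evens N ⊗ (odds N ⊗ triangular q N)
        ≈⟨ T.*-congˡ N (odds*triangular≈ᵀ N) ⟩
      evens N ⊗ evens N
        ≈⟨ T.*-cong N evens≈ evens≈ ⟩
      f 2 ⊗ f 2 ∎
      where
      open Relation.Binary.Reasoning.Setoid (T.setoid N)
      evens≈ : _≈ᵀ_ N (evens N) (f 2)
      evens≈ = T.sym N (T.trans N (f≈ᵀ 1 N ℕ.≤-refl) (≗⇒≈ᵀ N (eulerTrunc-evens N)))

-- Theta identities from bijections of index sets.

module ThetaEnumeration where
  open SeriesRing
  open SeriesOperations
  open EulerProducts

  -- s = ∑_{i ∈ I} q^(e i), witnessed by the finite fibres of e.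
  record Enumeration {I : Set} (e : I → ℕ) (s : Series) : Set where
    field
      fibre    : ℕ → List I
      unique   : ∀ n → Unique (fibre n)
      sound    : ∀ {n i} → i ∈ fibre n → e i ≡ n
      complete : ∀ i → i ∈ fibre (e i)
      coeff    : ∀ n → s n ≡ + length (fibre n)

  open Enumeration

  -- Two fibres over the same n have the same members without repetition, hence are permutations of
  -- each other. With `reindex`, a theta identity becomes an exponent-preserving bijection.
  Enumeration-unique : ∀ {I} {e e′ : I → ℕ} {s s′} →
                       Enumeration e s → Enumeration e′ s′ → e ≗ e′ → s ≗ s′
  Enumeration-unique S S′ e≗e′ n = ≡.trans (coeff S n) (≡.trans
    (cong +_ (↭-length (∼bag⇒↭ (unique∧set⇒bag (unique S n) (unique S′ n)
      (mk⇔ (λ i∈ → subst (λ m → _ ∈ fibre S′ m) (≡.trans (≡.sym (e≗e′ _)) (sound S i∈)) (complete S′ _))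
           (λ i∈ → subst (λ m → _ ∈ fibre S m) (≡.trans (e≗e′ _) (sound S′ i∈)) (complete S _)))))))
    (≡.sym (coeff S′ n)))

  reindex : ∀ {I J} {e : I → ℕ} {s} (b : J ↔ I) → Enumeration e s → Enumeration (e ∘ Inverse.to b) s
  reindex {e = e} b S = record
    { fibre    = map from ∘ fibre S
    ; unique   = λ n → Unique.map⁺ (λ {x} {y} p →
        ≡.trans (≡.sym (strictlyInverseˡ x)) (≡.trans (cong to p) (strictlyInverseˡ y))) (unique S n)
    ; sound    = λ j∈ → let i , i∈ , j≡ = ∈-map⁻ from j∈ in
        ≡.trans (cong e (≡.trans (cong to j≡) (strictlyInverseˡ i))) (sound S i∈)
    ; complete = λ j → subst (_∈ map from (fibre S (e (to j)))) (strictlyInverseʳ j)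
        (∈-map⁺ from (complete S (to j)))
    ; coeff    = λ n → ≡.trans (coeff S n) (cong +_ (≡.sym (length-map from (fibre S n)))) }
    where open Inverse b

  enum-cong : ∀ {I} {e e′ : I → ℕ} {s s′} → e ≗ e′ → s ≗ s′ → Enumeration e s → Enumeration e′ s′
  enum-cong p r S = record
    { fibre    = fibre S
    ; unique   = unique S
    ; sound    = λ i∈ → ≡.trans (≡.sym (p _)) (sound S i∈)
    ; complete = λ i → subst (λ n → i ∈ fibre S n) (p i) (complete S i)
    ; coeff    = λ n → ≡.trans (≡.sym (r n)) (coeff S n) }

  enum-one : Enumeration {⊤} (λ _ → 0) one
  enum-one = record
    { fibre    = λ { zero → [ tt ] ; (suc _) → [] }
    ; unique   = λ { zero → All.[] ∷ [] ; (suc _) → [] }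
    ; sound    = λ { {zero} _ → ≡.refl }
    ; complete = λ _ → here ≡.refl
    ; coeff    = λ { zero → ≡.refl ; (suc _) → ≡.refl } }

  enum-⊕ : ∀ {I J} {e : I → ℕ} {e′ : J → ℕ} {s s′} →
           Enumeration e s → Enumeration e′ s′ → Enumeration [ e , e′ ]′ (s ⊕ s′)
  enum-⊕ {e = e} {e′} {s} {s′} S S′ = record
    { fibre    = F
    ; unique   = λ n → Unique.++⁺ (Unique.map⁺ inj₁-injective (unique S n))
        (Unique.map⁺ inj₂-injective (unique S′ n))
        λ (p , r) → let _ , _ , x≡ = ∈-map⁻ inj₁ p ; _ , _ , y≡ = ∈-map⁻ inj₂ r in
          case-⊥ (≡.trans (≡.sym x≡) y≡)
    ; sound    = λ {n} i∈ → [ (λ p → let _ , j∈ , x≡ = ∈-map⁻ inj₁ p in ≡.trans (cong [ e , e′ ]′ x≡) (sound S j∈))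
                            , (λ p → let _ , j∈ , x≡ = ∈-map⁻ inj₂ p in ≡.trans (cong [ e , e′ ]′ x≡) (sound S′ j∈))
                            ]′ (∈-++⁻ (map inj₁ (fibre S n)) i∈)
    ; complete = λ { (inj₁ i) → ∈-++⁺ˡ (∈-map⁺ inj₁ (complete S i))
                   ; (inj₂ j) → ∈-++⁺ʳ _ (∈-map⁺ inj₂ (complete S′ j)) }
    ; coeff    = λ n → ≡.trans (⊕-coeff s s′ n) (≡.trans (cong₂ ℤ._+_ (coeff S n) (coeff S′ n))
        (cong +_ (≡.sym (≡.trans (length-++ (map inj₁ (fibre S n)))
          (cong₂ ℕ._+_ (length-map inj₁ (fibre S n)) (length-map inj₂ (fibre S′ n))))))) }
    where
    F = λ n → map inj₁ (fibre S n) ++ map inj₂ (fibre S′ n)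
    case-⊥ : ∀ {A B : Set} {x : A} {y : B} {Z : Set} → inj₁ x ≡ inj₂ y → Z
    case-⊥ ()

  -- The blocks are the products of the fibres over k and n - k; they are disjoint because the
  -- exponent of the first component recovers k.
  enum-⊗ : ∀ {I J} {e : I → ℕ} {e′ : J → ℕ} {s s′} →
           Enumeration e s → Enumeration e′ s′ → Enumeration (λ (i , j) → e i ℕ.+ e′ j) (s ⊗ s′)
  enum-⊗ {e = e} {e′} {s} {s′} S S′ = record
    { fibre    = λ n → concat (map (block n) (upTo (suc n)))
    ; unique   = λ n → Unique.concat⁺
        (All.map⁺ (All.applyUpTo⁺₂ _ (suc n) λ k → Unique.cartesianProduct⁺ (unique S k) (unique S′ (n ∸ k))))
        (AllPairs.map⁺ (AllPairs.applyUpTo⁺₁ _ (suc n) λ k<l _ (p , r) → ℕ.<⇒≢ k<l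
          (≡.trans (≡.sym (fst-sound n p)) (fst-sound n r))))
    ; sound    = λ {n} {ij} ij∈ → sound′ n ij ij∈
    ; complete = λ (i , j) → ∈-concat⁺′
        (∈-cartesianProduct⁺ (complete S i)
          (subst (λ m → j ∈ fibre S′ m) (≡.sym (ℕ.m+n∸m≡n (e i) (e′ j))) (complete S′ j)))
        (∈-map⁺ (block (e i ℕ.+ e′ j)) (∈-upTo⁺ (s≤s (ℕ.m≤m+n (e i) (e′ j)))))
    ; coeff    = λ n → ≡.trans (⊗-coeff s s′ n) (count n (upTo (suc n))) }
    where
    block : ℕ → ℕ → List _
    block n k = cartesianProduct (fibre S k) (fibre S′ (n ∸ k))

    fst-sound : ∀ n {k ij} → ij ∈ block n k → e (proj₁ ij) ≡ k
    fst-sound n {k} ij∈ = sound S (proj₁ (∈-cartesianProduct⁻ (fibre S k) (fibre S′ (n ∸ k)) ij∈))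

    sound′ : ∀ n ij → ij ∈ concat (map (block n) (upTo (suc n))) → e (proj₁ ij) ℕ.+ e′ (proj₂ ij) ≡ n
    sound′ n ij ij∈ with ∈-concat⁻′ (map (block n) (upTo (suc n))) ij∈
    ... | _ , ij∈xs , xs∈ with ∈-map⁻ (block n) xs∈
    ... | k , k∈ , ≡.refl = ≡.trans
      (cong₂ ℕ._+_ (fst-sound n ij∈xs) (sound S′ (proj₂ (∈-cartesianProduct⁻ (fibre S k) _ ij∈xs))))
      (ℕ.m+[n∸m]≡n (ℕ.≤-pred (∈-upTo⁻ k∈)))

    length-cartesianProduct : ∀ {A B : Set} (xs : List A) (ys : List B) →
                              length (cartesianProduct xs ys) ≡ length xs ℕ.* length ys
    length-cartesianProduct []       ys = ≡.refl
    length-cartesianProduct (x ∷ xs) ys = ≡.trans (length-++ (map (x ,_) ys))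
      (cong₂ ℕ._+_ (length-map (x ,_) ys) (length-cartesianProduct xs ys))

    count : ∀ n ks → sumℤ (map (λ k → s k ℤ.* s′ (n ∸ k)) ks) ≡ + length (concat (map (block n) ks))
    count n []       = ≡.refl
    count n (k ∷ ks) = ≡.trans (cong₂ ℤ._+_
        (≡.trans (cong₂ ℤ._*_ (coeff S k) (coeff S′ (n ∸ k)))
          (≡.trans (≡.sym (ℤ.pos-* (length (fibre S k)) (length (fibre S′ (n ∸ k)))))
            (cong +_ (≡.sym (length-cartesianProduct (fibre S k) (fibre S′ (n ∸ k)))))))
        (count n ks))
      (cong +_ (≡.sym (length-++ (block n k))))

  enum-dil : ∀ k {I} {e : I → ℕ} {s} → Enumeration e s → Enumeration (λ i → e i ℕ.* suc k) (dil (suc k) s)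
  enum-dil k {I} {e} {s} S = record
    { fibre = F ; unique = unique′ ; sound = λ {n} → sound′ n
    ; complete = λ i → complete′ i (e i ℕ.* suc k) ≡.refl ; coeff = coeff′ }
    where
    F : ℕ → List I
    F n with suc k ∣? n
    ... | yes (divides m _) = fibre S m
    ... | no _              = []

    unique′ : ∀ n → Unique (F n)
    unique′ n with suc k ∣? n
    ... | yes (divides m _) = unique S m
    ... | no _              = []

    sound′ : ∀ n {i} → i ∈ F n → e i ℕ.* suc k ≡ n
    sound′ n i∈ with suc k ∣? n
    ... | yes (divides m n≡) = ≡.trans (cong (ℕ._* suc k) (sound S i∈)) (≡.sym n≡)
    ... | no _               with () ← i∈

    complete′ : ∀ i n → e i ℕ.* suc k ≡ n → i ∈ F n
    complete′ i n e≡ with suc k ∣? n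
    ... | yes (divides m n≡) = subst (λ m → i ∈ fibre S m)
      (ℕ.*-cancelʳ-≡ (e i) m (suc k) (≡.trans e≡ n≡)) (complete S i)
    ... | no ∤n              = ⊥-elim (∤n (divides (e i) (≡.sym e≡)))

    coeff′ : ∀ n → dil (suc k) s n ≡ + length (F n)
    coeff′ n with suc k ∣? n
    ... | yes (divides m ≡.refl) = ≡.trans (dil-hit k s m) (coeff S m)
    ... | no ∤n                  = dil-miss k s n (λ m n≡ → ∤n (divides m n≡))

  enum-q⊗ : ∀ {I} {e : I → ℕ} {s} → Enumeration e s → Enumeration (suc ∘ e) (q ⊗ s)
  enum-q⊗ {s = s} S = record
    { fibre    = λ { zero → [] ; (suc n) → fibre S n }
    ; unique   = λ { zero → [] ; (suc n) → unique S n }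
    ; sound    = λ { {suc n} i∈ → cong suc (sound S i∈) }
    ; complete = complete S
    ; coeff    = λ { zero → q⊗-zero s ; (suc n) → ≡.trans (q⊗-suc s n) (coeff S n) } }

  -- By m ≤ e m every index with exponent n lies in 0, ..., n, which makes the search finite. It
  -- runs downwards to follow the recursion of `∑`.
  enum-powerSum : ∀ {e} → (∀ m → m ≤ e m) → Enumeration e (powerSum e)
  enum-powerSum {e} m≤e = record
    { fibre    = λ n → F n (suc n)
    ; unique   = λ n → Unique.filter⁺ (λ m → e m ℕ.≟ n) (Unique.downFrom⁺ (suc n))
    ; sound    = λ {n} i∈ → proj₂ (∈-filter⁻ (λ m → e m ℕ.≟ n) {xs = downFrom (suc n)} i∈)
    ; complete = λ m → ∈-filter⁺ (λ i → e i ℕ.≟ e m) (∈-downFrom⁺ (s≤s (m≤e m))) ≡.refl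
    ; coeff    = λ n → count n (suc n) }
    where
    open FiniteSum seriesRing using (∑)

    F : ℕ → ℕ → List ℕ
    F n N = filter (λ m → e m ℕ.≟ n) (downFrom N)

    count : ∀ n N → ∑ (λ m → q ^ e m) N n ≡ + length (F n N)
    count n zero = ≡.refl
    count n (suc N) = ≡.trans (⊕-coeff _ (q ^ e N) n) (by-cases (e N ℕ.≟ n))
      where
      by-cases : Dec (e N ≡ n) → ∑ (λ m → q ^ e m) N n ℤ.+ (q ^ e N) n ≡ + length (F n (suc N))
      by-cases (yes ≡.refl) = ≡.trans (cong₂ ℤ._+_ (count n N) (q^-diag n))
        (≡.trans (ℤ.+-comm (+ length (F n N)) 1ℤ)
          (cong (+_ ∘ length) (≡.sym (filter-accept (λ m → e m ℕ.≟ n) {x = N} {xs = downFrom N} ≡.refl))))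
      by-cases (no e≢n) = ≡.trans (cong₂ ℤ._+_ (count n N) (q^-off (e N) n e≢n))
        (≡.trans (ℤ.+-identityʳ _)
          (cong (+_ ∘ length) (≡.sym (filter-reject (λ m → e m ℕ.≟ n) {x = N} {xs = downFrom N} e≢n))))

  -- The theta functions as sums over ℤ

  -- For x in ℤ the numbers x(2x+1) are the triangular numbers, each once, and 8x(2x+1) + 1 =
  -- (4x+1)². So ψ also becomes a sum over all of ℤ with a quadratic exponent.
  φ-exponent ψ-exponent : ℤ → ℕ
  φ-exponent x = ℤ.∣ x ∣ ℕ.* ℤ.∣ x ∣
  ψ-exponent (+ m)      = m ℕ.* (1 ℕ.+ 2 ℕ.* m)
  ψ-exponent (-[1+ m ]) = suc m ℕ.* (1 ℕ.+ 2 ℕ.* m)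

  +φ-exponent : ∀ x → + φ-exponent x ≡ x ℤ.* x
  +φ-exponent (+ m)      = ℤ.pos-* m m
  +φ-exponent (-[1+ m ]) = ≡.refl

  +ψ-exponent : ∀ x → + ψ-exponent x ≡ x ℤ.* (+ 1 ℤ.+ + 2 ℤ.* x)
  +ψ-exponent (+ m) = ≡.trans (ℤ.pos-* m (1 ℕ.+ 2 ℕ.* m)) (cong (λ x → + m ℤ.* (+ 1 ℤ.+ x)) (ℤ.pos-* 2 m))
  +ψ-exponent (-[1+ m ]) = ≡.trans (ℤ.pos-* (suc m) (1 ℕ.+ 2 ℕ.* m)) (≡.trans
    (cong (λ x → + suc m ℤ.* (+ 1 ℤ.+ x)) (ℤ.pos-* 2 m))
    (solve 1 (λ m → (con 1ℤ :+ m) :* (con 1ℤ :+ con (+ 2) :* m)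
       := (:- (con 1ℤ :+ m)) :* (con 1ℤ :+ con (+ 2) :* (:- (con 1ℤ :+ m)))) ≡.refl (+ m)))
    where open Data.Integer.Solver.+-*-Solver

  enum-φ : Enumeration φ-exponent φ
  enum-φ = enum-cong exponent φ≗ (reindex ℤ↔ (enum-⊕ enum-one (enum-⊕ (enum-powerSum square-≥) (enum-powerSum square-≥))))
    where
    ℤ↔ : ℤ ↔ (⊤ ⊎ (ℕ ⊎ ℕ))
    ℤ↔ = mk↔ₛ′
      (λ { (+ zero) → inj₁ tt ; (+ suc m) → inj₂ (inj₁ m) ; (-[1+ m ]) → inj₂ (inj₂ m) })
      (λ { (inj₁ tt) → + 0 ; (inj₂ (inj₁ m)) → + suc m ; (inj₂ (inj₂ m)) → -[1+ m ] })
      (λ { (inj₁ tt) → ≡.refl ; (inj₂ (inj₁ m)) → ≡.refl ; (inj₂ (inj₂ m)) → ≡.refl })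
      (λ { (+ zero) → ≡.refl ; (+ suc m) → ≡.refl ; (-[1+ m ]) → ≡.refl })

    exponent : ∀ x → _ ≡ φ-exponent x
    exponent (+ zero)   = ≡.refl
    exponent (+ suc m)  = ≡.refl
    exponent (-[1+ m ]) = ≡.refl

    φ≗ : one ⊕ (φ⁺ ⊕ φ⁺) ≗ φ
    φ≗ = solve 1 (λ s → con (+ 1) :+ (s :+ s) := con (+ 1) :+ con (+ 2) :* s) (λ _ → ≡.refl) φ⁺
      where open IntegerCoefficients seriesRing

  enum-ψ : Enumeration ψ-exponent ψ
  enum-ψ = enum-cong exponent (λ _ → ≡.refl)
    (reindex ℤ↔ (enum-⊕ (enum-powerSum triangle₁-≥) (enum-powerSum triangle₂-≥)))
    where
    ℤ↔ : ℤ ↔ (ℕ ⊎ ℕ)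
    ℤ↔ = mk↔ₛ′
      (λ { (+ m) → inj₁ m ; (-[1+ m ]) → inj₂ m })
      [ +_ , -[1+_] ]′
      (λ { (inj₁ m) → ≡.refl ; (inj₂ m) → ≡.refl })
      (λ { (+ m) → ≡.refl ; (-[1+ m ]) → ≡.refl })

    exponent : ∀ x → _ ≡ ψ-exponent x
    exponent (+ m)      = ≡.refl
    exponent (-[1+ m ]) = ≡.refl

  -- Splitting ℤ into residue classes

  double : ℤ ⊎ ℤ → ℤ
  double (inj₁ k) = k ℤ.* + 2
  double (inj₂ k) = + 1 ℤ.+ k ℤ.* + 2

  private
    double-surjective : ∀ z → ∃ λ c → double c ≡ z
    double-surjective (+ n) with parity n
    ... | is-even m = inj₁ (+ m) , ≡.sym (ℤ.pos-* m 2)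
    ... | is-odd m  = inj₂ (+ m) , cong (λ x → + 1 ℤ.+ x) (≡.sym (ℤ.pos-* m 2))
    double-surjective (-[1+ n ]) with parity n
    ... | is-even m = inj₂ (-[1+ m ]) , ≡.refl
    ... | is-odd m  = inj₁ (-[1+ m ]) , ≡.refl

    even≢odd : ∀ k l → k ℤ.* + 2 ≢ + 1 ℤ.+ l ℤ.* + 2
    even≢odd k l p = absurd (k ℤ.- l) (≡.trans
      (solve 2 (λ k l → (k :- l) :* con (+ 2) := k :* con (+ 2) :- l :* con (+ 2)) ≡.refl k l)
      (≡.trans (cong (ℤ._- l ℤ.* + 2) p)
        (solve 1 (λ x → con (+ 1) :+ x :- x := con (+ 1)) ≡.refl (l ℤ.* + 2))))
      where
      open Data.Integer.Solver.+-*-Solver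
      absurd : ∀ d → d ℤ.* + 2 ≢ + 1
      absurd (+ m) p = odd≢even 0 m (≡.sym (ℤ.+-injective (≡.trans (ℤ.pos-* m 2) p)))

    open Algebra.Properties.Group (CommutativeRing.+-group ℤ.+-*-commutativeRing) using (∙-cancelˡ)

    double-injective : ∀ c d → double c ≡ double d → c ≡ d
    double-injective (inj₁ k) (inj₁ l) p = cong inj₁ (ℤ.*-cancelʳ-≡ k l (+ 2) p)
    double-injective (inj₁ k) (inj₂ l) p = ⊥-elim (even≢odd k l p)
    double-injective (inj₂ k) (inj₁ l) p = ⊥-elim (even≢odd l k (≡.sym p))
    double-injective (inj₂ k) (inj₂ l) p = cong inj₂ (ℤ.*-cancelʳ-≡ k l (+ 2) (∙-cancelˡ (+ 1) _ _ p))

  halve : ℤ → ℤ ⊎ ℤ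
  halve z = proj₁ (double-surjective z)

  double-halve : ∀ z → double (halve z) ≡ z
  double-halve z = proj₂ (double-surjective z)

  halve-double : ∀ c → halve (double c) ≡ c
  halve-double c = double-injective _ c (double-halve (double c))

  Classes : Set
  Classes = (ℤ ⊎ ℤ) ⊎ (ℤ ⊎ ℤ)

  -- The four classes are, in order, 4k, 4k+2, 4k+1 and 4k+3: even differences come before odd ones.
  quadruple : Classes ↔ ℤ
  quadruple = ↔-trans (halves ⊎-↔ halves) halves
    where
    halves : (ℤ ⊎ ℤ) ↔ ℤ
    halves = mk↔ₛ′ double halve double-halve halve-double

  open Data.Integer.Solver.+-*-Solver using (solve; _:+_; _:*_; _:-_; :-_; con; _:=_)

  private
    -- A pair (x, y) is recorded by y and the residue class of x - y modulo 4.
    shear : (Classes × ℤ) ↔ (ℤ × ℤ)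
    shear = mk↔ₛ′
      (λ (c , y) → y ℤ.+ to c , y)
      (λ (x , y) → from (x ℤ.- y) , y)
      (λ (x , y) → cong (_, y) (≡.trans (cong (λ t → y ℤ.+ t) (strictlyInverseˡ (x ℤ.- y)))
        (solve 2 (λ x y → y :+ (x :- y) := x) ≡.refl x y)))
      (λ (c , y) → cong (_, y) (≡.trans
        (cong from (solve 2 (λ y t → y :+ t :- y := t) ≡.refl y (to c))) (strictlyInverseʳ c)))
      where open Inverse quadruple

    -- With d = x - y the exponent of ψ ψ_3 is ((4x+1)² + 3(4y+1)² - 4)/8 = ((4y+d+1)² + 3d² - 1)/2.
    -- If d = 2v, the first square is (4w+1)² and the value is 4w(2w+1) + 6v². If d is odd, 4y+d+1 =
    -- 2u and d = ±(4w+1), and the value is 1 + 2u² + 12w(2w+1).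
    split : (Classes × ℤ) ↔ ((ℤ × ℤ) ⊎ (ℤ × ℤ))
    split = mk↔ₛ′ to from to-from from-to
      where
      to : Classes × ℤ → (ℤ × ℤ) ⊎ (ℤ × ℤ)
      to (inj₁ (inj₁ k) , y) = inj₁ (y ℤ.+ k , double (inj₁ k))
      -- Here d = 4k+2, so 4y+d+1 = 4(y+k) + 3, which is -(4w+1) for this w.
      to (inj₁ (inj₂ k) , y) = inj₁ (ℤ.- (+ 1 ℤ.+ (y ℤ.+ k)) , double (inj₂ k))
      to (inj₂ (inj₁ k) , y) = inj₂ (double (inj₂ (y ℤ.+ k)) , k)
      -- Here d = 4k+3 itself is -(4w+1), with w = -(1+k).
      to (inj₂ (inj₂ k) , y) = inj₂ (double (inj₁ (+ 1 ℤ.+ (y ℤ.+ k))) , ℤ.- (+ 1 ℤ.+ k))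

      from₁ from₂ : ℤ → ℤ ⊎ ℤ → Classes × ℤ
      from₁ w (inj₁ k) = inj₁ (inj₁ k) , w ℤ.- k
      from₁ w (inj₂ k) = inj₁ (inj₂ k) , ℤ.- (+ 1 ℤ.+ w) ℤ.- k
      from₂ w (inj₁ m) = inj₂ (inj₂ (ℤ.- (+ 1 ℤ.+ w))) , m ℤ.+ w
      from₂ w (inj₂ m) = inj₂ (inj₁ w) , m ℤ.- w

      from : (ℤ × ℤ) ⊎ (ℤ × ℤ) → Classes × ℤ
      from (inj₁ (w , v)) = from₁ w (halve v)
      from (inj₂ (u , w)) = from₂ w (halve u)

      to-from₁ : ∀ w c → to (from₁ w c) ≡ inj₁ (w , double c)
      to-from₁ w (inj₁ k) = cong (λ x → inj₁ (x , double (inj₁ k)))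
        (solve 2 (λ w k → w :- k :+ k := w) ≡.refl w k)
      to-from₁ w (inj₂ k) = cong (λ x → inj₁ (x , double (inj₂ k)))
        (solve 2 (λ w k → :- (con (+ 1) :+ (:- (con (+ 1) :+ w) :- k :+ k)) := w) ≡.refl w k)

      to-from₂ : ∀ w c → to (from₂ w c) ≡ inj₂ (double c , w)
      to-from₂ w (inj₁ m) = cong₂ (λ x y → inj₂ (double (inj₁ x) , y))
        (solve 2 (λ w m → con (+ 1) :+ (m :+ w :+ (:- (con (+ 1) :+ w))) := m) ≡.refl w m)
        (solve 1 (λ w → :- (con (+ 1) :+ (:- (con (+ 1) :+ w))) := w) ≡.refl w)
      to-from₂ w (inj₂ m) = cong (λ x → inj₂ (double (inj₂ x) , w))
        (solve 2 (λ w m → m :- w :+ w := m) ≡.refl w m)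

      to-from : ∀ b → to (from b) ≡ b
      to-from (inj₁ (w , v)) = ≡.trans (to-from₁ w (halve v)) (cong (λ v → inj₁ (w , v)) (double-halve v))
      to-from (inj₂ (u , w)) = ≡.trans (to-from₂ w (halve u)) (cong (λ u → inj₂ (u , w)) (double-halve u))

      from-to : ∀ c → from (to c) ≡ c
      from-to (inj₁ (inj₁ k) , y) = ≡.trans (cong (from₁ (y ℤ.+ k)) (halve-double (inj₁ k)))
        (cong (inj₁ (inj₁ k) ,_) (solve 2 (λ y k → y :+ k :- k := y) ≡.refl y k))
      from-to (inj₁ (inj₂ k) , y) = ≡.trans (cong (from₁ _) (halve-double (inj₂ k)))
        (cong (inj₁ (inj₂ k) ,_)
          (solve 2 (λ y k → :- (con (+ 1) :+ (:- (con (+ 1) :+ (y :+ k)))) :- k := y) ≡.refl y k))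
      from-to (inj₂ (inj₁ k) , y) = ≡.trans (cong (from₂ k) (halve-double (inj₂ (y ℤ.+ k))))
        (cong (inj₂ (inj₁ k) ,_) (solve 2 (λ y k → y :+ k :- k := y) ≡.refl y k))
      from-to (inj₂ (inj₂ k) , y) = ≡.trans (cong (from₂ _) (halve-double (inj₁ (+ 1 ℤ.+ (y ℤ.+ k)))))
        (cong₂ (λ x y → inj₂ (inj₂ x) , y)
          (solve 1 (λ k → :- (con (+ 1) :+ (:- (con (+ 1) :+ k))) := k) ≡.refl k)
          (solve 2 (λ y k → con (+ 1) :+ (y :+ k) :+ (:- (con (+ 1) :+ k)) := y) ≡.refl y k))

    ψψ-exponent : ℤ × ℤ → ℕ
    ψψ-exponent (x , y) = ψ-exponent x ℕ.+ ψ-exponent y ℕ.* 3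

    ψφ-exponent φψ-exponent : ℤ × ℤ → ℕ
    ψφ-exponent (w , v) = ψ-exponent w ℕ.* 4 ℕ.+ φ-exponent v ℕ.* 6
    φψ-exponent (u , w) = suc (φ-exponent u ℕ.* 2 ℕ.+ ψ-exponent w ℕ.* 12)

    +ψψ : ∀ x y → + ψψ-exponent (x , y)
        ≡ x ℤ.* (+ 1 ℤ.+ + 2 ℤ.* x) ℤ.+ y ℤ.* (+ 1 ℤ.+ + 2 ℤ.* y) ℤ.* + 3
    +ψψ x y = cong₂ ℤ._+_ (+ψ-exponent x)
      (≡.trans (ℤ.pos-* (ψ-exponent y) 3) (cong (ℤ._* + 3) (+ψ-exponent y)))

    +ψφ : ∀ w v → + ψφ-exponent (w , v)
        ≡ w ℤ.* (+ 1 ℤ.+ + 2 ℤ.* w) ℤ.* + 4 ℤ.+ v ℤ.* v ℤ.* + 6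
    +ψφ w v = cong₂ ℤ._+_
      (≡.trans (ℤ.pos-* (ψ-exponent w) 4) (cong (ℤ._* + 4) (+ψ-exponent w)))
      (≡.trans (ℤ.pos-* (φ-exponent v) 6) (cong (ℤ._* + 6) (+φ-exponent v)))

    +φψ : ∀ u w → + φψ-exponent (u , w)
        ≡ + 1 ℤ.+ (u ℤ.* u ℤ.* + 2 ℤ.+ w ℤ.* (+ 1 ℤ.+ + 2 ℤ.* w) ℤ.* + 12)
    +φψ u w = cong (λ x → + 1 ℤ.+ x) (cong₂ ℤ._+_
      (≡.trans (ℤ.pos-* (φ-exponent u) 2) (cong (ℤ._* + 2) (+φ-exponent u)))
      (≡.trans (ℤ.pos-* (ψ-exponent w) 12) (cong (ℤ._* + 12) (+ψ-exponent w))))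

    -- In ℤ the exponents, defined by cases on signs, become polynomials, and each residue class is
    -- a single polynomial identity.
    exponents-agree : ∀ c → ψψ-exponent (Inverse.to shear c)
                          ≡ [ ψφ-exponent , φψ-exponent ]′ (Inverse.to split c)
    exponents-agree (inj₁ (inj₁ k) , y) = ℤ.+-injective (≡.trans
      (+ψψ (y ℤ.+ Inverse.to quadruple (inj₁ (inj₁ k))) y) (≡.trans
      (solve 2 (λ k y → let t = k :* con (+ 2) :* con (+ 2) ; x = y :+ t ; w = y :+ k ; v = k :* con (+ 2) in
        x :* (con (+ 1) :+ con (+ 2) :* x) :+ y :* (con (+ 1) :+ con (+ 2) :* y) :* con (+ 3)
        := w :* (con (+ 1) :+ con (+ 2) :* w) :* con (+ 4) :+ v :* v :* con (+ 6)) ≡.refl k y)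
      (≡.sym (+ψφ (y ℤ.+ k) (double (inj₁ k))))))
    exponents-agree (inj₁ (inj₂ k) , y) = ℤ.+-injective (≡.trans
      (+ψψ (y ℤ.+ Inverse.to quadruple (inj₁ (inj₂ k))) y) (≡.trans
      (solve 2 (λ k y → let v = con (+ 1) :+ k :* con (+ 2) ; x = y :+ v :* con (+ 2)
                            w = :- (con (+ 1) :+ (y :+ k)) in
        x :* (con (+ 1) :+ con (+ 2) :* x) :+ y :* (con (+ 1) :+ con (+ 2) :* y) :* con (+ 3)
        := w :* (con (+ 1) :+ con (+ 2) :* w) :* con (+ 4) :+ v :* v :* con (+ 6)) ≡.refl k y)
      (≡.sym (+ψφ (ℤ.- (+ 1 ℤ.+ (y ℤ.+ k))) (double (inj₂ k))))))
    exponents-agree (inj₂ (inj₁ k) , y) = ℤ.+-injective (≡.trans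
      (+ψψ (y ℤ.+ Inverse.to quadruple (inj₂ (inj₁ k))) y) (≡.trans
      (solve 2 (λ k y → let t = con (+ 1) :+ k :* con (+ 2) :* con (+ 2) ; x = y :+ t
                            u = con (+ 1) :+ (y :+ k) :* con (+ 2) in
        x :* (con (+ 1) :+ con (+ 2) :* x) :+ y :* (con (+ 1) :+ con (+ 2) :* y) :* con (+ 3)
        := con (+ 1) :+ (u :* u :* con (+ 2) :+ k :* (con (+ 1) :+ con (+ 2) :* k) :* con (+ 12))) ≡.refl k y)
      (≡.sym (+φψ (double (inj₂ (y ℤ.+ k))) k))))
    exponents-agree (inj₂ (inj₂ k) , y) = ℤ.+-injective (≡.trans
      (+ψψ (y ℤ.+ Inverse.to quadruple (inj₂ (inj₂ k))) y) (≡.trans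
      (solve 2 (λ k y → let t = con (+ 1) :+ (con (+ 1) :+ k :* con (+ 2)) :* con (+ 2) ; x = y :+ t
                            u = (con (+ 1) :+ (y :+ k)) :* con (+ 2) ; w = :- (con (+ 1) :+ k) in
        x :* (con (+ 1) :+ con (+ 2) :* x) :+ y :* (con (+ 1) :+ con (+ 2) :* y) :* con (+ 3)
        := con (+ 1) :+ (u :* u :* con (+ 2) :+ w :* (con (+ 1) :+ con (+ 2) :* w) :* con (+ 12))) ≡.refl k y)
      (≡.sym (+φψ (double (inj₁ (+ 1 ℤ.+ (y ℤ.+ k)))) (ℤ.- (+ 1 ℤ.+ k))))))

  ψψ₃ : ψ ⊗ dil 3 ψ ≗ dil 4 ψ ⊗ dil 6 φ ⊕ q ⊗ (dil 2 φ ⊗ dil 12 ψ)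
  ψψ₃ = Enumeration-unique
    (reindex shear (enum-⊗ enum-ψ (enum-dil 2 enum-ψ)))
    (reindex split (enum-⊕ (enum-⊗ (enum-dil 3 enum-ψ) (enum-dil 5 enum-φ))
      (enum-q⊗ (enum-⊗ (enum-dil 1 enum-φ) (enum-dil 11 enum-ψ)))))
    exponents-agree

-- The odd part of CP_3 and its reduction modulo 16.

module OddPart where
  open SeriesRing
  open SeriesOperations
  open EulerProducts
  open ThetaEnumeration
  open CommutativeRing seriesRing hiding (Carrier; _≈_; isEquivalence; zero)
  open IntegerCoefficients seriesRing
  open TwoAdic seriesRing

  module _ (k : ℕ) where
    push-⊗ : ∀ {a a′ b b′} → dil k a ≗ a′ → dil k b ≗ b′ → dil k (a ⊗ b) ≗ a′ ⊗ b′
    push-⊗ {a} {b = b} p r = trans (dil-⊗ k a b) (*-cong p r)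

    push-⊕ : ∀ {a a′ b b′} → dil k a ≗ a′ → dil k b ≗ b′ → dil k (a ⊕ b) ≗ a′ ⊕ b′
    push-⊕ {a} {b = b} p r = trans (dil-⊕ k a b) (+-cong p r)

    push-- : ∀ {a a′ b b′} → dil k a ≗ a′ → dil k b ≗ b′ → dil k (a - b) ≗ a′ - b′
    push-- {b = b} p r = push-⊕ p (trans (dil-⊖ k b) (-‿cong r))

    push-ι : ∀ i {a a′} → dil k a ≗ a′ → dil k (ι i ⊗ a) ≗ ι i ⊗ a′
    push-ι i p = push-⊗ (dil-ι k i) p

    push-cube : ∀ {a a′} → dil k a ≗ a′ → dil k (a ⊗ a ⊗ a) ≗ a′ ⊗ a′ ⊗ a′
    push-cube p = push-⊗ (push-⊗ p p) p

    dil-≈₂ : ∀ {a b} → a ≈₂ b → dil k a ≈₂ dil k b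
    dil-≈₂ (t , e) = dil k t , trans (dil-cong k e) (push-⊕ refl (push-ι (+ 2) refl))

    dil-≈₂1 : ∀ {a} → a ≈₂ one → dil k a ≈₂ one
    dil-≈₂1 e = R₂.trans (dil-≈₂ e) (≈⇒≈₂ (dil-one k))

  push-q : dil 2 q ≗ q ⊗ q
  push-q = trans (dil-q 1) (*-congˡ (*-identityʳ q))

  push-q₃ : dil 3 q ≗ q ⊗ q ⊗ q
  push-q₃ = trans (dil-q 2) (solve 1 (λ q → q :* (q :* (q :* con (+ 1))) := q :* q :* q) refl q)

  -- Subscripts denote dilation, x_k = x(q^k), and a = φ.
  f₁ J p p₂ p₃ p₄ p₆ p₈ p₁₂ p₂₄ a₂ a₃ a₄ a₆ Φ Φ₃ f₂ f₃ f₆ J₂ J₃ J₆ g g₂ : Series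
  f₁ = f 1
  f₂ = dil 2 f₁
  f₃ = dil 3 f₁
  f₆ = dil 6 f₁
  J = Reciprocal.reciprocal f₁ ≡.refl
  J₂ = dil 2 J
  J₃ = dil 3 J
  J₆ = dil 6 J
  p = ψ
  p₂ = dil 2 ψ
  p₃ = dil 3 ψ
  p₄ = dil 4 ψ
  p₆ = dil 6 ψ
  p₈ = dil 8 ψ
  p₁₂ = dil 12 ψ
  p₂₄ = dil 24 ψ
  a₂ = dil 2 φ
  a₃ = dil 3 φ
  a₄ = dil 4 φ
  a₆ = dil 6 φ
  Φ = φ[-q]
  Φ₃ = dil 3 φ[-q]
  g = f₃ ⊗ f₃ ⊗ f₃ ⊗ (J ⊗ J ⊗ J)
  g₂ = dil 2 g

  f₁J : f₁ ⊗ J ≗ one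
  f₁J = Reciprocal.*-reciprocal f₁ ≡.refl

  dil-f₁J : ∀ k → dil k f₁ ⊗ dil k J ≗ one
  dil-f₁J k = trans (sym (dil-⊗ k f₁ J)) (trans (dil-cong k f₁J) (dil-one k))

  f₂Φ : f₂ ⊗ Φ ≗ f₁ ⊗ f₁
  f₂Φ = trans (*-congʳ (sym (f-dil 1))) f₂φ[-q]≗f₁²

  f₆Φ₃ : f₆ ⊗ Φ₃ ≗ f₃ ⊗ f₃
  f₆Φ₃ = trans (*-congʳ (sym (dil-dil 2 1 f₁)))
    (trans (sym (dil-⊗ 3 f₂ Φ)) (trans (dil-cong 3 f₂Φ) (dil-⊗ 3 f₁ f₁)))

  f₁p : f₁ ⊗ p ≗ f₂ ⊗ f₂
  f₁p = trans f₁ψ≗f₂² (*-cong (f-dil 1) (f-dil 1))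

  f₃p₃ : f₃ ⊗ p₃ ≗ f₆ ⊗ f₆
  f₃p₃ = trans (sym (dil-⊗ 3 f₁ p)) (trans (dil-cong 3 f₁p)
    (push-⊗ 3 (dil-dil 2 1 f₁) (dil-dil 2 1 f₁)))

  g₂≗ : g₂ ≗ f₆ ⊗ f₆ ⊗ f₆ ⊗ (J₂ ⊗ J₂ ⊗ J₂)
  g₂≗ = push-⊗ 2 (push-cube 2 (dil-dil 1 2 f₁)) (push-cube 2 refl)

  -- Φ/f_1² = 1/f_2 without division: a factor `one` is introduced as f_2 J_2, so that Gauss's
  -- identity applies, and f_1 J is cancelled afterwards.
  JJΦ : J ⊗ J ⊗ Φ ≗ J₂
  JJΦ = begin
    J ⊗ J ⊗ Φ                          ≈⟨ *-identityˡ _ ⟨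
    one ⊗ (J ⊗ J ⊗ Φ)                  ≈⟨ *-congʳ (dil-f₁J 2) ⟨
    f₂ ⊗ J₂ ⊗ (J ⊗ J ⊗ Φ)              ≈⟨ solve 4 (λ f J₂ J Φ → f :* J₂ :* (J :* J :* Φ) := J₂ :* (J :* J :* (f :* Φ))) refl f₂ J₂ J Φ ⟩
    J₂ ⊗ (J ⊗ J ⊗ (f₂ ⊗ Φ))            ≈⟨ *-congˡ (*-congˡ f₂Φ) ⟩
    J₂ ⊗ (J ⊗ J ⊗ (f₁ ⊗ f₁))           ≈⟨ solve 3 (λ J₂ J f → J₂ :* (J :* J :* (f :* f)) := J₂ :* ((f :* J) :* (f :* J))) refl J₂ J f₁ ⟩
    J₂ ⊗ (f₁ ⊗ J ⊗ (f₁ ⊗ J))           ≈⟨ *-congˡ (*-cong f₁J f₁J) ⟩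
    J₂ ⊗ (one ⊗ one)                   ≈⟨ solve 1 (λ J → J :* (con (+ 1) :* con (+ 1)) := J) refl J₂ ⟩
    J₂ ∎
    where open Relation.Binary.Reasoning.Setoid setoid

  -- Both sides are f_3⁶/f_2³, by the cubes of Φ/f_1² = 1/f_2 and of f_6 Φ_3 = f_3².
  g²Φ³ : g ⊗ g ⊗ (Φ ⊗ Φ ⊗ Φ) ≗ g₂ ⊗ (Φ₃ ⊗ Φ₃ ⊗ Φ₃)
  g²Φ³ = begin
    g ⊗ g ⊗ (Φ ⊗ Φ ⊗ Φ)
      ≈⟨ solve 3 (λ f J Φ → let g = f :* f :* f :* (J :* J :* J) ; u = f :* f ; v = J :* J :* Φ in
           g :* g :* (Φ :* Φ :* Φ) := u :* u :* u :* (v :* v :* v)) refl f₃ J Φ ⟩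
    cube (f₃ ⊗ f₃) ⊗ cube (J ⊗ J ⊗ Φ)
      ≈⟨ *-cong (cube-cong (sym f₆Φ₃)) (cube-cong JJΦ) ⟩
    cube (f₆ ⊗ Φ₃) ⊗ cube J₂
      ≈⟨ solve 3 (λ f J Φ → let u = f :* Φ in
           u :* u :* u :* (J :* J :* J) := f :* f :* f :* (J :* J :* J) :* (Φ :* Φ :* Φ)) refl f₆ J₂ Φ₃ ⟩
    cube f₆ ⊗ cube J₂ ⊗ (Φ₃ ⊗ Φ₃ ⊗ Φ₃)
      ≈⟨ *-congʳ (sym g₂≗) ⟩
    g₂ ⊗ (Φ₃ ⊗ Φ₃ ⊗ Φ₃) ∎
    where
    open Relation.Binary.Reasoning.Setoid setoid
    cube : Series → Series
    cube x = x ⊗ x ⊗ x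
    cube-cong : ∀ {x y} → x ≗ y → cube x ≗ cube y
    cube-cong e = *-cong (*-cong e e) e

  -- Chosen so that g_2 W = f_3³ f_6³ / (f_1 f_2), a square root of the generating function, while
  -- both Φ_3 and ψ ψ_3 have explicit even-odd splittings.
  W : Series
  W = Φ₃ ⊗ Φ₃ ⊗ (p ⊗ p₃)

  W≗ : W ≗ f₃ ⊗ f₃ ⊗ f₃ ⊗ (f₂ ⊗ f₂) ⊗ J
  W≗ = begin
    W
      ≈⟨ solve 1 (λ w → w := w :* con (+ 1) :* (con (+ 1) :* (con (+ 1) :* con (+ 1)))) refl W ⟩
    W ⊗ one ⊗ (one ⊗ (one ⊗ one))
      -- Gauss's identities ask for f_1, f_3 and f_6² beside W. Each factor brings its reciprocal,
      -- and in the end all of these but J cancel.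
      ≈⟨ *-cong (*-congˡ (sym f₁J)) (*-cong (sym (dil-f₁J 3)) (*-cong (sym (dil-f₁J 6)) (sym (dil-f₁J 6)))) ⟩
    W ⊗ (f₁ ⊗ J) ⊗ (f₃ ⊗ J₃ ⊗ (f₆ ⊗ J₆ ⊗ (f₆ ⊗ J₆)))
      ≈⟨ regroup Φ₃ p p₃ f₁ f₃ f₆ J J₃ J₆ ⟩
    f₆ ⊗ Φ₃ ⊗ (f₆ ⊗ Φ₃) ⊗ (f₁ ⊗ p) ⊗ (f₃ ⊗ p₃) ⊗ (J ⊗ J₃ ⊗ (J₆ ⊗ J₆))
      ≈⟨ *-congʳ (*-cong (*-cong (*-cong f₆Φ₃ f₆Φ₃) f₁p) f₃p₃) ⟩
    f₃ ⊗ f₃ ⊗ (f₃ ⊗ f₃) ⊗ (f₂ ⊗ f₂) ⊗ (f₆ ⊗ f₆) ⊗ (J ⊗ J₃ ⊗ (J₆ ⊗ J₆))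
      ≈⟨ solve 6 (λ f₂ f₃ f₆ J J₃ J₆ →
           f₃ :* f₃ :* (f₃ :* f₃) :* (f₂ :* f₂) :* (f₆ :* f₆) :* (J :* J₃ :* (J₆ :* J₆))
           := f₃ :* f₃ :* f₃ :* (f₂ :* f₂) :* J :* (f₃ :* J₃ :* (f₆ :* J₆ :* (f₆ :* J₆))))
           refl f₂ f₃ f₆ J J₃ J₆ ⟩
    f₃ ⊗ f₃ ⊗ f₃ ⊗ (f₂ ⊗ f₂) ⊗ J ⊗ (f₃ ⊗ J₃ ⊗ (f₆ ⊗ J₆ ⊗ (f₆ ⊗ J₆)))
      ≈⟨ *-congˡ (*-cong (dil-f₁J 3) (*-cong (dil-f₁J 6) (dil-f₁J 6))) ⟩
    f₃ ⊗ f₃ ⊗ f₃ ⊗ (f₂ ⊗ f₂) ⊗ J ⊗ (one ⊗ (one ⊗ one))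
      ≈⟨ solve 1 (λ w → w :* (con (+ 1) :* (con (+ 1) :* con (+ 1))) := w) refl _ ⟩
    f₃ ⊗ f₃ ⊗ f₃ ⊗ (f₂ ⊗ f₂) ⊗ J ∎
    where
    open Relation.Binary.Reasoning.Setoid setoid
    regroup : ∀ Φ₃ p p₃ f₁ f₃ f₆ J J₃ J₆ →
      Φ₃ ⊗ Φ₃ ⊗ (p ⊗ p₃) ⊗ (f₁ ⊗ J) ⊗ (f₃ ⊗ J₃ ⊗ (f₆ ⊗ J₆ ⊗ (f₆ ⊗ J₆)))
      ≗ f₆ ⊗ Φ₃ ⊗ (f₆ ⊗ Φ₃) ⊗ (f₁ ⊗ p) ⊗ (f₃ ⊗ p₃) ⊗ (J ⊗ J₃ ⊗ (J₆ ⊗ J₆))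
    regroup = solve 9 (λ Φ₃ p p₃ f₁ f₃ f₆ J J₃ J₆ →
      Φ₃ :* Φ₃ :* (p :* p₃) :* (f₁ :* J) :* (f₃ :* J₃ :* (f₆ :* J₆ :* (f₆ :* J₆)))
      := f₆ :* Φ₃ :* (f₆ :* Φ₃) :* (f₁ :* p) :* (f₃ :* p₃) :* (J :* J₃ :* (J₆ :* J₆))) refl

  g₂W : g₂ ⊗ W ≗ f₃ ⊗ f₃ ⊗ f₃ ⊗ (f₆ ⊗ f₆ ⊗ f₆) ⊗ (J ⊗ J₂)
  g₂W = begin
    g₂ ⊗ W
      ≈⟨ *-cong g₂≗ W≗ ⟩
    f₆ ⊗ f₆ ⊗ f₆ ⊗ (J₂ ⊗ J₂ ⊗ J₂) ⊗ (f₃ ⊗ f₃ ⊗ f₃ ⊗ (f₂ ⊗ f₂) ⊗ J)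
      ≈⟨ solve 5 (λ f₂ u v J J₂ →
           u :* (J₂ :* J₂ :* J₂) :* (v :* (f₂ :* f₂) :* J)
           := v :* u :* (J :* J₂) :* (f₂ :* J₂ :* (f₂ :* J₂))) refl f₂ (f₆ ⊗ f₆ ⊗ f₆) (f₃ ⊗ f₃ ⊗ f₃) J J₂ ⟩
    f₃ ⊗ f₃ ⊗ f₃ ⊗ (f₆ ⊗ f₆ ⊗ f₆) ⊗ (J ⊗ J₂) ⊗ (f₂ ⊗ J₂ ⊗ (f₂ ⊗ J₂))
      ≈⟨ *-congˡ (*-cong (dil-f₁J 2) (dil-f₁J 2)) ⟩
    f₃ ⊗ f₃ ⊗ f₃ ⊗ (f₆ ⊗ f₆ ⊗ f₆) ⊗ (J ⊗ J₂) ⊗ (one ⊗ one)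
      ≈⟨ solve 1 (λ w → w :* (con (+ 1) :* con (+ 1)) := w) refl _ ⟩
    f₃ ⊗ f₃ ⊗ f₃ ⊗ (f₆ ⊗ f₆ ⊗ f₆) ⊗ (J ⊗ J₂) ∎
    where open Relation.Binary.Reasoning.Setoid setoid

  -- ψ ψ_3 = X(q²) + q Y(q²) and Φ_3² = M(q²) - 4q³ N(q²); multiplying out gives the even and odd
  -- parts U and V of W.
  X Y M N U V : Series
  X = p₂ ⊗ a₃
  Y = φ ⊗ p₆
  M = a₆ ⊗ a₆ ⊕ 4* (q ⊗ q ⊗ q ⊗ (p₁₂ ⊗ p₁₂))
  N = a₆ ⊗ p₁₂
  U = X ⊗ M - 4* (q ⊗ q ⊗ (Y ⊗ N))
  V = Y ⊗ M - 4* (q ⊗ (X ⊗ N))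

  W-dissection : W ≗ dil 2 U ⊕ q ⊗ dil 2 V
  W-dissection = begin
    Φ₃ ⊗ Φ₃ ⊗ (p ⊗ p₃)
      ≈⟨ *-cong Φ₃² pp₃ ⟩
    (dil 2 M - 4* (q ⊗ q ⊗ q ⊗ dil 2 N)) ⊗ (dil 2 X ⊕ q ⊗ dil 2 Y)
      ≈⟨ solve 5 (λ q M N X Y → (M :- con (+ 4) :* (q :* q :* q :* N)) :* (X :+ q :* Y)
           := X :* M :- con (+ 4) :* (q :* q :* (q :* q) :* (Y :* N))
              :+ q :* (Y :* M :- con (+ 4) :* (q :* q :* (X :* N))))
           refl q (dil 2 M) (dil 2 N) (dil 2 X) (dil 2 Y) ⟩
    dil 2 X ⊗ dil 2 M - 4* (q ⊗ q ⊗ (q ⊗ q) ⊗ (dil 2 Y ⊗ dil 2 N))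
      ⊕ q ⊗ (dil 2 Y ⊗ dil 2 M - 4* (q ⊗ q ⊗ (dil 2 X ⊗ dil 2 N)))
      ≈⟨ +-cong
           (push-- 2 (dil-⊗ 2 X M) (push-ι 2 (+ 4) (push-⊗ 2 (push-⊗ 2 push-q push-q) (dil-⊗ 2 Y N))))
           (*-congˡ (push-- 2 (dil-⊗ 2 Y M) (push-ι 2 (+ 4) (push-⊗ 2 push-q (dil-⊗ 2 X N))))) ⟨
    dil 2 U ⊕ q ⊗ dil 2 V ∎
    where
    open Relation.Binary.Reasoning.Setoid setoid
    a₁₂ = dil 12 φ

    pp₃ : p ⊗ p₃ ≗ dil 2 X ⊕ q ⊗ dil 2 Y
    pp₃ = trans ψψ₃ (sym (+-cong (push-⊗ 2 (dil-dil 1 1 ψ) (dil-dil 1 2 φ))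
      (*-congˡ (push-⊗ 2 refl (dil-dil 1 5 ψ)))))

    Φ₃≗ : Φ₃ ≗ a₁₂ - 2* (q ⊗ q ⊗ q ⊗ p₂₄)
    Φ₃≗ = trans (dil-cong 3 φ[-q]-dissection)
      (push-- 3 (dil-dil 2 3 φ) (push-ι 3 (+ 2) (push-⊗ 3 push-q₃ (dil-dil 2 7 ψ))))

    Φ₃² : Φ₃ ⊗ Φ₃ ≗ dil 2 M - 4* (q ⊗ q ⊗ q ⊗ dil 2 N)
    Φ₃² = trans (*-cong Φ₃≗ Φ₃≗) (trans
      (solve 3 (λ q a p → let c = q :* q :* q in
         (a :- con (+ 2) :* (c :* p)) :* (a :- con (+ 2) :* (c :* p))
         := a :* a :+ con (+ 4) :* (q :* q :* (q :* q) :* (q :* q) :* (p :* p)) :- con (+ 4) :* (c :* (a :* p)))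
         refl q a₁₂ p₂₄)
      (sym (+-cong (push-⊕ 2 (push-⊗ 2 (dil-dil 1 5 φ) (dil-dil 1 5 φ))
          (push-ι 2 (+ 4) (push-⊗ 2 (push-⊗ 2 (push-⊗ 2 push-q push-q) push-q)
            (push-⊗ 2 (dil-dil 1 11 ψ) (dil-dil 1 11 ψ)))))
        (-‿cong (*-congˡ (*-congˡ (push-⊗ 2 (dil-dil 1 5 φ) (dil-dil 1 11 ψ))))))))

  private
    φ≈₂1 : φ ≈₂ one
    φ≈₂1 = φ⁺ , refl

    Φ≈₂1 : Φ ≈₂ one
    Φ≈₂1 = φ⁻ , refl

    φ≗Φ : φ ≗ Φ ⊕ 4* (q ⊗ p₈)
    φ≗Φ = trans φ-dissection (trans
      (solve 2 (λ a b → a :+ con (+ 2) :* b := a :- con (+ 2) :* b :+ con (+ 4) :* b) refl a₄ (q ⊗ p₈))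
      (+-congʳ (sym φ[-q]-dissection)))

    a₃≗Φ₃ : a₃ ≗ Φ₃ ⊕ 4* (q ⊗ q ⊗ q ⊗ p₂₄)
    a₃≗Φ₃ = trans (dil-cong 3 φ≗Φ)
      (push-⊕ 3 refl (push-ι 3 (+ 4) (push-⊗ 3 push-q₃ (dil-dil 2 7 ψ))))

    f₁²≈₂f₂ : f₁ ⊗ f₁ ≈₂ f₂
    f₁²≈₂f₂ = R₂.trans (≈⇒≈₂ (sym f₂Φ)) (R₂.trans (R₂.*-congˡ {f₂} Φ≈₂1) (R₂.*-identityʳ f₂))

    -- ψ = f_2²/f_1 ≡ f_1⁴/f_1.
    p≈₂f₁³ : p ≈₂ f₁ ⊗ f₁ ⊗ f₁
    p≈₂f₁³ = begin
      p                           ≈⟨ R₂.*-identityˡ p ⟨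
      one ⊗ p                     ≈⟨ ≈⇒≈₂ (*-congʳ f₁J) ⟨
      f₁ ⊗ J ⊗ p                  ≈⟨ ≈⇒≈₂ (trans (solve 3 (λ f J p → f :* J :* p := f :* p :* J) refl f₁ J p) (*-congʳ f₁p)) ⟩
      f₂ ⊗ f₂ ⊗ J                 ≈⟨ R₂.*-congʳ (R₂.*-cong f₁²≈₂f₂ f₁²≈₂f₂) ⟨
      f₁ ⊗ f₁ ⊗ (f₁ ⊗ f₁) ⊗ J     ≈⟨ ≈⇒≈₂ (trans
        (solve 2 (λ f J → f :* f :* (f :* f) :* J := f :* f :* f :* (f :* J)) refl f₁ J)
        (trans (*-congˡ f₁J) (*-identityʳ _))) ⟩
      f₁ ⊗ f₁ ⊗ f₁                ∎
      where open Relation.Binary.Reasoning.Setoid R₂.setoid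

    p₃≈₂f₃³ : p₃ ≈₂ f₃ ⊗ f₃ ⊗ f₃
    p₃≈₂f₃³ = R₂.trans (dil-≈₂ 3 p≈₂f₁³) (≈⇒≈₂ (push-cube 3 refl))

    p₂≈₂p² : p₂ ≈₂ p ⊗ p
    p₂≈₂p² = begin
      p₂                                          ≈⟨ dil-≈₂ 2 p≈₂f₁³ ⟩
      dil 2 (f₁ ⊗ f₁ ⊗ f₁)                        ≈⟨ ≈⇒≈₂ (push-cube 2 refl) ⟩
      f₂ ⊗ f₂ ⊗ f₂                                ≈⟨ R₂.*-cong (R₂.*-cong f₁²≈₂f₂ f₁²≈₂f₂) f₁²≈₂f₂ ⟨
      f₁ ⊗ f₁ ⊗ (f₁ ⊗ f₁) ⊗ (f₁ ⊗ f₁)             ≈⟨ ≈⇒≈₂ (solve 1 (λ f →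
        f :* f :* (f :* f) :* (f :* f) := f :* f :* f :* (f :* f :* f)) refl f₁) ⟩
      f₁ ⊗ f₁ ⊗ f₁ ⊗ (f₁ ⊗ f₁ ⊗ f₁)               ≈⟨ R₂.*-cong p≈₂f₁³ p≈₂f₁³ ⟨
      p ⊗ p                                       ∎
      where open Relation.Binary.Reasoning.Setoid R₂.setoid

    p₆≈₂p₃² : p₆ ≈₂ p₃ ⊗ p₃
    p₆≈₂p₃² = R₂.trans (≈⇒≈₂ (sym (dil-dil 2 1 ψ))) (R₂.trans (dil-≈₂ 3 p₂≈₂p²) (≈⇒≈₂ (dil-⊗ 3 p p)))

    -- (f_3/f_1)³ f_1³ = f_3³, which is ψ_3 modulo 2.
    gp≈₂p₃ : g ⊗ p ≈₂ p₃
    gp≈₂p₃ = begin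
      g ⊗ p
        ≈⟨ R₂.*-congˡ {g} p≈₂f₁³ ⟩
      g ⊗ (f₁ ⊗ f₁ ⊗ f₁)
        ≈⟨ ≈⇒≈₂ (trans
             (solve 3 (λ u J f → u :* (J :* J :* J) :* (f :* f :* f) := u :* (f :* J :* (f :* J) :* (f :* J)))
               refl (f₃ ⊗ f₃ ⊗ f₃) J f₁)
             (trans (*-congˡ (*-cong (*-cong f₁J f₁J) f₁J))
               (solve 1 (λ u → u :* (con (+ 1) :* con (+ 1) :* con (+ 1)) := u) refl (f₃ ⊗ f₃ ⊗ f₃)))) ⟩
      f₃ ⊗ f₃ ⊗ f₃
        ≈⟨ p₃≈₂f₃³ ⟨
      p₃ ∎
      where open Relation.Binary.Reasoning.Setoid R₂.setoid

    pp₃≈₂ : p ⊗ p₃ ≈₂ p₄ ⊕ q ⊗ p₁₂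
    pp₃≈₂ = R₂.trans (≈⇒≈₂ ψψ₃) (R₂.+-cong
      (R₂.trans (R₂.*-congˡ {p₄} (dil-≈₂1 6 φ≈₂1)) (R₂.*-identityʳ p₄))
      (R₂.*-congˡ {q} (R₂.trans (R₂.*-congʳ {p₁₂} (dil-≈₂1 2 φ≈₂1)) (R₂.*-identityˡ p₁₂))))

  -- The even half of `odd-part-mod-8` with q² replaced by q; it disappears when odd coefficients
  -- are taken.
  E₀ : Series
  E₀ = g ⊗ (p ⊗ p₃ ⊗ (a₂ ⊗ a₂ ⊕ 4* (q ⊗ (p₄ ⊗ p₄))) ⊕ 4* (p₆ ⊗ (q ⊗ (p₃ ⊗ p₃))))

  g²UV≈₈ : g ⊗ g ⊗ (U ⊗ V) ≈₈ dil 2 E₀ ⊕ q ⊗ dil 2 (4* (dil 2 (p₂ ⊗ p₃)))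
  g²UV≈₈ = begin
    g ⊗ g ⊗ (U ⊗ V)
      ≈⟨ odd-part-mod-8 {p₂₄ = p₂₄} (dil-≈₂1 4 φ≈₂1) (dil-≈₂1 6 φ≈₂1) Φ≈₂1 (dil-≈₂1 3 Φ≈₂1)
           φ[-q]-dissection φ≗Φ a₃≗Φ₃ g²Φ³ ⟩
    g₂ ⊗ (p₂ ⊗ p₆ ⊗ (a₄ ⊗ a₄ ⊕ 4* (q ⊗ q ⊗ (p₈ ⊗ p₈))) ⊕ 4* (p₁₂ ⊗ (q ⊗ q ⊗ (p₆ ⊗ p₆))))
       ⊕ q ⊗ 4* (g₂ ⊗ (q ⊗ q ⊗ p₂₄ ⊗ (p₂ ⊗ p₆) ⊕ p₁₂ ⊗ (p₂ ⊗ p₂)))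
      ≈⟨ ≈⇒≈₈ (+-cong
           (push-⊗ 2 refl (push-⊕ 2
             (push-⊗ 2 (push-⊗ 2 refl (dil-dil 1 2 ψ)) (push-⊕ 2 (push-⊗ 2 (dil-dil 1 1 φ) (dil-dil 1 1 φ))
               (push-ι 2 (+ 4) (push-⊗ 2 push-q (push-⊗ 2 (dil-dil 1 3 ψ) (dil-dil 1 3 ψ))))))
             (push-ι 2 (+ 4) (push-⊗ 2 (dil-dil 1 5 ψ) (push-⊗ 2 push-q
               (push-⊗ 2 (dil-dil 1 2 ψ) (dil-dil 1 2 ψ)))))))
           (*-congˡ (*-congˡ (push-⊗ 2 refl (push-⊕ 2
             (push-⊗ 2 (push-⊗ 2 push-q (dil-dil 1 11 ψ)) (push-⊗ 2 refl (dil-dil 1 2 ψ)))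
             (push-⊗ 2 (dil-dil 1 5 ψ) (push-⊗ 2 refl refl))))))) ⟨
    dil 2 E₀ ⊕ q ⊗ 4* (dil 2 (g ⊗ (q ⊗ p₁₂ ⊗ (p ⊗ p₃) ⊕ p₆ ⊗ (p ⊗ p))))
      ≈⟨ R₈.+-congˡ {dil 2 E₀} (R₈.*-congˡ {q} (4*-lift (dil-≈₂ 2 (residue-mod-2 {q} {p} {p₃} {p₄} {p₆} {p₁₂} {g} gp≈₂p₃ p₆≈₂p₃² pp₃≈₂)))) ⟩
    dil 2 E₀ ⊕ q ⊗ 4* (dil 2 (p₄ ⊗ p₆))
      -- p₄ p₆ is p₂ p₃ taken at q², so the odd half hides a further dilation by 2; this is what
      -- separates 8n+7 from 8n+3.
      ≈⟨ ≈⇒≈₈ (+-congˡ (*-congˡ (push-ι 2 (+ 4)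
           (dil-cong 2 (push-⊗ 2 (dil-dil 1 1 ψ) (dil-dil 1 2 ψ)))))) ⟨
    dil 2 E₀ ⊕ q ⊗ dil 2 (4* (dil 2 (p₂ ⊗ p₃))) ∎
    where open Relation.Binary.Reasoning.Setoid R₈.setoid

  ^s≗^ : ∀ a k → a ^s k ≗ a ^ k
  ^s≗^ a zero    n = ≡.refl
  ^s≗^ a (suc k) n = ≡.trans (·-cong {a} (λ _ → ≡.refl) (^s≗^ a k) n) (≡.sym (⊗-coeff a (a ^ k) n))

  ·≗⊗ : ∀ {a a′ b b′} → a ≗ a′ → b ≗ b′ → a · b ≗ a′ ⊗ b′
  ·≗⊗ {a} {a′} {b} {b′} p r n = ≡.trans (·-cong p r n) (≡.sym (⊗-coeff a′ b′ n))

  ·^s≗ : ∀ k l m n → f (suc k) ^s m · (f (suc l) ^s n) ≗ dil (suc k) f₁ ^ m ⊗ dil (suc l) f₁ ^ n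
  ·^s≗ k l m n = ·≗⊗ (trans (^s≗^ _ m) (^-congˡ m (f-dil k))) (trans (^s≗^ _ n) (^-congˡ n (f-dil l)))

  module _ (C : Series) (C-eq : ∀ n → (C · ((f 1 ^s 2) · (f 2 ^s 2))) n ≡ ((f 3 ^s 6) · (f 6 ^s 6)) n) where

    C-equation : C ⊗ (f₁ ⊗ f₁ ⊗ (f₂ ⊗ f₂)) ≗ f₃ ^ 6 ⊗ f₆ ^ 6
    C-equation = trans
      (*-congˡ (solve 2 (λ x y → x :* x :* (y :* y) := x :* (x :* con (+ 1)) :* (y :* (y :* con (+ 1)))) refl f₁ f₂))
      (trans (sym (·≗⊗ {C} refl (·≗⊗ (^s≗^ f₁ 2) (trans (^s≗^ (f 2) 2) (^-congˡ 2 (f-dil 1))))))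
        (trans C-eq (·^s≗ 2 5 6 6)))

    -- Reciprocals solve the cross-multiplied equation for `C`, and the solution is the square of
    -- g_2 W.
    C≗ : C ≗ g₂ ⊗ g₂ ⊗ (W ⊗ W)
    C≗ = begin
      C
        ≈⟨ solve 1 (λ C → C := C :* (con (+ 1) :* con (+ 1) :* (con (+ 1) :* con (+ 1)))) refl C ⟩
      C ⊗ (one ⊗ one ⊗ (one ⊗ one))
        ≈⟨ *-congˡ (*-cong (*-cong f₁J f₁J) (*-cong (dil-f₁J 2) (dil-f₁J 2))) ⟨
      C ⊗ (f₁ ⊗ J ⊗ (f₁ ⊗ J) ⊗ (f₂ ⊗ J₂ ⊗ (f₂ ⊗ J₂)))
        ≈⟨ solve 5 (λ C f₁ f₂ J J₂ → C :* (f₁ :* J :* (f₁ :* J) :* (f₂ :* J₂ :* (f₂ :* J₂)))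
             := C :* (f₁ :* f₁ :* (f₂ :* f₂)) :* (J :* J₂ :* (J :* J₂))) refl C f₁ f₂ J J₂ ⟩
      C ⊗ (f₁ ⊗ f₁ ⊗ (f₂ ⊗ f₂)) ⊗ (J ⊗ J₂ ⊗ (J ⊗ J₂))
        ≈⟨ *-congʳ C-equation ⟩
      f₃ ^ 6 ⊗ f₆ ^ 6 ⊗ (J ⊗ J₂ ⊗ (J ⊗ J₂))
        ≈⟨ solve 3 (λ u v j →
             u :* (u :* (u :* (u :* (u :* (u :* con (+ 1)))))) :* (v :* (v :* (v :* (v :* (v :* (v :* con (+ 1))))))) :* (j :* j)
             := u :* u :* u :* (v :* v :* v) :* j :* (u :* u :* u :* (v :* v :* v) :* j)) refl f₃ f₆ (J ⊗ J₂) ⟩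
      f₃ ⊗ f₃ ⊗ f₃ ⊗ (f₆ ⊗ f₆ ⊗ f₆) ⊗ (J ⊗ J₂) ⊗ (f₃ ⊗ f₃ ⊗ f₃ ⊗ (f₆ ⊗ f₆ ⊗ f₆) ⊗ (J ⊗ J₂))
        ≈⟨ *-cong g₂W g₂W ⟨
      g₂ ⊗ W ⊗ (g₂ ⊗ W)
        ≈⟨ solve 2 (λ g W → g :* W :* (g :* W) := g :* g :* (W :* W)) refl g₂ W ⟩
      g₂ ⊗ g₂ ⊗ (W ⊗ W) ∎
      where open Relation.Binary.Reasoning.Setoid setoid

    -- g_2² is a series in q² and the odd part of a square (u + q v)² is 2q u v. This 2 raises the
    -- later congruence from modulus 8 to modulus 16.
    odd-C : odd C ≗ 2* (g ⊗ g ⊗ (U ⊗ V))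
    odd-C n = ≡.trans (C-dissection (suc (n ℕ.* 2))) (odd-dil A B n)
      where
      A = g ⊗ g ⊗ (U ⊗ U ⊕ q ⊗ (V ⊗ V))
      B = 2* (g ⊗ g ⊗ (U ⊗ V))
      C-dissection : C ≗ dil 2 A ⊕ q ⊗ dil 2 B
      C-dissection = trans C≗ (trans (*-congˡ (*-cong W-dissection W-dissection)) (trans
        (solve 4 (λ g q U V → g :* g :* ((U :+ q :* V) :* (U :+ q :* V))
           := g :* g :* (U :* U :+ q :* q :* (V :* V)) :+ q :* (con (+ 2) :* (g :* g :* (U :* V))))
           refl g₂ q (dil 2 U) (dil 2 V))
        (sym (+-cong
          (push-⊗ 2 (dil-⊗ 2 g g) (push-⊕ 2 (dil-⊗ 2 U U) (push-⊗ 2 push-q (dil-⊗ 2 V V))))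
          (*-congˡ (push-ι 2 (+ 2) (push-⊗ 2 (dil-⊗ 2 g g) (dil-⊗ 2 U V))))))))

    odd-g²UV : ∃ λ t → ∀ n → (g ⊗ g ⊗ (U ⊗ V)) (suc (n ℕ.* 2)) ≡ + 4 ℤ.* dil 2 (p₂ ⊗ p₃) n ℤ.+ + 8 ℤ.* t n
    odd-g²UV = let t , e = g²UV≈₈ in odd t , λ n → ≡.trans (e (suc (n ℕ.* 2))) (≡.trans (⊕-coeff _ (8* t) _)
      (cong₂ ℤ._+_ (≡.trans (odd-dil E₀ (4* (dil 2 (p₂ ⊗ p₃))) n) (ι-coeff (+ 4) (dil 2 (p₂ ⊗ p₃)) n))
        (ι-coeff (+ 8) t (suc (n ℕ.* 2)))))

    -- Odd coefficients are taken twice: 4n + 3 = 2(2n + 1) + 1.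
    C-4n+3 : ∃ λ t → ∀ n → C (suc (suc (n ℕ.* 2) ℕ.* 2)) ≡ + 8 ℤ.* dil 2 (p₂ ⊗ p₃) n ℤ.+ + 16 ℤ.* t n
    C-4n+3 = let t , e = odd-g²UV in t , λ n → ≡.trans (odd-C (suc (n ℕ.* 2))) (≡.trans (ι-coeff (+ 2) _ (suc (n ℕ.* 2)))
      (≡.trans (cong (λ x → + 2 ℤ.* x) (e n))
        (ℤ-solve 2 (λ x y → ℤ-con (+ 2) ⊛ (ℤ-con (+ 4) ⊛ x ⊞ ℤ-con (+ 8) ⊛ y) ≐ ℤ-con (+ 8) ⊛ x ⊞ ℤ-con (+ 16) ⊛ y)
          ≡.refl (dil 2 (p₂ ⊗ p₃) n) (t n))))
      where open Data.Integer.Solver.+-*-Solver using ()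
              renaming (solve to ℤ-solve; con to ℤ-con; _:*_ to _⊛_; _:+_ to _⊞_; _:=_ to _≐_)

≡ℤ0mod-multiple : ∀ {x} d y → x ≡ + d ℤ.* y → x ≡ℤ0mod d
≡ℤ0mod-multiple d y ≡.refl = divides ℤ.∣ y ∣ (≡.trans (ℤ.abs-* (+ d) y) (ℕ.*-comm d ℤ.∣ y ∣))

open import Data.Nat using (_+_; _*_)
open SeriesRing using (_⊗_)
open SeriesOperations using (dil; dil-miss; odd≢even)
open OddPart using (p₂; p₃)

theorem3p2 : (CP3 : ℕ → ℤ)
    → (∀ n → (CP3 · ((f 1 ^s 2) · (f 2 ^s 2))) n ≡ ((f 3 ^s 6) · (f 6 ^s 6)) n)
    → ∀ n → (CP3 (8 * n + 3) ≡ℤ0mod 8) × (CP3 (8 * n + 7) ≡ℤ0mod 16)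
theorem3p2 CP3 CP3-eq n = let t , e = OddPart.C-4n+3 CP3 CP3-eq in
  -- Index 2n: 4(2n) + 3 = 8n + 3, and 8w + 16t has the factor 8.
  subst (λ i → CP3 i ≡ℤ0mod 8)
    (ℕ-solve 1 (λ n → ℕ-con 1 ⊞ (ℕ-con 1 ⊞ n ⊛ ℕ-con 2 ⊛ ℕ-con 2) ⊛ ℕ-con 2 ≐ ℕ-con 8 ⊛ n ⊞ ℕ-con 3) ≡.refl n)
    (≡ℤ0mod-multiple 8 (w (n * 2) ℤ.+ + 2 ℤ.* t (n * 2)) (≡.trans (e (n * 2))
      (ℤ-solve 2 (λ x y → ℤ-con (+ 8) ⊡ x ⊹ ℤ-con (+ 16) ⊡ y ≑ ℤ-con (+ 8) ⊡ (x ⊹ ℤ-con (+ 2) ⊡ y))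
        ≡.refl (w (n * 2)) (t (n * 2)))))
  -- Index 2n + 1: 4(2n + 1) + 3 = 8n + 7, an odd position, where the series `w` in q² has
  -- coefficient 0 and only 16t remains.
  , subst (λ i → CP3 i ≡ℤ0mod 16)
    (ℕ-solve 1 (λ n → ℕ-con 1 ⊞ (ℕ-con 1 ⊞ (ℕ-con 1 ⊞ n ⊛ ℕ-con 2) ⊛ ℕ-con 2) ⊛ ℕ-con 2 ≐ ℕ-con 8 ⊛ n ⊞ ℕ-con 7) ≡.refl n)
    (≡ℤ0mod-multiple 16 (t (suc (n * 2))) (≡.trans (e (suc (n * 2)))
      (≡.trans (cong (λ x → + 8 ℤ.* x ℤ.+ + 16 ℤ.* t (suc (n * 2))) w-odd) (ℤ.+-identityˡ _))))
  where
  w = dil 2 (p₂ ⊗ p₃)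
  w-odd : w (suc (n * 2)) ≡ 0ℤ
  w-odd = dil-miss 1 (p₂ ⊗ p₃) (suc (n * 2)) (odd≢even n)
  open Data.Nat.Solver.+-*-Solver using ()
    renaming (solve to ℕ-solve; con to ℕ-con; _:*_ to _⊛_; _:+_ to _⊞_; _:=_ to _≐_)
  open Data.Integer.Solver.+-*-Solver using ()
    renaming (solve to ℤ-solve; con to ℤ-con; _:*_ to _⊡_; _:+_ to _⊹_; _:=_ to _≑_)
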